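{- For $p,q\in\mathbb{N}$ with $1\le q<p$ define \[ N(p,q)=\sum_{j\vdash q-1}\ \sum_{k\vdash p-q}\left(\prod_{i=1}^{q-1} j_i!\,i^{j_i}\prod_{i=1}^{p-q}k_i!\,i^{k_i}\right)^{ -1}\prod_{a,b=1}^{p-q}\Bigl(1+\sum_{d\mid \operatorname{lcm}(a,b)} d\,j_d\Bigr)^{k_ak_b\gcd(a,b)}. \] Then for every $n\in\mathbb{N}$, the number of nilpotent semigroups of degree $3$ of order $n$ up to isomorphism equals \[ \sum_{m=2}^{a(n)}\bigl(N(n,m)-N(n-1,m-1)\bigr),\qquad a(n)=\left\lfloor n+\tfrac12-\sqrt{n-\tfrac34}\,\right\rfloor. \]
   Context: A semigroup $S$ is nilpotent of degree $3$ if, writing $S^r=\{s_1\cdots s_r: s_i\in S\}$, we have $|S^3|=1$ and $|S^2|>1$. For $n\ge 0$, $j\vdash n$ means $j$ is a partition of $n$ (the empty partition if $n=0$), and $j_i$ denotes the number of parts of $j$ equal to $i$ (so $j_i=0$ for $i>n$). Sums over $d\mid t$ range over positive divisors $d$ of $t$. -}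

module Defs where

open import Level using (0ℓ; _⊔_) renaming (suc to lsuc)
open import Algebra.Bundles using (Semigroup; RawMagma)
open import Algebra.Morphism.Structures using (module MagmaMorphisms)
import Algebra.Morphism.Construct.Identity as Id
import Algebra.Morphism.Construct.Composition as Comp
open import Data.Empty using (⊥; ⊥-elim)
open import Data.Fin.Base using (Fin)
import Data.Integer.Base as ℤ
import Data.Integer.Properties as ℤₚ
open import Data.List.Base
  using (List; []; _∷_; _++_; map; foldr; filter; length; applyUpTo)
open import Data.List.Properties using (∷-injectiveˡ; ∷-injectiveʳ)
open import Data.List.Membership.Propositional using (_∈_)
open import Data.List.Membership.Propositional.Properties
  using (∈-++⁺ˡ; ∈-++⁺ʳ; ∈-++⁻; ∈-map⁺; ∈-map⁻)
open import Data.List.Relation.Unary.All as All using (All; []; _∷_)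
import Data.List.Relation.Unary.All.Properties as Allₚ
open import Data.List.Relation.Unary.Any using (here)
open import Data.List.Relation.Unary.Linked using (Linked; []; [-]; _∷_)
import Data.List.Relation.Unary.Linked as Linked
open import Data.List.Relation.Unary.Unique.Propositional using (Unique)
open import Data.List.Relation.Unary.AllPairs using ([]; _∷_)
import Data.List.Relation.Unary.Unique.Propositional.Properties as Uniqueₚ
open import Data.Nat.Base
  using (ℕ; zero; suc; _+_; _*_; _∸_; _^_; _!; _≤_; _<_; _≥_; z≤n; s≤s; NonZero)
import Data.Nat.Properties as ℕₚ
open import Data.Nat.Divisibility using (_∣?_)
open import Data.Nat.GCD using (gcd)
open import Data.Nat.LCM using (lcm)
open import Data.Nat.ListAction using (sum; product)
open import Data.Nat.ListAction.Properties using (product≢0)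
open import Data.Product using (Σ; Σ-syntax; ∃-syntax; _×_; _,_; proj₁; proj₂)
open import Data.Rational.Base using (ℚ; 0ℚ; 1ℚ; ½; _/_)
import Data.Rational.Base as ℚ
import Data.Rational.Properties as ℚₚ
open import Data.Rational.Solver using (module +-*-Solver)
import Data.Rational.Unnormalised.Base as ℚᵘ
import Data.Rational.Unnormalised.Properties as ℚᵘₚ
open import Data.Sum.Base using (inj₁; inj₂)
open import Data.Vec.Base using (Vec; foldr₁)
open import Function.Base using (_on_; id; _∘_)
open import Function.Bundles using (Inverse; _⇔_; mk⇔)
open import Relation.Binary.Bundles using (Setoid)
open import Relation.Binary.PropositionalEquality
  using (_≡_; refl; sym; trans; cong; cong₂; subst; subst₂)
import Relation.Binary.PropositionalEquality as ≡
import Relation.Binary.Construct.On as On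
open import Relation.Nullary using (¬_; Dec; yes; no)
open import Relation.Nullary.Decidable using (_×-dec_)

------------------------------------------------------------------------
-- Cardinality of a setoid, i.e. the number of its ≈-classes

HasSize : ∀ {a ℓ} → Setoid a ℓ → ℕ → Set (a ⊔ ℓ)
HasSize X n = Inverse X (≡.setoid (Fin n))

------------------------------------------------------------------------
-- Nilpotent semigroups of degree 3

-- Power S r is the subset S^r of S, as a setoid in its own right.

Power : Semigroup 0ℓ 0ℓ → (r : ℕ) → .{{NonZero r}} → Setoid 0ℓ 0ℓ
Power S (suc r) =
  On.setoid {B = Σ[ s ∈ Carrier ] Σ[ v ∈ Vec Carrier (suc r) ] s ≈ foldr₁ _∙_ v}
            setoid proj₁
  where open Semigroup S

IsNilpotentOfDegree3 : Semigroup 0ℓ 0ℓ → Set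
IsNilpotentOfDegree3 S =
  HasSize (Power S 3) 1 × (∃[ k ] HasSize (Power S 2) k × 1 < k)

record NilpotentSemigroup3 (n : ℕ) : Set₁ where
  field
    semigroup : Semigroup 0ℓ 0ℓ
    order     : HasSize (Semigroup.setoid semigroup) n
    nilpotent : IsNilpotentOfDegree3 semigroup

  open Semigroup semigroup public using (rawMagma)

infix 4 _≅_

_≅_ : ∀ {n} → NilpotentSemigroup3 n → NilpotentSemigroup3 n → Set
S ≅ T = ∃[ f ] MagmaMorphisms.IsMagmaIsomorphism S.rawMagma T.rawMagma f
  where
  module S = NilpotentSemigroup3 S
  module T = NilpotentSemigroup3 T

module _ {n : ℕ} where
  open MagmaMorphisms
  open NilpotentSemigroup3 using (semigroup)

  ≅-refl : {S : NilpotentSemigroup3 n} → S ≅ S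
  ≅-refl {S} = id , Id.isMagmaIsomorphism _ (Semigroup.refl (semigroup S))

  ≅-sym : {S T : NilpotentSemigroup3 n} → S ≅ T → T ≅ S
  ≅-sym {S} {T} (f , iso) = g , record
    { isMagmaMonomorphism = record
      { isMagmaHomomorphism = record
        { isRelHomomorphism = record
          { cong = λ {x} {y} x≈y → injective (T.trans (fg x) (T.trans x≈y (T.sym (fg y)))) }
        ; homo = λ x y → injective (T.trans (fg (x T.∙ y))
                   (T.sym (T.trans (homo (g x) (g y)) (T.∙-cong (fg x) (fg y)))))
        }
      ; injective = λ {x} {y} gx≈gy →
          T.trans (T.sym (fg x)) (T.trans (⟦⟧-cong gx≈gy) (fg y))
      }
    ; surjective = λ x → f x , λ z≈fx → injective (T.trans (fg _) z≈fx)
    }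
    where
    module S = Semigroup (semigroup S)
    module T = Semigroup (semigroup T)
    open IsMagmaIsomorphism iso

    g : T.Carrier → S.Carrier
    g y = proj₁ (surjective y)

    fg : ∀ y → f (g y) T.≈ y
    fg y = proj₂ (surjective y) S.refl

  ≅-trans : {S T U : NilpotentSemigroup3 n} → S ≅ T → T ≅ U → S ≅ U
  ≅-trans {U = U} (f , f-iso) (g , g-iso) =
    g ∘ f , Comp.isMagmaIsomorphism (Semigroup.trans (semigroup U)) f-iso g-iso

NilpotentSemigroups3UpToIso : ℕ → Setoid (lsuc 0ℓ) 0ℓ
NilpotentSemigroups3UpToIso n = record
  { Carrier       = NilpotentSemigroup3 n
  ; _≈_           = _≅_
  ; isEquivalence = record
    { refl  = λ {S} → ≅-refl {S = S}
    ; sym   = λ {S} {T} → ≅-sym {S = S} {T}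
    ; trans = λ {S} {T} {U} → ≅-trans {S = S} {T} {U}
    }
  }

------------------------------------------------------------------------
-- Partitions

record IsPartition (n : ℕ) (j : List ℕ) : Set where
  field
    decreasing : Linked _≥_ j
    positive   : All NonZero j
    total      : sum j ≡ n

-- boundedPartitions f m n lists the partitions of n with all parts ≤ m;
-- f is fuel, and any f ≥ n suffices.

boundedPartitions : ℕ → ℕ → ℕ → List (List ℕ)
boundedPartitions _       _       zero    = [] ∷ []
boundedPartitions zero    _       (suc _) = []
boundedPartitions (suc _) zero    (suc _) = []
boundedPartitions (suc f) (suc m) (suc n) with m ℕₚ.≤? n
... | yes _ = map (suc m ∷_) (boundedPartitions f (suc m) (n ∸ m))
              ++ boundedPartitions (suc f) m (suc n)
... | no _  = boundedPartitions (suc f) m (suc n)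

partitions : ℕ → List (List ℕ)
partitions n = boundedPartitions n n n

private
  ≥head : ∀ {m} {j : List ℕ} → Linked _≥_ (m ∷ j) → All (_≤ m) j
  ≥head [-]        = []
  ≥head (m≥x ∷ xs) = m≥x ∷ All.map (λ y≤x → ℕₚ.≤-trans y≤x m≥x) (≥head xs)

  cons-linked : ∀ {m} {j : List ℕ} → All (_≤ m) j → Linked _≥_ j → Linked _≥_ (m ∷ j)
  cons-linked {j = []}    _         _  = [-]
  cons-linked {j = _ ∷ _} (x≤m ∷ _) xs = x≤m ∷ xs

  bounded-sound : ∀ f m n {j} → j ∈ boundedPartitions f m n →
                  IsPartition n j × All (_≤ m) j
  bounded-sound f m zero (here refl) =
    record { decreasing = [] ; positive = [] ; total = refl } , []
  bounded-sound (suc f) (suc m) (suc n) j∈ with m ℕₚ.≤? n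
  ... | no _ with bounded-sound (suc f) m (suc n) j∈
  ...   | p , b = p , All.map ℕₚ.m≤n⇒m≤1+n b
  bounded-sound (suc f) (suc m) (suc n) j∈ | yes m≤n
    with ∈-++⁻ (map (suc m ∷_) (boundedPartitions f (suc m) (n ∸ m))) j∈
  ... | inj₂ j∈′ with bounded-sound (suc f) m (suc n) j∈′
  ...   | p , b = p , All.map ℕₚ.m≤n⇒m≤1+n b
  bounded-sound (suc f) (suc m) (suc n) j∈ | yes m≤n | inj₁ j∈′
    with ∈-map⁻ (suc m ∷_) j∈′
  ... | _ , i∈ , refl with bounded-sound f (suc m) (n ∸ m) i∈
  ...   | p , b = record
      { decreasing = cons-linked b decreasing
      ; positive   = _ ∷ positive
      ; total      = cong suc (trans (cong (m +_) total) (ℕₚ.m+[n∸m]≡n m≤n))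
      } , ℕₚ.≤-refl ∷ b
    where open IsPartition p

  bounded-complete : ∀ f m n {j} → n ≤ f → IsPartition n j → All (_≤ m) j →
                     j ∈ boundedPartitions f m n
  bounded-complete f m zero {[]} _ _ _ = here refl
  bounded-complete f m zero {zero ∷ j} _ p _ with IsPartition.positive p
  ... | () ∷ _
  bounded-complete f m zero {suc x ∷ j} _ p _ with IsPartition.total p
  ... | ()
  bounded-complete (suc f) m (suc n) {[]} _ p _ with IsPartition.total p
  ... | ()
  bounded-complete (suc f) zero (suc n) {zero ∷ j} _ p _ with IsPartition.positive p
  ... | () ∷ _
  bounded-complete (suc f) zero (suc n) {suc x ∷ j} _ _ (() ∷ _)
  bounded-complete (suc f) (suc m) (suc n) {x ∷ j} (s≤s n≤f) p (x≤ ∷ b)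
    with m ℕₚ.≤? n | x ℕₚ.≟ suc m
  ... | yes m≤n | yes refl = ∈-++⁺ˡ (∈-map⁺ (suc m ∷_)
        (bounded-complete f (suc m) (n ∸ m) (ℕₚ.≤-trans (ℕₚ.m∸n≤m n m) n≤f)
          record
            { decreasing = Linked.tail decreasing
            ; positive   = All.tail positive
            ; total      = trans (sym (ℕₚ.m+n∸m≡n m (sum j)))
                                 (cong (_∸ m) (ℕₚ.suc-injective total))
            }
          b))
    where open IsPartition p
  ... | no m≰n | yes refl = ⊥-elim (m≰n (subst (m ≤_)
          (ℕₚ.suc-injective (IsPartition.total p)) (ℕₚ.m≤m+n m (sum j))))
  ... | yes _ | no x≢ = ∈-++⁺ʳ (map (suc m ∷_) (boundedPartitions f (suc m) (n ∸ m)))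
        (bounded-complete (suc f) m (suc n) (s≤s n≤f) p
          (x≤m ∷ All.map (λ y≤x → ℕₚ.≤-trans y≤x x≤m) (≥head (IsPartition.decreasing p))))
    where x≤m = ℕₚ.≤-pred (ℕₚ.≤∧≢⇒< x≤ x≢)
  ... | no _ | no x≢ = bounded-complete (suc f) m (suc n) (s≤s n≤f) p
          (x≤m ∷ All.map (λ y≤x → ℕₚ.≤-trans y≤x x≤m) (≥head (IsPartition.decreasing p)))
    where x≤m = ℕₚ.≤-pred (ℕₚ.≤∧≢⇒< x≤ x≢)

  bounded-unique : ∀ f m n → Unique (boundedPartitions f m n)
  bounded-unique _       _       zero    = [] ∷ []
  bounded-unique zero    _       (suc _) = []
  bounded-unique (suc _) zero    (suc _) = []
  bounded-unique (suc f) (suc m) (suc n) with m ℕₚ.≤? n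
  ... | no _  = bounded-unique (suc f) m (suc n)
  ... | yes _ = Uniqueₚ.++⁺
      (Uniqueₚ.map⁺ ∷-injectiveʳ (bounded-unique f (suc m) (n ∸ m)))
      (bounded-unique (suc f) m (suc n))
      λ { (j∈₁ , j∈₂) → disjoint j∈₁ j∈₂ }
    where
    disjoint : ∀ {j} → j ∈ map (suc m ∷_) (boundedPartitions f (suc m) (n ∸ m)) →
               j ∈ boundedPartitions (suc f) m (suc n) → ⊥
    disjoint j∈₁ j∈₂ with ∈-map⁻ (suc m ∷_) j∈₁
    ... | _ , _ , refl with proj₂ (bounded-sound (suc f) m (suc n) j∈₂)
    ...   | 1+m≤m ∷ _ = ℕₚ.1+n≰n 1+m≤m

  parts≤sum : (j : List ℕ) → All (_≤ sum j) j
  parts≤sum []      = []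
  parts≤sum (x ∷ j) =
    ℕₚ.m≤m+n x (sum j) ∷ All.map (λ y≤ → ℕₚ.≤-trans y≤ (ℕₚ.m≤n+m (sum j) x)) (parts≤sum j)

∈-partitions⇔ : ∀ {n j} → j ∈ partitions n ⇔ IsPartition n j
∈-partitions⇔ {n} {j} = mk⇔
  (proj₁ ∘ bounded-sound n n n)
  (λ p → bounded-complete n n n ℕₚ.≤-refl p
    (subst (λ s → All (_≤ s) j) (IsPartition.total p) (parts≤sum j)))

partitions-unique : ∀ n → Unique (partitions n)
partitions-unique n = bounded-unique n n n

mult : List ℕ → ℕ → ℕ
mult j i = length (filter (i ℕₚ.≟_) j)

------------------------------------------------------------------------
-- The numbers N(p,q)

[_⋯_] : ℕ → ℕ → List ℕ
[ l ⋯ u ] = applyUpTo (l +_) (suc u ∸ l)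

∏[1⋯_] : ℕ → (ℕ → ℕ) → ℕ
∏[1⋯ n ] f = product (map f [ 1 ⋯ n ])

∑ : ∀ {a} {A : Set a} → List A → (A → ℚ) → ℚ
∑ xs f = foldr ℚ._+_ 0ℚ (map f xs)

fromℕ : ℕ → ℚ
fromℕ n = ℤ.+ n / 1

divisors : ℕ → List ℕ
divisors t = filter (_∣? t) [ 1 ⋯ t ]

centraliserOrder : ℕ → List ℕ → ℕ
centraliserOrder n j = ∏[1⋯ n ] λ i → mult j i ! * i ^ mult j i

centraliserOrder≢0 : ∀ {n j} → NonZero (centraliserOrder n j)
centraliserOrder≢0 {n} {j} =
  product≢0 (Allₚ.map⁺ (Allₚ.applyUpTo⁺₂ (1 +_) n factor≢0))
  where
  factor≢0 : ∀ i → NonZero (mult j (suc i) ! * suc i ^ mult j (suc i))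
  factor≢0 i = ℕₚ.m*n≢0 _ _ {{ℕₚ._!≢0 (mult j (suc i))}} {{ℕₚ.m^n≢0 (suc i) (mult j (suc i))}}

-- Only meaningful for 1 ≤ q < p, where _∸_ is true subtraction.

N : ℕ → ℕ → ℚ
N p q =
  ∑ (partitions (q ∸ 1)) λ j →
  ∑ (partitions (p ∸ q)) λ k →
    (ℤ.+ 1 / (centraliserOrder (q ∸ 1) j * centraliserOrder (p ∸ q) k))
      {{ℕₚ.m*n≢0 _ _ {{centraliserOrder≢0 {q ∸ 1} {j}}} {{centraliserOrder≢0 {p ∸ q} {k}}}}}
    ℚ.* fromℕ (∏[1⋯ p ∸ q ] λ a → ∏[1⋯ p ∸ q ] λ b →
          (1 + sum (map (λ d → d * mult j d) (divisors (lcm a b))))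
            ^ (mult k a * mult k b * gcd a b))

------------------------------------------------------------------------
-- ⌊ x − √y ⌋ for rational x and y ≥ 0

-- r ≤ x − √y as reals, i.e. √y ≤ x − r.

_≤_-√_ : ℚ → ℚ → ℚ → Set
r ≤ x -√ y = 0ℚ ℚ.≤ x ℚ.- r × y ℚ.≤ (x ℚ.- r) ℚ.* (x ℚ.- r)

_≤?_-√_ : ∀ r x y → Dec (r ≤ x -√ y)
r ≤? x -√ y = (0ℚ ℚₚ.≤? x ℚ.- r) ×-dec (y ℚₚ.≤? (x ℚ.- r) ℚ.* (x ℚ.- r))

IsFloor : ℕ → ℚ → ℚ → Set
IsFloor m x y = fromℕ m ≤ x -√ y × ¬ (fromℕ (suc m) ≤ x -√ y)

-- The largest m with 1 ≤ m ≤ u satisfying P (0 if there is none).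

largest : ∀ {P : ℕ → Set} → (∀ m → Dec (P m)) → ℕ → ℕ
largest P? zero    = zero
largest P? (suc u) with P? (suc u)
... | yes _ = suc u
... | no _  = largest P? u

-- a n = ⌊ n + ½ − √(n − ¾) ⌋ for n ≥ 1, by a-isFloor below.

a : ℕ → ℕ
a n = largest (λ m → fromℕ m ≤? fromℕ n ℚ.+ ½ -√ (fromℕ n ℚ.- ℤ.+ 3 / 4)) n

private
  largest-spec : ∀ {P : ℕ → Set} (P? : ∀ m → Dec (P m)) u → P 0 → ¬ P (suc u) →
                 P (largest P? u) × ¬ P (suc (largest P? u))
  largest-spec P? zero    lo hi = lo , hi
  largest-spec P? (suc u) lo hi with P? (suc u)
  ... | yes p = p , hi
  ... | no ¬p = largest-spec P? u lo ¬p

  fromℕ-suc : ∀ n → fromℕ (suc n) ≡ 1ℚ ℚ.+ fromℕ n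
  fromℕ-suc n = ℚₚ.toℚᵘ-injective (begin
    ℚ.toℚᵘ (fromℕ (suc n))                ≈⟨ ℚₚ.toℚᵘ-fromℚᵘ (ℚᵘ.mkℚᵘ (ℤ.+ suc n) 0) ⟩
    ℚᵘ.mkℚᵘ (ℤ.+ suc n) 0                 ≈⟨ ℚᵘ.*≡* (cong (ℤ._* ℤ.+ 1) (cong (λ z → ℤ.+ 1 ℤ.+ z) (sym (ℤₚ.*-identityʳ (ℤ.+ n))))) ⟩
    ℚ.toℚᵘ 1ℚ ℚᵘ.+ ℚᵘ.mkℚᵘ (ℤ.+ n) 0      ≈⟨ ℚᵘₚ.+-congʳ (ℚ.toℚᵘ 1ℚ) (ℚₚ.toℚᵘ-fromℚᵘ (ℚᵘ.mkℚᵘ (ℤ.+ n) 0)) ⟨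
    ℚ.toℚᵘ 1ℚ ℚᵘ.+ ℚ.toℚᵘ (fromℕ n)       ≈⟨ ℚₚ.toℚᵘ-homo-+ 1ℚ (fromℕ n) ⟨
    ℚ.toℚᵘ (1ℚ ℚ.+ fromℕ n)               ∎)
    where open ℚᵘₚ.≃-Reasoning

  0≤fromℕ : ∀ n → 0ℚ ℚ.≤ fromℕ n
  0≤fromℕ zero    = ℚₚ.≤-refl
  0≤fromℕ (suc n) = subst (0ℚ ℚ.≤_) (sym (fromℕ-suc n))
    (ℚₚ.+-mono-≤ (ℚₚ.nonNegative⁻¹ 1ℚ) (0≤fromℕ n))

  open +-*-Solver

  lower-identity : ∀ q → (q ℚ.- ℤ.+ 3 / 4) ℚ.+ (q ℚ.* q ℚ.+ 1ℚ) ≡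
                         (q ℚ.+ ½ ℚ.- 0ℚ) ℚ.* (q ℚ.+ ½ ℚ.- 0ℚ)
  lower-identity = solve 1
    (λ t → (t :+ con (ℚ.- (ℤ.+ 3 / 4))) :+ (t :* t :+ con 1ℚ) :=
           (t :+ con ½ :+ con 0ℚ) :* (t :+ con ½ :+ con 0ℚ)) refl

  upper-identity : ∀ q → q ℚ.+ ½ ℚ.- (1ℚ ℚ.+ q) ≡ ℚ.- ½
  upper-identity = solve 1 (λ t → (t :+ con ½) :- (con 1ℚ :+ t) := con (ℚ.- ½)) refl

  lower : ∀ q → 0ℚ ℚ.≤ q → 0ℚ ≤ q ℚ.+ ½ -√ (q ℚ.- ℤ.+ 3 / 4)
  lower q 0≤q =
      subst (0ℚ ℚ.≤_) (sym (ℚₚ.+-identityʳ (q ℚ.+ ½)))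
        (ℚₚ.+-mono-≤ 0≤q (ℚₚ.nonNegative⁻¹ ½))
    , subst₂ ℚ._≤_ (ℚₚ.+-identityʳ (q ℚ.- ℤ.+ 3 / 4)) (lower-identity q)
        (ℚₚ.+-monoʳ-≤ (q ℚ.- ℤ.+ 3 / 4) 0≤q*q+1)
    where
    0≤q*q+1 : 0ℚ ℚ.≤ q ℚ.* q ℚ.+ 1ℚ
    0≤q*q+1 = ℚₚ.+-mono-≤
      (subst (ℚ._≤ q ℚ.* q) (ℚₚ.*-zeroʳ q)
        (ℚₚ.*-monoˡ-≤-nonNeg q {{ℚ.nonNegative 0≤q}} 0≤q))
      (ℚₚ.nonNegative⁻¹ 1ℚ)

  0≰-½ : ¬ (0ℚ ℚ.≤ ℚ.- ½)
  0≰-½ (ℚ.*≤* ())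

  upper : ∀ q r {y} → r ≡ 1ℚ ℚ.+ q → ¬ (r ≤ q ℚ.+ ½ -√ y)
  upper q r r≡1+q (0≤ , _) = 0≰-½ (subst (0ℚ ℚ.≤_)
    (trans (cong (λ z → q ℚ.+ ½ ℚ.- z) r≡1+q) (upper-identity q)) 0≤)

a-isFloor : ∀ n → .{{NonZero n}} →
            IsFloor (a n) (fromℕ n ℚ.+ ½) (fromℕ n ℚ.- ℤ.+ 3 / 4)
a-isFloor n = largest-spec
  (λ m → fromℕ m ≤? fromℕ n ℚ.+ ½ -√ (fromℕ n ℚ.- ℤ.+ 3 / 4)) n
  (lower (fromℕ n) (0≤fromℕ n))
  (upper (fromℕ n) (fromℕ (suc n)) (fromℕ-suc n))

{-# OPTIONS --safe #-}

-- A nilpotent semigroup S of degree 3 is given by its generators, the elements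
-- outside S², and a table of their products: all other products are zero, and
-- any table with values in S² whose nonzero entries exhaust S² ∖ {0} occurs.
-- With k generators and |S²| = m the isomorphism classes are thus the orbits of
-- Sₖ × Sₘ₋₁ on such tables. The orbits on all tables are counted by N(k + m, m),
-- and the tables missing a nonzero value are, up to relabelling, tables with one
-- value fewer, counted by N(k + m − 1, m − 1). A table has k² entries, so
-- m − 1 ≤ k², which is the bound a(n) on m.
--
-- For N, Burnside's lemma asks for the pairs (σ , τ) together with a fixed table,
-- that is an equivariant map from (σ × σ) to 1 ⊎ τ. Cycles of lengths a and b
-- multiply to gcd(a,b) cycles of length lcm(a,b), and an equivariant map out of a
-- cycle of length l is a point with period l, of which there are 1 + Σ d over the
-- cycle lengths d ∣ l of τ. Inserting a point into a permutation either adds a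
-- fixed point or lengthens a cycle, and the averages over partitions with weight
-- 1 / ∏ jᵢ! i^jᵢ obey the same recursion, by marking one part of the partition.

module Submission where

open import Defs
open import Algebra.Bundles using (Group; Semigroup)
import Algebra.Construct.DirectProduct as DirectProduct
open import Algebra.Morphism.Structures using (module MagmaMorphisms)
open import Algebra.Structures using (IsCommutativeMonoid)
open import Level using (0ℓ; _⊔_)
open import Data.Bool.Base using (true; false; if_then_else_)
open import Data.Empty using (⊥; ⊥-elim)
open import Data.Fin.Base as Fin using (Fin; zero; suc; toℕ; punchIn; punchOut)
import Data.Fin.Permutation as Perm
open Perm using (Permutation′; _⟨$⟩ʳ_; _⟨$⟩ˡ_; lift₀; flip)
import Data.Fin.Permutation.Components as PC
import Data.Fin.Properties as Finₚ
import Data.Integer.Base as ℤ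
import Data.Integer.Properties as ℤₚ
open import Data.List.Base using (List; []; _∷_; map; foldr; filter; length; applyUpTo)
import Data.List.Properties as Listₚ
open import Data.List.Membership.Propositional using (_∈_; _∉_)
open import Data.List.Membership.Propositional.Properties
  using (∈-map⁺; ∈-map⁻; ∈-filter⁺; ∈-filter⁻; ∈-applyUpTo⁺; ∈-applyUpTo⁻)
open import Data.List.Membership.Propositional.Properties.WithK using (unique∧set⇒bag)
open import Data.List.Relation.Binary.BagAndSetEquality using (∼bag⇒↭)
open import Data.List.Relation.Binary.Permutation.Propositional as ↭
  using (_↭_; ↭-refl; ↭-sym; ↭-trans; prep)
import Data.List.Relation.Binary.Permutation.Propositional.Properties as ↭ₚ
open import Data.List.Relation.Binary.Pointwise using (Pointwise-≡⇒≡)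
open import Data.List.Relation.Unary.All as All using (All; []; _∷_)
import Data.List.Relation.Unary.All.Properties as Allₚ
open import Data.List.Relation.Unary.AllPairs using ([]; _∷_)
open import Data.List.Relation.Unary.Any using (here; there)
open import Data.List.Relation.Unary.Linked using (Linked)
import Data.List.Relation.Unary.Sorted.TotalOrder.Properties as Sortedₚ
open import Data.List.Relation.Unary.Unique.Propositional using (Unique)
import Data.List.Relation.Unary.Unique.Propositional.Properties as Uniqueₚ
import Data.List.Sort as Sort
open import Data.Maybe.Base as Maybe using (Maybe; nothing; just)
import Data.Maybe.Properties as Maybeₚ
open import Data.Nat.Base
  using (ℕ; zero; suc; _+_; _*_; _∸_; _^_; _!; _≤_; _<_; _≥_; z≤n; s≤s;
         NonZero; ≢-nonZero; ≢-nonZero⁻¹)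
open import Data.Nat.Divisibility using (_∣_; _∣?_; divides; ∣⇒≤; m%n≡0⇒n∣m; n∣m⇒m%n≡0)
open import Data.Nat.DivMod
open import Data.Nat.GCD using (gcd; gcd[m,n]∣m; gcd[m,n]∣n)
open import Data.Nat.GeneralisedArithmetic using (fold)
open import Data.Nat.LCM using (lcm; m∣lcm[m,n]; n∣lcm[m,n]; lcm-least; gcd*lcm)
open import Data.Nat.ListAction using (sum; product)
open import Data.Nat.ListAction.Properties using (sum-↭)
import Data.Nat.Properties as ℕₚ
open import Data.List.Membership.DecPropositional ℕₚ._≟_ using (_∈?_)
open import Data.Nat.Solver using () renaming (module +-*-Solver to ℕ-Solver)
open import Data.Product as Product
  using (Σ; Σ-syntax; ∃-syntax; _×_; _,_; proj₁; proj₂; uncurry)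
open import Data.Product.Relation.Binary.Pointwise.NonDependent using (_×ₛ_)
open import Data.Rational.Base as ℚ using (ℚ; 0ℚ; 1ℚ; ½; _-_)
import Data.Rational.Properties as ℚₚ
open import Data.Rational.Solver using () renaming (module +-*-Solver to ℚ-Solver)
import Data.Rational.Unnormalised.Base as ℚᵘ
import Data.Rational.Unnormalised.Properties as ℚᵘₚ
open import Data.Sum.Base as Sum using (_⊎_; inj₁; inj₂; [_,_]′)
import Data.Sum.Properties as Sumₚ
open import Data.Sum.Relation.Binary.Pointwise using (_⊎ₛ_; inj₁; inj₂)
open import Data.Vec.Base using ([]; _∷_)
open import Function.Base using (_∘_; id)
open import Function.Bundles using (Inverse; _↔_; mk↔ₛ′; mk⇔; Equivalence)
import Function.Construct.Composition as Compose
import Function.Construct.Symmetry as Symmetry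
open import Relation.Binary.Bundles using (Setoid)
import Relation.Binary.Construct.Flip.EqAndOrd as Flip
import Relation.Binary.Construct.On as On
open import Relation.Binary.Definitions using (DecidableEquality; tri<; tri≈; tri>)
open import Relation.Binary.PropositionalEquality
  using (_≡_; _≢_; _≗_; refl; sym; trans; cong; cong₂; subst; subst₂; module ≡-Reasoning)
import Relation.Binary.PropositionalEquality as ≡
open import Relation.Nullary using (¬_; Dec; yes; no; does)
open import Relation.Nullary.Decidable using (dec-true; dec-false; map′; ¬?)

-- Tables and permutations are functions and semigroups carry their own equality, so everything is
-- counted as a setoid, and pointwise equality does the work of extensionality. Finiteness also
-- supplies the decisions that a count requires: equivalence of tables is decided by searching the
-- group, and membership in S² by searching all pairs of factors, which splits S into generators and
-- S². The obstacle in the Burnside count is the cycle type of a permutation. No permutation is ever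
-- decomposed into cycles, and no conjugacy class is counted. Generating all permutations by
-- insertion equips each of them with a conjugacy to a standard union of cycles, and the class sizes
-- n! / ∏ jᵢ! i^jᵢ enter only through a recursion that the weighted sum over partitions shares with
-- the sum over permutations. An isomorphism respects S² and the zero. Hence it permutes the
-- generators and the m - 1 nonzero elements of S² separately, which is the group Sₖ × Sₘ₋₁. The
-- bound a(n) enters in one direction: every semigroup has its |S²| in the range of summation, and
-- each m in the range contributes exactly its own number of classes.

-- Sizes of setoids

bijection⇒inverse : ∀ {a ℓ b m} (X : Setoid a ℓ) (Y : Setoid b m) →
  (f : Setoid.Carrier X → Setoid.Carrier Y) →
  (∀ {x y} → Setoid._≈_ X x y → Setoid._≈_ Y (f x) (f y)) →
  (∀ {x y} → Setoid._≈_ Y (f x) (f y) → Setoid._≈_ X x y) →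
  (∀ y → Σ[ x ∈ Setoid.Carrier X ] Setoid._≈_ Y (f x) y) →
  Inverse X Y
bijection⇒inverse X Y f f-cong f-inj f-surj = record
  { to        = f
  ; from      = λ y → proj₁ (f-surj y)
  ; to-cong   = f-cong
  ; from-cong = λ {y} {z} y≈z → f-inj
      (Y.trans (proj₂ (f-surj y)) (Y.trans y≈z (Y.sym (proj₂ (f-surj z)))))
  ; inverse   = (λ {y} x≈ → Y.trans (f-cong x≈) (proj₂ (f-surj y)))
              , (λ {x} {y} y≈ → f-inj (Y.trans (proj₂ (f-surj y)) y≈))
  }
  where
  module X = Setoid X
  module Y = Setoid Y

module _ {a ℓ b m} (X : Setoid a ℓ) (Y : Setoid b m) (e : Inverse X Y) where
  private
    module X = Setoid X
    module Y = Setoid Y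
  open Inverse e

  inverse-to-from : ∀ y → to (from y) Y.≈ y
  inverse-to-from y = inverseˡ {y} X.refl

  inverse-from-to : ∀ x → from (to x) X.≈ x
  inverse-from-to x = inverseʳ {x} Y.refl

  inverse-injective : ∀ x y → to x Y.≈ to y → x X.≈ y
  inverse-injective x y eq =
    X.trans (X.sym (inverse-from-to x)) (X.trans (from-cong eq) (inverse-from-to y))

representatives⇒size : ∀ {a ℓ} (X : Setoid a ℓ) {n} (r : Fin n → Setoid.Carrier X) →
  (∀ {i j} → Setoid._≈_ X (r i) (r j) → i ≡ j) →
  (∀ x → Σ[ i ∈ Fin n ] Setoid._≈_ X (r i) x) →
  HasSize X n
representatives⇒size X {n} r r-inj r-surj = Symmetry.inverse
  (bijection⇒inverse (≡.setoid (Fin n)) X r (λ { refl → Setoid.refl X }) r-inj r-surj)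

size-resp : ∀ {a ℓ b m} {X : Setoid a ℓ} {Y : Setoid b m} {n} →
            Inverse X Y → HasSize Y n → HasSize X n
size-resp = Compose.inverse

size-unique : ∀ {a ℓ} {X : Setoid a ℓ} {m n} → HasSize X m → HasSize X n → m ≡ n
size-unique s t = Perm.↔⇒≡ (Compose.inverse (Symmetry.inverse s) t)

module Size {a ℓ} {X : Setoid a ℓ} {n} (s : HasSize X n) where
  open Setoid X using (_≈_)
  open Inverse s public using (to; from; to-cong; from-cong)

  from-to : ∀ x → from (to x) ≈ x
  from-to x = Inverse.inverseʳ s refl

  to-from : ∀ i → to (from i) ≡ i
  to-from i = Inverse.inverseˡ s (Setoid.refl X)

  to-injective : ∀ {x y} → to x ≡ to y → x ≈ y
  to-injective {x} {y} eq =
    Setoid.trans X (Setoid.sym X (from-to x)) (Setoid.trans X (from-cong eq) (from-to y))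

  ≈-dec : ∀ x y → Dec (x ≈ y)
  ≈-dec x y with to x Finₚ.≟ to y
  ... | yes eq = yes (to-injective eq)
  ... | no neq = no (λ x≈y → neq (to-cong x≈y))

size-× : ∀ {a ℓ b k} {X : Setoid a ℓ} {Y : Setoid b k} {m n} →
         HasSize X m → HasSize Y n → HasSize (X ×ₛ Y) (m * n)
size-× {X = X} {Y} {m} {n} s t = size-resp
  (bijection⇒inverse (X ×ₛ Y) (≡.setoid (Fin m × Fin n))
    (λ { (x , y) → S.to x , T.to y })
    (λ { (p , q) → cong₂ _,_ (S.to-cong p) (T.to-cong q) })
    (λ eq → S.to-injective (cong proj₁ eq) , T.to-injective (cong proj₂ eq))
    (λ { (i , j) → (S.from i , T.from j) , cong₂ _,_ (S.to-from i) (T.to-from j) }))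
  (Symmetry.inverse Finₚ.*↔×)
  where
  module S = Size s
  module T = Size t

size-⊎ : ∀ {a ℓ b k} {X : Setoid a ℓ} {Y : Setoid b k} {m n} →
         HasSize X m → HasSize Y n → HasSize (X ⊎ₛ Y) (m + n)
size-⊎ {X = X} {Y} {m} {n} s t = size-resp
  (bijection⇒inverse (X ⊎ₛ Y) (≡.setoid (Fin m ⊎ Fin n)) f
    (λ { (inj₁ p) → cong inj₁ (S.to-cong p) ; (inj₂ q) → cong inj₂ (T.to-cong q) })
    f-inj
    (λ { (inj₁ i) → inj₁ (S.from i) , cong inj₁ (S.to-from i)
       ; (inj₂ j) → inj₂ (T.from j) , cong inj₂ (T.to-from j) }))
  (Symmetry.inverse Finₚ.+↔⊎)
  where
  module S = Size s
  module T = Size t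

  f : Setoid.Carrier (X ⊎ₛ Y) → Fin m ⊎ Fin n
  f (inj₁ x) = inj₁ (S.to x)
  f (inj₂ y) = inj₂ (T.to y)

  f-inj : ∀ {x y} → f x ≡ f y → Setoid._≈_ (X ⊎ₛ Y) x y
  f-inj {inj₁ x} {inj₁ y} eq = inj₁ (S.to-injective (Sumₚ.inj₁-injective eq))
  f-inj {inj₂ x} {inj₂ y} eq = inj₂ (T.to-injective (Sumₚ.inj₂-injective eq))

size-Fin : ∀ {n} → HasSize (≡.setoid (Fin n)) n
size-Fin = Perm.id

Functions : Set → ℕ → Setoid 0ℓ 0ℓ
Functions A m = A ≡.→-setoid Fin m

funToFin-cong : ∀ k {m} {f g : Fin k → Fin m} → f ≗ g → Fin.funToFin f ≡ Fin.funToFin g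
funToFin-cong zero    _   = refl
funToFin-cong (suc k) f≗g = cong₂ Fin.combine (f≗g zero) (funToFin-cong k (f≗g ∘ suc))

size-functions : ∀ {A : Set} {k} m → HasSize (≡.setoid A) k → HasSize (Functions A m) (m ^ k)
size-functions {A} {k} m s = representatives⇒size (Functions A m)
  (λ i x → Fin.finToFun {m} {k} i (S.to x))
  (λ {i} {j} eq → trans (sym (Finₚ.funToFin-finToFin {k} {m} i))
    (trans (funToFin-cong k (λ y → trans (cong (Fin.finToFun {m} {k} i) (sym (S.to-from y)))
       (trans (eq (S.from y)) (cong (Fin.finToFun {m} {k} j) (S.to-from y)))))
      (Finₚ.funToFin-finToFin {k} {m} j)))
  (λ f → Fin.funToFin {k} {m} (f ∘ S.from) , λ x →
    trans (Finₚ.finToFun-funToFin (f ∘ S.from) (S.to x)) (cong f (S.from-to x)))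
  where module S = Size s

-- Membership proofs are ignored by the equality, so elements are counted once even if `P` has
-- several proofs.
Sub : ∀ {a ℓ p} (X : Setoid a ℓ) (P : Setoid.Carrier X → Set p) → Setoid (a ⊔ p) ℓ
Sub X P = On.setoid {B = Σ (Setoid.Carrier X) P} X proj₁

size-empty : ∀ {a ℓ} {X : Setoid a ℓ} → ¬ Setoid.Carrier X → HasSize X 0
size-empty {X = X} ¬x = representatives⇒size X (λ ()) (λ { {()} }) (λ x → ⊥-elim (¬x x))

-- Representatives are found by scanning the enumeration `r` and keeping an element only if it is
-- equivalent to none of those kept already; this is where decidability enters. `Maybe` lets `r` run
-- over a larger set, with `nothing` outside the intended subset.
finite-quotient : ∀ {a ℓ} (X : Setoid a ℓ) → (∀ x y → Dec (Setoid._≈_ X x y)) →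
  ∀ {n} (r : Fin n → Maybe (Setoid.Carrier X)) →
  (∀ x → Σ[ i ∈ Fin n ] Σ[ y ∈ Setoid.Carrier X ] r i ≡ just y × Setoid._≈_ X y x) →
  ∃[ c ] HasSize X c
finite-quotient X _≈?_ {n} r r-surj with reps r
  where
  open Setoid X renaming (refl to ≈-refl; sym to ≈-sym; trans to ≈-trans)

  Reps : ∀ {n} → (Fin n → Maybe Carrier) → Set _
  Reps {n} r = Σ[ c ∈ ℕ ] Σ[ s ∈ (Fin c → Carrier) ] (∀ {i j} → s i ≈ s j → i ≡ j) ×
               (∀ i y → r i ≡ just y → Σ[ j ∈ Fin c ] s j ≈ y)

  reps : ∀ {n} (r : Fin n → Maybe Carrier) → Reps r
  reps {zero}  r = 0 , (λ ()) , (λ { {()} }) , λ ()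
  reps {suc n} r with reps (r ∘ suc) | r zero in r₀
  ... | c , s , s-inj , s-surj | nothing =
    c , s , s-inj , λ { zero y eq → ⊥-elim (absurd (trans (sym r₀) eq)) ; (suc i) → s-surj i }
    where
    absurd : ∀ {y} → nothing ≡ just {A = Carrier} y → ⊥
    absurd ()
  ... | c , s , s-inj , s-surj | just x with Finₚ.any? (λ j → s j ≈? x)
  ...   | yes (j , sj≈x) = c , s , s-inj , λ
    { zero y eq → j , ≈-trans sj≈x (reflexive (Maybeₚ.just-injective (trans (sym r₀) eq)))
    ; (suc i) → s-surj i }
  ...   | no ¬x = suc c , s′ , (λ {i} {j} → s′-inj i j) , λ
    { zero y eq → zero , reflexive (Maybeₚ.just-injective (trans (sym r₀) eq))
    ; (suc i) y eq → suc (proj₁ (s-surj i y eq)) , proj₂ (s-surj i y eq) }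
    where
    s′ : Fin (suc c) → Carrier
    s′ zero    = x
    s′ (suc j) = s j

    s′-inj : ∀ i j → s′ i ≈ s′ j → i ≡ j
    s′-inj zero    zero    _  = refl
    s′-inj zero    (suc j) eq = ⊥-elim (¬x (j , ≈-sym eq))
    s′-inj (suc i) zero    eq = ⊥-elim (¬x (i , eq))
    s′-inj (suc i) (suc j) eq = cong suc (s-inj eq)
... | c , s , s-inj , s-surj = c , representatives⇒size X s s-inj cover
  where
  cover : ∀ x → _
  cover x with r-surj x
  ... | i , y , eq , y≈x with s-surj i y eq
  ...   | j , sj≈y = j , Setoid.trans X sj≈y y≈x

-- Burnside's lemma

record Action (G : Group 0ℓ 0ℓ) (X : Setoid 0ℓ 0ℓ) : Set where
  private
    module G = Group G
    module X = Setoid X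
  field
    act      : G.Carrier → X.Carrier → X.Carrier
    act-cong : ∀ {g h x y} → g G.≈ h → x X.≈ y → act g x X.≈ act h y
    act-ε    : ∀ x → act G.ε x X.≈ x
    act-∙    : ∀ g h x → act (g G.∙ h) x X.≈ act g (act h x)

  act-⁻¹ˡ : ∀ g x → act (g G.⁻¹) (act g x) X.≈ x
  act-⁻¹ˡ g x = X.trans (X.sym (act-∙ (g G.⁻¹) g x))
    (X.trans (act-cong (G.inverseˡ g) X.refl) (act-ε x))

  act-⁻¹-swap : ∀ {g x y} → act g x X.≈ y → act (g G.⁻¹) y X.≈ x
  act-⁻¹-swap {g} {x} eq = X.trans (act-cong G.refl (X.sym eq)) (act-⁻¹ˡ g x)

  orbits : Setoid 0ℓ 0ℓ
  orbits = record
    { Carrier       = X.Carrier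
    ; _≈_           = λ x y → Σ[ g ∈ G.Carrier ] act g x X.≈ y
    ; isEquivalence = record
      { refl  = λ {x} → G.ε , act-ε x
      ; sym   = λ { (g , eq) → g G.⁻¹ , act-⁻¹-swap eq }
      ; trans = λ { {x} (g , eq) (h , eq′) → h G.∙ g ,
          X.trans (act-∙ h g x) (X.trans (act-cong G.refl eq) eq′) }
      }
    }

  FixedPairs : Setoid 0ℓ 0ℓ
  FixedPairs = Sub (G.setoid ×ₛ X) (λ (g , x) → act g x X.≈ x)

-- With rep x the chosen point of the orbit of x and t x a transporter from
-- rep x to x, the pairs (g , x) with g x ≈ x correspond to pairs of an orbit
-- and the group element g (t x), which carries rep x to x.

burnside : ∀ {G X} (A : Action G X) {m n c} →
  HasSize (Group.setoid G) m → HasSize X n → HasSize (Action.orbits A) c →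
  HasSize (Action.FixedPairs A) (c * m)
burnside {G} {X} A {m} {n} {c} sG sX sO =
  size-resp (bijection⇒inverse FixedPairs (≡.setoid (Fin c) ×ₛ G.setoid) f
      (λ {p} {q} → f-cong {p} {q}) (λ {p} {q} → f-inj {p} {q}) f-surj)
    (size-× size-Fin sG)
  where
  open Action A
  module G = Group G
  module X = Setoid X
  module O = Size sO
  module SX = Size sX

  -- Equal points could receive different transporters from `sO`. Passing to the point with the same
  -- index first makes `t` depend on the index alone, hence compatible with equality.
  canonical : X.Carrier → X.Carrier
  canonical x = SX.from (SX.to x)

  orbit : X.Carrier → Fin c
  orbit x = O.to x

  rep : X.Carrier → X.Carrier
  rep x = O.from (orbit (canonical x))

  t : X.Carrier → G.Carrier
  t x = proj₁ (O.from-to (canonical x))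

  t-rep : ∀ x → act (t x) (rep x) X.≈ x
  t-rep x = X.trans (proj₂ (O.from-to (canonical x))) (SX.from-to x)

  t-cong : ∀ {x y} → x X.≈ y → t x ≡ t y
  t-cong x≈y = cong (λ i → proj₁ (O.from-to (SX.from i))) (SX.to-cong x≈y)

  ≈⇒orbit : ∀ {x y} → x X.≈ y → orbit x ≡ orbit y
  ≈⇒orbit {x} x≈y = O.to-cong (G.ε , X.trans (act-ε x) x≈y)

  rep-orbit : ∀ {x y} → orbit x ≡ orbit y → rep x ≡ rep y
  rep-orbit {x} {y} eq = cong O.from
    (trans (≈⇒orbit (SX.from-to x)) (trans eq (sym (≈⇒orbit (SX.from-to y)))))

  f : Setoid.Carrier FixedPairs → Fin c × G.Carrier
  f ((g , x) , _) = orbit x , g G.∙ t x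

  f-cong : ∀ {p q} → Setoid._≈_ FixedPairs p q → _
  f-cong (g≈h , x≈y) = ≈⇒orbit x≈y , G.∙-cong g≈h (G.reflexive (t-cong x≈y))

  moves : ∀ {g x} → act g x X.≈ x → act (g G.∙ t x) (rep x) X.≈ x
  moves {g} {x} eq = X.trans (act-∙ g (t x) (rep x)) (X.trans (act-cong G.refl (t-rep x)) eq)

  f-inj : ∀ {p q} → Setoid._≈_ (≡.setoid (Fin c) ×ₛ G.setoid) (f p) (f q) →
          Setoid._≈_ FixedPairs p q
  f-inj {(g , x) , gx} {(h , y) , hy} (o , e) = cancel , x≈y
    where
    x≈y : x X.≈ y
    x≈y = X.trans (X.sym (moves gx))
      (X.trans (act-cong e (X.reflexive (rep-orbit {x} {y} o))) (moves hy))

    cancel : g G.≈ h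
    cancel = ∙-cancelʳ (t x) g h
      (G.trans e (G.∙-cong G.refl (G.reflexive (t-cong (X.sym x≈y)))))
      where open import Algebra.Properties.Group G using (∙-cancelʳ)

  f-surj : ∀ p → Σ[ q ∈ Setoid.Carrier FixedPairs ]
                 Setoid._≈_ (≡.setoid (Fin c) ×ₛ G.setoid) (f q) p
  f-surj (o , h) = ((h G.∙ t x G.⁻¹ , x) , fixes) , orbit-x ,
    G.trans (G.assoc h _ _) (G.trans (G.∙-cong G.refl (G.inverseˡ (t x))) (G.identityʳ h))
    where
    x : X.Carrier
    x = act h (O.from o)

    orbit-x : orbit x ≡ o
    orbit-x = trans (sym (O.to-cong (h , X.refl))) (O.to-from o)

    rep-x : rep x ≡ O.from o
    rep-x = cong O.from (trans (≈⇒orbit (SX.from-to x)) orbit-x)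

    fixes : act (h G.∙ t x G.⁻¹) x X.≈ x
    fixes = X.trans (act-∙ h (t x G.⁻¹) x) (act-cong G.refl
      (X.trans (act-⁻¹-swap (t-rep x)) (X.reflexive rep-x)))

-- Permutations

permutationGroup : ℕ → Group 0ℓ 0ℓ
permutationGroup n = record
  { Carrier = Permutation′ n
  ; _≈_     = Perm._≈_
  -- `∘ₚ` composes in diagrammatic order; reversing it makes the group act from the left.
  ; _∙_     = λ π ρ → ρ Perm.∘ₚ π
  ; ε       = Perm.id
  ; _⁻¹     = flip
  ; isGroup = record
    { isMonoid = record
      { isSemigroup = record
        { isMagma = record
          { isEquivalence = record
            { refl  = λ _ → refl
            ; sym   = λ p i → sym (p i)
            ; trans = λ p q i → trans (p i) (q i)
            }
          ; ∙-cong = λ {π} p q i → trans (cong (π ⟨$⟩ʳ_) (q i)) (p _)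
          }
        ; assoc = λ _ _ _ _ → refl
        }
      ; identity = (λ _ _ → refl) , λ _ _ → refl
      }
    ; inverse = (λ π _ → Perm.inverseˡ π) , λ π _ → Perm.inverseʳ π
    ; ⁻¹-cong = λ {π} {ρ} p i → trans (cong (π ⟨$⟩ˡ_) (sym (Perm.inverseʳ ρ)))
        (trans (cong (π ⟨$⟩ˡ_) (sym (p (ρ ⟨$⟩ˡ i)))) (Perm.inverseˡ π))
    }
  }

Permutations : ℕ → Setoid 0ℓ 0ℓ
Permutations n = Group.setoid (permutationGroup n)

permutation-injective : ∀ {m n} (π : Perm.Permutation m n) {i j} →
                        π ⟨$⟩ʳ i ≡ π ⟨$⟩ʳ j → i ≡ j
permutation-injective π eq =
  trans (sym (Perm.inverseˡ π)) (trans (cong (π ⟨$⟩ˡ_) eq) (Perm.inverseˡ π))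

transpose-left : ∀ {n} (i j : Fin n) → PC.transpose i j i ≡ j
transpose-left i j rewrite dec-true (i Finₚ.≟ i) refl = refl

transpose-right : ∀ {n} (i j : Fin n) → PC.transpose i j j ≡ i
transpose-right i j with j Finₚ.≟ i
... | yes j≡i = j≡i
... | no _ rewrite dec-true (j Finₚ.≟ j) refl = refl

transpose-other : ∀ {n} (i j : Fin n) {k} → k ≢ i → k ≢ j → PC.transpose i j k ≡ k
transpose-other i j {k} k≢i k≢j
  rewrite dec-false (k Finₚ.≟ i) k≢i | dec-false (k Finₚ.≟ j) k≢j = refl

-- extend π (suc x) inserts zero after x in its cycle; extend π zero makes
-- zero a fixed point.

extend : ∀ {n} → Permutation′ n → Fin (suc n) → Permutation′ (suc n)
extend π i = Perm.transpose zero i Perm.∘ₚ lift₀ π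

extend-at : ∀ {n} (π : Permutation′ n) i → extend π i ⟨$⟩ʳ i ≡ zero
extend-at π i = cong (lift₀ π ⟨$⟩ʳ_) (transpose-right zero i)

-- The inserted position is recovered as the preimage of zero, by `extend-at`. Undoing the
-- transposition then leaves a permutation that fixes zero, that is, one of `n` points.
permutations-suc : ∀ n → Inverse (Permutations n ×ₛ ≡.setoid (Fin (suc n))) (Permutations (suc n))
permutations-suc n = bijection⇒inverse _ (Permutations (suc n)) (uncurry extend) ext-cong ext-inj ext-surj
  where
  ext-cong : ∀ {p q} → Setoid._≈_ (Permutations n ×ₛ ≡.setoid (Fin (suc n))) p q →
             uncurry extend p Perm.≈ uncurry extend q
  ext-cong {π , i} {ρ , _} (π≈ρ , refl) k = Perm.lift₀-cong π ρ π≈ρ (PC.transpose zero i k)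

  ext-inj : ∀ {p q} → uncurry extend p Perm.≈ uncurry extend q →
            Setoid._≈_ (Permutations n ×ₛ ≡.setoid (Fin (suc n))) p q
  ext-inj {π , i} {ρ , j} eq with permutation-injective (extend ρ j) {i} {j}
      (trans (sym (eq i)) (trans (extend-at π i) (sym (extend-at ρ j))))
  ... | refl = (λ k → Finₚ.suc-injective (trans (sym (untranspose π k))
      (trans (eq (PC.transpose i zero (suc k))) (untranspose ρ k)))) , refl
    where
    untranspose : ∀ π k → extend π i ⟨$⟩ʳ PC.transpose i zero (suc k) ≡ suc (π ⟨$⟩ʳ k)
    untranspose π k = cong (lift₀ π ⟨$⟩ʳ_) (PC.transpose-inverse zero i)

  ext-surj : ∀ π → Σ[ p ∈ Permutation′ n × Fin (suc n) ] uncurry extend p Perm.≈ π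
  ext-surj π = (Perm.remove zero ρ , i) , λ k →
    trans (Perm.lift₀-remove ρ ρ₀ (PC.transpose zero i k))
          (cong (π ⟨$⟩ʳ_) (PC.transpose-inverse i zero))
    where
    i = π ⟨$⟩ˡ zero
    ρ = Perm.transpose i zero Perm.∘ₚ π

    ρ₀ : ρ ⟨$⟩ʳ zero ≡ zero
    ρ₀ = trans (cong (π ⟨$⟩ʳ_) (transpose-right i zero)) (Perm.inverseʳ π)

size-permutations : ∀ n → HasSize (Permutations n) (n !)
size-permutations zero    = representatives⇒size (Permutations 0) {1}
  (λ _ → Perm.id) (λ { {zero} {zero} _ → refl }) (λ _ → zero , λ ())
size-permutations (suc n) = subst (HasSize (Permutations (suc n))) (ℕₚ.*-comm (n !) (suc n))
  (size-resp (Symmetry.inverse (permutations-suc n)) (size-× (size-permutations n) size-Fin))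

-- Conjugate self-maps

infix 4 _≃_

record _≃_ {X Y : Set} (σ : X → X) (τ : Y → Y) : Set where
  constructor conj
  field
    iso        : X ↔ Y
    equivariant : ∀ x → Inverse.to iso (σ x) ≡ τ (Inverse.to iso x)

  open Inverse iso public using (to; from)

  to-from : ∀ y → to (from y) ≡ y
  to-from y = Inverse.inverseˡ iso refl

  from-to : ∀ x → from (to x) ≡ x
  from-to x = Inverse.inverseʳ iso refl

  to-injective : ∀ {x y} → to x ≡ to y → x ≡ y
  to-injective {x} {y} eq = trans (sym (from-to x)) (trans (cong from eq) (from-to y))

  from-equivariant : ∀ y → from (τ y) ≡ σ (from y)
  from-equivariant y = trans (cong from (trans (cong τ (sym (to-from y))) (sym (equivariant (from y)))))
                             (from-to _)

≃-refl : ∀ {X : Set} {σ : X → X} → σ ≃ σ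
≃-refl = conj (mk↔ₛ′ id id (λ _ → refl) (λ _ → refl)) (λ _ → refl)

≃-sym : ∀ {X Y : Set} {σ : X → X} {τ : Y → Y} → σ ≃ τ → τ ≃ σ
≃-sym e = conj (Symmetry.inverse iso) from-equivariant
  where open _≃_ e

≃-trans : ∀ {X Y Z : Set} {σ : X → X} {τ : Y → Y} {υ : Z → Z} → σ ≃ τ → τ ≃ υ → σ ≃ υ
≃-trans e f = conj (Compose.inverse E.iso F.iso)
  (λ x → trans (cong F.to (E.equivariant x)) (F.equivariant (E.to x)))
  where
  module E = _≃_ e
  module F = _≃_ f

⊎-≃ : ∀ {X X′ Y Y′ : Set} {σ : X → X} {σ′ : X′ → X′} {τ : Y → Y} {τ′ : Y′ → Y′} →
      σ ≃ σ′ → τ ≃ τ′ → Sum.map σ τ ≃ Sum.map σ′ τ′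
⊎-≃ e f = conj (mk↔ₛ′ (Sum.map E.to F.to) (Sum.map E.from F.from)
    (λ { (inj₁ x) → cong inj₁ (E.to-from x) ; (inj₂ y) → cong inj₂ (F.to-from y) })
    (λ { (inj₁ x) → cong inj₁ (E.from-to x) ; (inj₂ y) → cong inj₂ (F.from-to y) }))
  (λ { (inj₁ x) → cong inj₁ (E.equivariant x) ; (inj₂ y) → cong inj₂ (F.equivariant y) })
  where
  module E = _≃_ e
  module F = _≃_ f

-- Disjoint unions of cycles

rotate : ∀ {l} → Fin l → Fin l
rotate {suc l} i = suc (toℕ i) mod suc l

toℕ-mod : ∀ m n .{{_ : NonZero n}} → toℕ (m mod n) ≡ m % n
toℕ-mod m n = Finₚ.toℕ-fromℕ< (m%n<n m n)

rotate-step : ∀ {l} (i : Fin l) → suc (toℕ i) < l → toℕ (rotate i) ≡ suc (toℕ i)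
rotate-step {suc l} i i<l = trans (toℕ-mod (suc (toℕ i)) (suc l)) (m<n⇒m%n≡m i<l)

rotate-last : ∀ {l} (i : Fin l) → suc (toℕ i) ≡ l → toℕ (rotate i) ≡ 0
rotate-last {suc l} i i≡l = trans (toℕ-mod (suc (toℕ i)) (suc l))
  (trans (cong (_% suc l) i≡l) (n%n≡0 (suc l)))

-- `rotates L` on this type is the standard permutation with cycle lengths `L`; a conjugacy
-- `σ ≃ rotates L` is how "σ has cycle type `L`" is expressed.
Cycles : List ℕ → Set
Cycles []      = ⊥
Cycles (l ∷ L) = Fin l ⊎ Cycles L

rotates : ∀ L → Cycles L → Cycles L
rotates (l ∷ L) = Sum.map rotate (rotates L)

cycles-≟ : ∀ L → DecidableEquality (Cycles L)
cycles-≟ (l ∷ L) = Sumₚ.≡-dec Finₚ._≟_ (cycles-≟ L)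

lengthen : ∀ L → Cycles L → List ℕ
lengthen (l ∷ L) (inj₁ _) = suc l ∷ L
lengthen (l ∷ L) (inj₂ z) = l ∷ lengthen L z

lengthen-nonZero : ∀ L z → All NonZero L → All NonZero (lengthen L z)
lengthen-nonZero (l ∷ L) (inj₁ _) (_ ∷ ps) = _ ∷ ps
lengthen-nonZero (l ∷ L) (inj₂ z) (p ∷ ps) = p ∷ lengthen-nonZero L z ps

-- `nothing` is the new point. This is `extend π (suc x)` freed from `Fin`, so that the insertion
-- can be carried along a conjugacy to `Cycles L`.
insertAfter : ∀ {X : Set} → DecidableEquality X → (X → X) → X → Maybe X → Maybe X
insertAfter _≟_ σ x nothing  = just (σ x)
insertAfter _≟_ σ x (just y) with does (y ≟ x)
... | true  = nothing
... | false = just (σ y)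

insertAfter-≃ : ∀ {X Y : Set} (_≟X_ : DecidableEquality X) (_≟Y_ : DecidableEquality Y)
  {σ : X → X} {τ : Y → Y} (e : σ ≃ τ) x →
  insertAfter _≟X_ σ x ≃ insertAfter _≟Y_ τ (_≃_.to e x)
insertAfter-≃ _≟X_ _≟Y_ {σ} {τ} e x = conj
  (mk↔ₛ′ (Maybe.map to) (Maybe.map from)
    (λ { nothing → refl ; (just y) → cong just (to-from y) })
    (λ { nothing → refl ; (just y) → cong just (from-to y) }))
  (λ { nothing → cong just (equivariant x) ; (just y) → step y })
  where
  open _≃_ e

  step : ∀ y → Maybe.map to (insertAfter _≟X_ σ x (just y)) ≡ insertAfter _≟Y_ τ (to x) (just (to y))
  step y with y ≟X x | to y ≟Y to x
  ... | yes _   | yes _  = refl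
  ... | no _    | no _   = cong just (equivariant y)
  ... | yes y≡x | no neq = ⊥-elim (neq (cong to y≡x))
  ... | no neq  | yes eq = ⊥-elim (neq (to-injective eq))

toℕ-punchIn-< : ∀ {n} (i : Fin (suc n)) (j : Fin n) → toℕ j < toℕ i → toℕ (punchIn i j) ≡ toℕ j
toℕ-punchIn-< (suc i) zero    _         = refl
toℕ-punchIn-< (suc i) (suc j) (s≤s j<i) = cong suc (toℕ-punchIn-< i j j<i)

toℕ-punchIn-≥ : ∀ {n} (i : Fin (suc n)) (j : Fin n) → toℕ i ≤ toℕ j → toℕ (punchIn i j) ≡ suc (toℕ j)
toℕ-punchIn-≥ zero    j       _         = refl
toℕ-punchIn-≥ (suc i) (suc j) (s≤s i≤j) = cong suc (toℕ-punchIn-≥ i j i≤j)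

-- The new point takes position `suc i`, and `punchIn (suc i)` moves the later points up by one, so
-- the cyclic order is kept. The cases compare a point with `i`: before it, equal to it, or after it
-- with a possible wrap to zero.
insertAfter-rotate : ∀ {l} (i : Fin l) → insertAfter Finₚ._≟_ rotate i ≃ rotate {suc l}
insertAfter-rotate {l} i = conj (mk↔ₛ′ g f gf fg) equi
  where
  g : Maybe (Fin l) → Fin (suc l)
  g nothing  = suc i
  g (just y) = punchIn (suc i) y

  f : Fin (suc l) → Maybe (Fin l)
  f y with suc i Finₚ.≟ y
  ... | yes _  = nothing
  ... | no neq = just (punchOut neq)

  gf : ∀ y → g (f y) ≡ y
  gf y with suc i Finₚ.≟ y
  ... | yes eq = eq
  ... | no neq = Finₚ.punchIn-punchOut neq

  fg : ∀ y → f (g y) ≡ y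
  fg nothing with i Finₚ.≟ i
  ... | yes _  = refl
  ... | no neq = ⊥-elim (neq refl)
  fg (just y) with suc i Finₚ.≟ punchIn (suc i) y
  ... | yes eq = ⊥-elim (Finₚ.punchInᵢ≢i (suc i) y (sym eq))
  ... | no neq = cong just (trans (Finₚ.punchOut-cong (suc i) refl) (Finₚ.punchOut-punchIn (suc i)))

  below : ∀ y → toℕ y < toℕ i → punchIn (suc i) (rotate y) ≡ rotate (punchIn (suc i) y)
  below y y<i = Finₚ.toℕ-injective (trans
    (trans (toℕ-punchIn-< (suc i) (rotate y) (s≤s (subst (_≤ toℕ i) (sym ry) y<i))) ry)
    (sym (trans (rotate-step (punchIn (suc i) y)
      (s≤s (subst (_< l) (sym py) (Finₚ.toℕ<n y)))) (cong suc py))))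
    where
    ry = rotate-step y (ℕₚ.<-≤-trans (s≤s y<i) (Finₚ.toℕ<n i))
    py = toℕ-punchIn-< (suc i) y (ℕₚ.m<n⇒m<1+n y<i)

  -- With `j` free, the same argument covers a shifted point and, for `y` equal to `i`, the new
  -- point itself, whose successor is the old successor of `i`.
  above : ∀ j y → toℕ i ≤ toℕ y → toℕ j ≡ suc (toℕ y) → punchIn (suc i) (rotate y) ≡ rotate j
  above j y i≤y j≡ with ℕₚ.m≤n⇒m<n∨m≡n (Finₚ.toℕ<n y)
  ... | inj₁ 1+y<l = Finₚ.toℕ-injective (trans
    (trans (toℕ-punchIn-≥ (suc i) (rotate y) (subst (suc (toℕ i) ≤_) (sym ry) (s≤s i≤y))) (cong suc ry))
    (sym (trans (rotate-step j (s≤s (subst (_< l) (sym j≡) 1+y<l))) (cong suc j≡))))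
    where ry = rotate-step y 1+y<l
  ... | inj₂ 1+y≡l = Finₚ.toℕ-injective (trans
    (trans (toℕ-punchIn-< (suc i) (rotate y) (subst (_< suc (toℕ i)) (sym ry) (s≤s z≤n))) ry)
    (sym (rotate-last j (cong suc (trans j≡ 1+y≡l)))))
    where ry = rotate-last y 1+y≡l

  equi : ∀ y → g (insertAfter Finₚ._≟_ rotate i y) ≡ rotate (g y)
  equi nothing  = above (suc i) i ℕₚ.≤-refl refl
  equi (just y) with y Finₚ.≟ i
  ... | yes refl = Finₚ.toℕ-injective (sym (trans
    (rotate-step (punchIn (suc i) i) (s≤s (subst (_< l) (sym pi) (Finₚ.toℕ<n i)))) (cong suc pi)))
    where pi = toℕ-punchIn-< (suc i) i ℕₚ.≤-refl
  ... | no y≢i with ℕₚ.<-cmp (toℕ y) (toℕ i)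
  ...   | tri< y<i _ _ = below y y<i
  ...   | tri≈ _ eq _  = ⊥-elim (y≢i (Finₚ.toℕ-injective eq))
  ...   | tri> _ _ i<y = above _ y (ℕₚ.<⇒≤ i<y) (toℕ-punchIn-≥ (suc i) y i<y)

insertAfter-rotates : ∀ L z → insertAfter (cycles-≟ L) (rotates L) z ≃ rotates (lengthen L z)
insertAfter-rotates (l ∷ L) (inj₁ i) = ≃-trans
  (conj (mk↔ₛ′ f g (λ { (inj₁ nothing) → refl ; (inj₁ (just _)) → refl ; (inj₂ _) → refl })
      (λ { nothing → refl ; (just (inj₁ _)) → refl ; (just (inj₂ _)) → refl }))
    (λ { nothing → refl ; (just (inj₁ y)) → equi y ; (just (inj₂ _)) → refl }))
  (⊎-≃ (insertAfter-rotate i) ≃-refl)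
  where
  f : Maybe (Fin l ⊎ Cycles L) → Maybe (Fin l) ⊎ Cycles L
  f nothing         = inj₁ nothing
  f (just (inj₁ y)) = inj₁ (just y)
  f (just (inj₂ w)) = inj₂ w

  g : Maybe (Fin l) ⊎ Cycles L → Maybe (Fin l ⊎ Cycles L)
  g (inj₁ nothing)  = nothing
  g (inj₁ (just y)) = just (inj₁ y)
  g (inj₂ w)        = just (inj₂ w)

  equi : ∀ y → f (insertAfter (cycles-≟ (l ∷ L)) (rotates (l ∷ L)) (inj₁ i) (just (inj₁ y))) ≡
               inj₁ (insertAfter Finₚ._≟_ rotate i (just y))
  equi y with y Finₚ.≟ i
  ... | yes _ = refl
  ... | no _  = refl
insertAfter-rotates (l ∷ L) (inj₂ z) = ≃-trans
  (conj (mk↔ₛ′ f g (λ { (inj₂ nothing) → refl ; (inj₂ (just _)) → refl ; (inj₁ _) → refl })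
      (λ { nothing → refl ; (just (inj₁ _)) → refl ; (just (inj₂ _)) → refl }))
    (λ { nothing → refl ; (just (inj₂ y)) → equi y ; (just (inj₁ _)) → refl }))
  (⊎-≃ ≃-refl (insertAfter-rotates L z))
  where
  f : Maybe (Fin l ⊎ Cycles L) → Fin l ⊎ Maybe (Cycles L)
  f nothing         = inj₂ nothing
  f (just (inj₁ y)) = inj₁ y
  f (just (inj₂ w)) = inj₂ (just w)

  g : Fin l ⊎ Maybe (Cycles L) → Maybe (Fin l ⊎ Cycles L)
  g (inj₂ nothing)  = nothing
  g (inj₁ y)        = just (inj₁ y)
  g (inj₂ (just w)) = just (inj₂ w)

  equi : ∀ y → f (insertAfter (cycles-≟ (l ∷ L)) (rotates (l ∷ L)) (inj₂ z) (just (inj₂ y))) ≡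
               inj₂ (insertAfter (cycles-≟ L) (rotates L) z (just y))
  equi y with cycles-≟ L y z
  ... | yes _ = refl
  ... | no _  = refl

extend-zero : ∀ {n} (π : Permutation′ n) L → (π ⟨$⟩ʳ_) ≃ rotates L →
              (extend π zero ⟨$⟩ʳ_) ≃ rotates (1 ∷ L)
extend-zero {n} π L e = ≃-trans
  (conj (mk↔ₛ′ f g (λ { (inj₁ zero) → refl ; (inj₂ _) → refl })
      (λ { zero → refl ; (suc _) → refl }))
    (λ { zero → refl ; (suc x) → refl }))
  (⊎-≃ ≃-refl e)
  where
  f : Fin (suc n) → Fin 1 ⊎ Fin n
  f zero    = inj₁ zero
  f (suc x) = inj₂ x

  g : Fin 1 ⊎ Fin n → Fin (suc n)
  g (inj₁ _) = zero
  g (inj₂ x) = suc x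

extend-suc : ∀ {n} (π : Permutation′ n) L (e : (π ⟨$⟩ʳ_) ≃ rotates L) x →
             (extend π (suc x) ⟨$⟩ʳ_) ≃ rotates (lengthen L (_≃_.to e x))
extend-suc {n} π L e x = ≃-trans
  (conj (mk↔ₛ′ f g (λ { nothing → refl ; (just _) → refl })
      (λ { zero → refl ; (suc _) → refl }))
    (λ { zero → refl ; (suc y) → equi y }))
  (≃-trans (insertAfter-≃ Finₚ._≟_ (cycles-≟ L) e x) (insertAfter-rotates L _))
  where
  f : Fin (suc n) → Maybe (Fin n)
  f zero    = nothing
  f (suc y) = just y

  g : Maybe (Fin n) → Fin (suc n)
  g nothing  = zero
  g (just y) = suc y

  equi : ∀ y → f (extend π (suc x) ⟨$⟩ʳ suc y) ≡ insertAfter Finₚ._≟_ (π ⟨$⟩ʳ_) x (just y)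
  equi y with y Finₚ.≟ x
  ... | yes _ = refl
  ... | no _  = refl

-- Counting over all permutations by cycle type

-- A cycle of length `l` offers `l` places for a new point, all giving length `suc l`. So this is
-- the sum of `F (lengthen L z)` over all points `z` of `Cycles L`.
grow : (List ℕ → ℕ) → List ℕ → ℕ
grow F []      = 0
grow F (l ∷ L) = l * F (suc l ∷ L) + grow (F ∘ (l ∷_)) L

-- The sum of F over the cycle types of all permutations of n points.

sumPermutations : ℕ → (List ℕ → ℕ) → ℕ
sumPermutations zero    F = F []
sumPermutations (suc n) F = sumPermutations n (λ L → F (1 ∷ L) + grow F L)

module _ {X : Setoid 0ℓ 0ℓ} where
  open Setoid X using (Carrier)

  Family : (A : Set) → (A → Carrier → Set) → Setoid 0ℓ 0ℓ
  Family A S = Sub (≡.setoid A ×ₛ X) (uncurry S)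

  family-⊎ : ∀ {A B : Set} (S : A ⊎ B → Carrier → Set) {m n} →
    HasSize (Family A (S ∘ inj₁)) m → HasSize (Family B (S ∘ inj₂)) n →
    HasSize (Family (A ⊎ B) S) (m + n)
  family-⊎ {A} {B} S s t = size-resp
    (Symmetry.inverse (bijection⇒inverse (Family A (S ∘ inj₁) ⊎ₛ Family B (S ∘ inj₂)) (Family (A ⊎ B) S)
      f f-cong f-inj
      (λ { ((inj₁ a , x) , p) → inj₁ ((a , x) , p) , refl , Setoid.refl X
         ; ((inj₂ b , x) , p) → inj₂ ((b , x) , p) , refl , Setoid.refl X })))
    (size-⊎ s t)
    where
    f : Setoid.Carrier (Family A (S ∘ inj₁) ⊎ₛ Family B (S ∘ inj₂)) → Setoid.Carrier (Family (A ⊎ B) S)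
    f (inj₁ ((a , x) , p)) = (inj₁ a , x) , p
    f (inj₂ ((b , x) , p)) = (inj₂ b , x) , p

    f-cong : ∀ {u v} → Setoid._≈_ (Family A (S ∘ inj₁) ⊎ₛ Family B (S ∘ inj₂)) u v →
             Setoid._≈_ (Family (A ⊎ B) S) (f u) (f v)
    f-cong (inj₁ (p , q)) = cong inj₁ p , q
    f-cong (inj₂ (p , q)) = cong inj₂ p , q

    f-inj : ∀ {u v} → Setoid._≈_ (Family (A ⊎ B) S) (f u) (f v) →
            Setoid._≈_ (Family A (S ∘ inj₁) ⊎ₛ Family B (S ∘ inj₂)) u v
    f-inj {inj₁ _} {inj₁ _} (refl , q) = inj₁ (refl , q)
    f-inj {inj₂ _} {inj₂ _} (refl , q) = inj₂ (refl , q)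

  family-↔ : ∀ {A B : Set} (e : A ↔ B) (S : A → Carrier → Set) {n} →
    HasSize (Family B (S ∘ Inverse.from e)) n → HasSize (Family A S) n
  family-↔ {A} {B} e S = size-resp (Symmetry.inverse (bijection⇒inverse
    (Family B (S ∘ E.from)) (Family A S)
    (λ { ((b , x) , p) → (E.from b , x) , p })
    (λ { (p , q) → cong E.from p , q })
    (λ { {(b , _) , _} {(c , _) , _} (p , q) →
      trans (sym (E.inverseˡ refl)) (trans (cong E.to p) (E.inverseˡ refl)) , q })
    (λ { ((a , x) , p) → ((E.to a , x) , subst (λ a → S a x) (sym (E.inverseʳ refl)) p) ,
      E.inverseʳ refl , Setoid.refl X })))
    where
    module E = Inverse e

  family-single : ∀ (S : Fin 1 → Carrier → Set) {n} →
    HasSize (Sub X (S zero)) n → HasSize (Family (Fin 1) S) n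
  family-single S = size-resp (bijection⇒inverse (Family (Fin 1) S) (Sub X (S zero))
    (λ { ((zero , x) , p) → x , p })
    (λ { {(zero , _) , _} {(zero , _) , _} (_ , q) → q })
    (λ { {(zero , _) , _} {(zero , _) , _} q → refl , q })
    (λ { (x , p) → ((zero , x) , p) , Setoid.refl X }))

  family-Fin : ∀ {l} (S : Fin l → Carrier → Set) {n} →
    (∀ i → HasSize (Sub X (S i)) n) → HasSize (Family (Fin l) S) (l * n)
  family-Fin {zero}  S s = size-empty (λ { ((() , _) , _) })
  family-Fin {suc l} S s = family-↔ (Finₚ.+↔⊎ {1}) S
    (family-⊎ _ (family-single _ (s zero)) (family-Fin (S ∘ suc) (s ∘ suc)))

  family-cycles : ∀ L (S : Cycles L → Carrier → Set) (F : List ℕ → ℕ) →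
    (∀ z → HasSize (Sub X (S z)) (F (lengthen L z))) → HasSize (Family (Cycles L) S) (grow F L)
  family-cycles []      S F s = size-empty (λ { ((() , _) , _) })
  family-cycles (l ∷ L) S F s = family-⊎ S (family-Fin _ (s ∘ inj₁))
    (family-cycles L _ (F ∘ (l ∷_)) (s ∘ inj₂))

-- Induction by insertion: the position `i` is absorbed into `X`, and `F` becomes the sum over all
-- insertions, as in `sumPermutations`. The conjugacy offered to the hypothesis is assembled along
-- the way: `i` equal to zero adds a cycle of length one, while the other positions are reindexed by
-- the points of `Cycles L`, each lengthening its own cycle.
size-over-permutations : ∀ n (X : Setoid 0ℓ 0ℓ) (R : Permutation′ n → Setoid.Carrier X → Set) F →
  (∀ {π ρ x} → π Perm.≈ ρ → R π x → R ρ x) →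
  (∀ π L → All NonZero L → (π ⟨$⟩ʳ_) ≃ rotates L → HasSize (Sub X (R π)) (F L)) →
  HasSize (Sub (Permutations n ×ₛ X) (uncurry R)) (sumPermutations n F)
size-over-permutations zero X R F R-resp s = size-resp
  (bijection⇒inverse (Sub (Permutations 0 ×ₛ X) (uncurry R)) (Sub X (R Perm.id))
    (λ { ((π , x) , r) → x , R-resp {π} {Perm.id} (λ ()) r })
    proj₂
    (λ eq → (λ ()) , eq)
    (λ { (x , r) → ((Perm.id , x) , r) , Setoid.refl X }))
  (s Perm.id [] [] (conj Finₚ.0↔⊥ λ ()))
size-over-permutations (suc n) X R F R-resp s = size-resp
  (Symmetry.inverse (bijection⇒inverse
    (Sub (Permutations n ×ₛ X′) (uncurry R′)) (Sub (Permutations (suc n) ×ₛ X) (uncurry R))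
    (λ { ((π , i , x) , r) → (extend π i , x) , r })
    (λ { {(π , i , _) , _} {(ρ , j , _) , _} (p , q , e) →
         E.to-cong {π , i} {ρ , j} (p , q) , e })
    (λ { {(π , i , _) , _} {(ρ , j , _) , _} (p , e) →
         let q = E.injective (π , i) (ρ , j) p in proj₁ q , proj₂ q , e })
    (λ { ((π , x) , r) → let ((ρ , i) , ρi≈π) = E.surjective′ π in
         ((ρ , i , x) , R-resp (λ k → sym (ρi≈π k)) r) , ρi≈π , Setoid.refl X })))
  (size-over-permutations n X′ R′ _
    (λ { {π} {ρ} {i , x} p → R-resp (E.to-cong {π , i} {ρ , i} (p , refl)) })
    λ π L nz e → family-↔ (Finₚ.+↔⊎ {1}) (R′′ π)
      (family-⊎ _ (family-single _ (s _ (1 ∷ L) (_ ∷ nz) (extend-zero π L e)))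
        (family-↔ (_≃_.iso e) (R′′ π ∘ suc) (family-cycles L _ F λ z →
          subst (λ w → HasSize (Sub X (R (extend π (suc (_≃_.from e z))))) (F (lengthen L w)))
            (_≃_.to-from e z)
            (s _ _ (lengthen-nonZero L _ nz) (extend-suc π L e (_≃_.from e z)))))))
  where
  X′ : Setoid 0ℓ 0ℓ
  X′ = ≡.setoid (Fin (suc n)) ×ₛ X

  R′′ : Permutation′ n → Fin (suc n) → Setoid.Carrier X → Set
  R′′ π i x = R (extend π i) x

  R′ : Permutation′ n → Setoid.Carrier X′ → Set
  R′ π = uncurry (R′′ π)

  module E where
    open Inverse (permutations-suc n) public

    private
      P = Permutations n ×ₛ ≡.setoid (Fin (suc n))
      P⁺ = Permutations (suc n)

    injective : ∀ p q → to p Perm.≈ to q → Setoid._≈_ P p q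
    injective = inverse-injective P P⁺ (permutations-suc n)

    surjective′ : ∀ π → Σ[ p ∈ _ ] to p Perm.≈ π
    surjective′ π = from π , inverse-to-from P P⁺ (permutations-suc n) π

-- Equivariant maps

Equivariant : ∀ {X Y : Set} → (X → X) → (Y → Y) → (X → Y) → Set
Equivariant σ τ f = ∀ x → f (σ x) ≡ τ (f x)

Equivariants : ∀ {X Y : Set} → (X → X) → (Y → Y) → Setoid 0ℓ 0ℓ
Equivariants {X} {Y} σ τ = Sub (X ≡.→-setoid Y) (Equivariant σ τ)

equivariants-≃ : ∀ {X X′ Y Y′ : Set} {σ : X → X} {σ′ : X′ → X′} {τ : Y → Y} {τ′ : Y′ → Y′} →
  σ ≃ σ′ → τ ≃ τ′ → ∀ {n} → HasSize (Equivariants σ′ τ′) n → HasSize (Equivariants σ τ) n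
equivariants-≃ {σ = σ} {σ′} {τ} {τ′} e f = size-resp (bijection⇒inverse
  (Equivariants σ τ) (Equivariants σ′ τ′)
  (λ { (h , eq) → F.to ∘ h ∘ E.from , λ x → trans (cong (F.to ∘ h) (E.from-equivariant x))
         (trans (cong F.to (eq (E.from x))) (F.equivariant (h (E.from x)))) })
  (λ p x → cong F.to (p (E.from x)))
  (λ { {h , _} {k , _} p x → trans (cong h (sym (E.from-to x)))
         (trans (F.to-injective (p (E.to x))) (cong k (E.from-to x))) })
  (λ { (h , eq) → (F.from ∘ h ∘ E.to , λ x → trans (cong (F.from ∘ h) (E.equivariant x))
         (trans (cong F.from (eq (E.to x))) (F.from-equivariant (h (E.to x)))))
       , λ x → trans (F.to-from _) (cong h (E.to-from x)) }))
  where
  module E = _≃_ e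
  module F = _≃_ f

equivariants-≃ˡ : ∀ {X X′ Y : Set} (τ : Y → Y) {σ : X → X} {σ′ : X′ → X′} →
  σ ≃ σ′ → ∀ {n} → HasSize (Equivariants σ′ τ) n → HasSize (Equivariants σ τ) n
equivariants-≃ˡ τ e = equivariants-≃ {τ = τ} {τ} e ≃-refl

equivariants-⊎ : ∀ {X X′ Y : Set} (τ : Y → Y) {σ : X → X} {σ′ : X′ → X′} {m n} →
  HasSize (Equivariants σ τ) m → HasSize (Equivariants σ′ τ) n →
  HasSize (Equivariants (Sum.map σ σ′) τ) (m * n)
equivariants-⊎ τ {σ} {σ′} s t = size-resp (bijection⇒inverse
  (Equivariants (Sum.map σ σ′) τ) (Equivariants σ τ ×ₛ Equivariants σ′ τ)
  (λ { (h , eq) → (h ∘ inj₁ , eq ∘ inj₁) , (h ∘ inj₂ , eq ∘ inj₂) })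
  (λ p → p ∘ inj₁ , p ∘ inj₂)
  (λ { (p , q) (inj₁ x) → p x ; (p , q) (inj₂ x) → q x })
  (λ { ((h , p) , (k , q)) → ([ h , k ]′ , λ { (inj₁ x) → p x ; (inj₂ x) → q x })
     , (λ _ → refl) , (λ _ → refl) }))
  (size-× s t)

equivariants-⊥ : ∀ {X Y : Set} (τ : Y → Y) {σ : X → X} → ¬ X → HasSize (Equivariants σ τ) 1
equivariants-⊥ τ {σ} ¬x = representatives⇒size (Equivariants σ τ) {1}
  (λ _ → (λ x → ⊥-elim (¬x x)) , λ x → ⊥-elim (¬x x))
  (λ { {zero} {zero} _ → refl }) (λ _ → zero , λ x → ⊥-elim (¬x x))

-- Products of self-maps

infixr 5 _⊗_

_⊗_ : ∀ {X Y : Set} → (X → X) → (Y → Y) → X × Y → X × Y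
(σ ⊗ τ) (x , y) = σ x , τ y

×-≃ : ∀ {X X′ Y Y′ : Set} {σ : X → X} {σ′ : X′ → X′} {τ : Y → Y} {τ′ : Y′ → Y′} →
      σ ≃ σ′ → τ ≃ τ′ → (σ ⊗ τ) ≃ (σ′ ⊗ τ′)
×-≃ e f = conj (mk↔ₛ′ (Product.map E.to F.to) (Product.map E.from F.from)
    (λ { (x , y) → cong₂ _,_ (E.to-from x) (F.to-from y) })
    (λ { (x , y) → cong₂ _,_ (E.from-to x) (F.from-to y) }))
  (λ { (x , y) → cong₂ _,_ (E.equivariant x) (F.equivariant y) })
  where
  module E = _≃_ e
  module F = _≃_ f

×-swap-≃ : ∀ {X Y : Set} {σ : X → X} {τ : Y → Y} → (σ ⊗ τ) ≃ (τ ⊗ σ)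
×-swap-≃ = conj (mk↔ₛ′ Product.swap Product.swap (λ _ → refl) (λ _ → refl)) (λ _ → refl)

×-distribʳ-⊎-≃ : ∀ {X X′ Y : Set} {σ : X → X} {σ′ : X′ → X′} {τ : Y → Y} →
  (Sum.map σ σ′ ⊗ τ) ≃ Sum.map (σ ⊗ τ) (σ′ ⊗ τ)
×-distribʳ-⊎-≃ = conj (mk↔ₛ′
  (λ { (inj₁ x , y) → inj₁ (x , y) ; (inj₂ x , y) → inj₂ (x , y) })
  (λ { (inj₁ (x , y)) → inj₁ x , y ; (inj₂ (x , y)) → inj₂ x , y })
  (λ { (inj₁ _) → refl ; (inj₂ _) → refl })
  (λ { (inj₁ _ , _) → refl ; (inj₂ _ , _) → refl }))
  (λ { (inj₁ _ , _) → refl ; (inj₂ _ , _) → refl })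

equivariants-cycles-× : ∀ {Y Z : Set} (τ : Y → Y) (ζ : Z → Z) L (h : ℕ → ℕ) → All NonZero L →
  (∀ a .{{_ : NonZero a}} → HasSize (Equivariants (rotate {a} ⊗ ζ) τ) (h a)) →
  HasSize (Equivariants (rotates L ⊗ ζ) τ) (product (map h L))
equivariants-cycles-× τ ζ []      h _          s = equivariants-⊥ τ (λ ())
equivariants-cycles-× τ ζ (a ∷ L) h (nz ∷ nzs) s = equivariants-≃ˡ τ ×-distribʳ-⊎-≃
  (equivariants-⊎ τ {rotate {a} ⊗ ζ} {rotates L ⊗ ζ} (s a {{nz}}) (equivariants-cycles-× τ ζ L h nzs s))

equivariants-copies : ∀ {X Y : Set} (τ : Y → Y) (σ : X → X) {n} g →
  HasSize (Equivariants σ τ) n → HasSize (Equivariants (_⊗_ {Fin g} id σ) τ) (n ^ g)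
equivariants-copies τ σ zero    s = equivariants-⊥ τ (λ { (() , _) })
equivariants-copies {X} τ σ (suc g) s =
  equivariants-≃ˡ τ split (equivariants-⊎ τ {σ} {_⊗_ {Fin g} id σ} s (equivariants-copies τ σ g s))
  where
  split : _⊗_ {Fin (suc g)} id σ ≃ Sum.map σ (_⊗_ {Fin g} id σ)
  split = conj (mk↔ₛ′ f k
      (λ { (inj₁ _) → refl ; (inj₂ _) → refl })
      (λ { (zero , _) → refl ; (suc _ , _) → refl }))
    (λ { (zero , _) → refl ; (suc _ , _) → refl })
    where
    f : Fin (suc g) × X → X ⊎ Fin g × X
    f (zero  , x) = inj₁ x
    f (suc i , x) = inj₂ (i , x)

    k : X ⊎ Fin g × X → Fin (suc g) × X
    k (inj₁ x)       = zero , x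
    k (inj₂ (i , x)) = suc i , x

-- Equivariant maps out of a cycle

Fixed : ∀ {Y : Set} → (Y → Y) → ℕ → Setoid 0ℓ 0ℓ
Fixed {Y} τ l = Sub (≡.setoid Y) (λ y → fold y τ l ≡ y)

0%n≡0 : ∀ n .{{_ : NonZero n}} → 0 % n ≡ 0
0%n≡0 n = n∣m⇒m%n≡0 0 n (divides 0 refl)

toℕ-rotate : ∀ {l} .{{_ : NonZero l}} (i : Fin l) → toℕ (rotate i) ≡ suc (toℕ i) % l
toℕ-rotate {suc l} i = toℕ-mod (suc (toℕ i)) (suc l)

suc-% : ∀ m n .{{_ : NonZero n}} → suc (m % n) % n ≡ suc m % n
suc-% m n = trans (%-distribˡ-+ 1 (m % n) n)
  (trans (cong (λ k → (1 % n + k) % n) (m%n%n≡m%n m n)) (sym (%-distribˡ-+ 1 m n)))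

rotate-mod : ∀ k l .{{_ : NonZero l}} → rotate (k mod l) ≡ suc k mod l
rotate-mod k l = Finₚ.toℕ-injective (trans (toℕ-rotate (k mod l))
  (trans (cong (λ m → suc m % l) (toℕ-mod k l)) (trans (suc-% k l) (sym (toℕ-mod (suc k) l)))))

toℕ-% : ∀ {l} .{{_ : NonZero l}} (i : Fin l) → toℕ i % l ≡ toℕ i
toℕ-% i = m<n⇒m%n≡m (Finₚ.toℕ<n i)

mod-toℕ : ∀ {l} .{{_ : NonZero l}} (i : Fin l) → toℕ i mod l ≡ i
mod-toℕ {l} i = Finₚ.toℕ-injective (trans (toℕ-mod (toℕ i) l) (toℕ-% i))

mod-cong : ∀ {m n l} .{{_ : NonZero l}} → m % l ≡ n % l → m mod l ≡ n mod l
mod-cong {m} {n} {l} eq = Finₚ.toℕ-injective (trans (toℕ-mod m l) (trans eq (sym (toℕ-mod n l))))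

equivariants-rotate : ∀ {Y : Set} (τ : Y → Y) l .{{_ : NonZero l}} {n} →
  HasSize (Fixed τ l) n → HasSize (Equivariants (rotate {l}) τ) n
equivariants-rotate {Y} τ l = size-resp (bijection⇒inverse (Equivariants (rotate {l}) τ) (Fixed τ l)
  (λ { (f , eq) → f (0 mod l) , trans (sym (orbit f eq l)) (cong f (mod-cong (trans (n%n≡0 l) (sym (0%n≡0 l))))) })
  (λ p → p (0 mod l))
  (λ { {f , eq} {g , eq′} p i → trans (along f eq i)
         (trans (cong (λ y → fold y τ (toℕ i)) p) (sym (along g eq′ i))) })
  (λ { (y , eq) → ((λ i → fold y τ (toℕ i)) , spread y eq)
     , cong (fold y τ) (trans (toℕ-mod 0 l) (0%n≡0 l)) }))
  where
  orbit : ∀ f → Equivariant (rotate {l}) τ f → ∀ k → f (k mod l) ≡ fold (f (0 mod l)) τ k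
  orbit f eq zero    = refl
  orbit f eq (suc k) = trans (cong f (sym (rotate-mod k l)))
    (trans (eq (k mod l)) (cong τ (orbit f eq k)))

  along : ∀ f → Equivariant (rotate {l}) τ f → ∀ i → f i ≡ fold (f (0 mod l)) τ (toℕ i)
  along f eq i = trans (cong f (sym (mod-toℕ i))) (orbit f eq (toℕ i))

  spread : ∀ y → fold y τ l ≡ y → Equivariant (rotate {l}) τ (λ i → fold y τ (toℕ i))
  spread y eq i with ℕₚ.m≤n⇒m<n∨m≡n (Finₚ.toℕ<n i)
  ... | inj₁ 1+i<l = cong (fold y τ) (rotate-step i 1+i<l)
  ... | inj₂ 1+i≡l = trans (cong (fold y τ) (rotate-last i 1+i≡l))
          (trans (sym eq) (cong (fold y τ) (sym 1+i≡l)))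

fold-⊎-inj₁ : ∀ {X Y : Set} (σ : X → X) (τ : Y → Y) x l →
              fold (inj₁ x) (Sum.map σ τ) l ≡ inj₁ (fold x σ l)
fold-⊎-inj₁ σ τ x zero    = refl
fold-⊎-inj₁ σ τ x (suc l) = cong (Sum.map σ τ) (fold-⊎-inj₁ σ τ x l)

fold-⊎-inj₂ : ∀ {X Y : Set} (σ : X → X) (τ : Y → Y) y l →
              fold (inj₂ y) (Sum.map σ τ) l ≡ inj₂ (fold y τ l)
fold-⊎-inj₂ σ τ y zero    = refl
fold-⊎-inj₂ σ τ y (suc l) = cong (Sum.map σ τ) (fold-⊎-inj₂ σ τ y l)

fixed-⊎ : ∀ {X Y : Set} {σ : X → X} {τ : Y → Y} l {m n} →
  HasSize (Fixed σ l) m → HasSize (Fixed τ l) n → HasSize (Fixed (Sum.map σ τ) l) (m + n)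
fixed-⊎ {X} {Y} {σ} {τ} l s t = size-resp
  (Symmetry.inverse (bijection⇒inverse (Fixed σ l ⊎ₛ Fixed τ l) (Fixed (Sum.map σ τ) l) f
    (λ { (inj₁ p) → cong inj₁ p ; (inj₂ p) → cong inj₂ p })
    (λ { {inj₁ _} {inj₁ _} p → inj₁ (Sumₚ.inj₁-injective p)
       ; {inj₂ _} {inj₂ _} p → inj₂ (Sumₚ.inj₂-injective p) })
    (λ { (inj₁ x , eq) → inj₁ (x , Sumₚ.inj₁-injective (trans (sym (fold-⊎-inj₁ σ τ x l)) eq)) , refl
       ; (inj₂ y , eq) → inj₂ (y , Sumₚ.inj₂-injective (trans (sym (fold-⊎-inj₂ σ τ y l)) eq)) , refl })))
  (size-⊎ s t)
  where
  f : Setoid.Carrier (Fixed σ l ⊎ₛ Fixed τ l) → Setoid.Carrier (Fixed (Sum.map σ τ) l)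
  f (inj₁ (x , eq)) = inj₁ x , trans (fold-⊎-inj₁ σ τ x l) (cong inj₁ eq)
  f (inj₂ (y , eq)) = inj₂ y , trans (fold-⊎-inj₂ σ τ y l) (cong inj₂ eq)

-- For `n` of the form `suc n′` the number `n′ * x` represents -x modulo `n`. Adding it to both
-- sides cancels without any subtraction.
%-cancelˡ-+ : ∀ n .{{_ : NonZero n}} x {y u v} → x % n ≡ y % n → (x + u) % n ≡ (y + v) % n → u % n ≡ v % n
%-cancelˡ-+ n@(suc n′) x {y} {u} {v} x≡y eq = begin
  u % n                         ≡⟨ drop x u refl ⟨
  (n′ * x + (x + u)) % n        ≡⟨ %-distribˡ-+ (n′ * x) (x + u) n ⟩
  ((n′ * x) % n + (x + u) % n) % n ≡⟨ cong (λ k → ((n′ * x) % n + k) % n) eq ⟩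
  ((n′ * x) % n + (y + v) % n) % n ≡⟨ %-distribˡ-+ (n′ * x) (y + v) n ⟨
  (n′ * x + (y + v)) % n        ≡⟨ drop y v (sym x≡y) ⟩
  v % n                         ∎
  where
  open ≡-Reasoning
  drop : ∀ z w → z % n ≡ x % n → (n′ * x + (z + w)) % n ≡ w % n
  drop z w z≡x = begin
    (n′ * x + (z + w)) % n ≡⟨ cong (_% n) (ℕₚ.+-assoc (n′ * x) z w) ⟨
    (n′ * x + z + w) % n   ≡⟨ %-remove-+ˡ w (m%n≡0⇒n∣m (n′ * x + z) n (begin
        (n′ * x + z) % n                 ≡⟨ %-distribˡ-+ (n′ * x) z n ⟩
        ((n′ * x) % n + z % n) % n       ≡⟨ cong (λ k → ((n′ * x) % n + k) % n) z≡x ⟩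
        ((n′ * x) % n + x % n) % n       ≡⟨ %-distribˡ-+ (n′ * x) x n ⟨
        (n′ * x + x) % n                 ≡⟨ cong (_% n) (trans (ℕₚ.+-comm (n′ * x) x) (ℕₚ.*-comm n x)) ⟩
        (x * n) % n                      ≡⟨ m*n%n≡0 x n ⟩
        0                                ∎)) ⟩
    w % n                  ∎

fold-rotate : ∀ {d} .{{_ : NonZero d}} (i : Fin d) l → toℕ (fold i rotate l) ≡ (l + toℕ i) % d
fold-rotate     i zero    = sym (toℕ-% i)
fold-rotate {d} i (suc l) = trans (toℕ-rotate (fold i rotate l))
  (trans (cong (λ k → suc k % d) (fold-rotate i l)) (suc-% (l + toℕ i) d))

dividing : ℕ → ℕ → ℕ
dividing l d = if does (d ∣? l) then d else 0

-- Rotating `l` times is translation by `l` modulo `d`, which fixes every point if `d` divides `l`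
-- and no point otherwise.
fixed-rotate : ∀ d .{{_ : NonZero d}} l → HasSize (Fixed (rotate {d}) l) (dividing l d)
fixed-rotate d l with d ∣? l
... | yes d∣l = representatives⇒size (Fixed (rotate {d}) l)
  (λ i → i , Finₚ.toℕ-injective (trans (fold-rotate i l) (trans (%-remove-+ˡ (toℕ i) d∣l) (toℕ-% i))))
  id (λ { (i , _) → i , refl })
... | no ¬d∣l = size-empty (λ { (i , eq) → ¬d∣l (m%n≡0⇒n∣m l d (trans
    (%-cancelˡ-+ d (toℕ i) {toℕ i} {l} {0} refl (trans (cong (_% d) (ℕₚ.+-comm (toℕ i) l))
      (trans (sym (fold-rotate i l)) (trans (cong toℕ eq) (trans (sym (toℕ-% i))
        (cong (_% d) (sym (ℕₚ.+-identityʳ (toℕ i)))))))))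
    (0%n≡0 d))) })

fixed-cycles : ∀ J l → All NonZero J → HasSize (Fixed (rotates J) l) (sum (map (dividing l) J))
fixed-cycles []      l _          = size-empty (λ ())
fixed-cycles (d ∷ J) l (nz ∷ nzs) = fixed-⊎ l (fixed-rotate d {{nz}} l) (fixed-cycles J l nzs)

-- The product of two cycles

%-∣ : ∀ n .{{_ : NonZero n}} x d → (x + d) % n ≡ x % n → n ∣ d
%-∣ n x d eq = m%n≡0⇒n∣m d n (trans
  (%-cancelˡ-+ n x {x} {d} {0} refl (trans eq (cong (_% n) (sym (ℕₚ.+-identityʳ x)))))
  (0%n≡0 n))

-- The uniqueness half of the Chinese remainder theorem for arbitrary moduli: the difference is
-- divisible by `a` and by `b`, hence by their lcm, but is smaller than it.
%-lcm-injective-≤ : ∀ a b .{{_ : NonZero a}} .{{_ : NonZero b}} {x y} → x ≤ y → y < lcm a b →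
  x % a ≡ y % a → x % b ≡ y % b → x ≡ y
%-lcm-injective-≤ a b {x} {y} x≤y y< p q with y ∸ x in eq
... | zero  = ℕₚ.≤-antisym x≤y (ℕₚ.m∸n≡0⇒m≤n eq)
... | suc d = ⊥-elim (ℕₚ.<⇒≱ y< (ℕₚ.≤-trans
    (∣⇒≤ (lcm-least (%-∣ a x (suc d) (trans (cong (_% a) x+d) (sym p)))
                    (%-∣ b x (suc d) (trans (cong (_% b) x+d) (sym q)))))
    (subst (suc d ≤_) x+d (ℕₚ.m≤n+m (suc d) x))))
  where
  x+d : x + suc d ≡ y
  x+d = trans (cong (x +_) (sym eq)) (ℕₚ.m+[n∸m]≡n x≤y)

%-lcm-injective : ∀ a b .{{_ : NonZero a}} .{{_ : NonZero b}} {x y} → x < lcm a b → y < lcm a b →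
  x % a ≡ y % a → x % b ≡ y % b → x ≡ y
%-lcm-injective a b {x} {y} x< y< p q with ℕₚ.≤-total x y
... | inj₁ x≤y = %-lcm-injective-≤ a b x≤y y< p q
... | inj₂ y≤x = sym (%-lcm-injective-≤ a b y≤x x< (sym p) (sym q))

-- Punching a missed value out of the codomain would inject `suc n` points into `n`.
injective⇒surjective : ∀ {n} (f : Fin n → Fin n) → (∀ {i j} → f i ≡ f j → i ≡ j) →
                       ∀ y → Σ[ x ∈ Fin n ] f x ≡ y
injective⇒surjective {suc n} f f-inj y with Finₚ.any? (λ x → f x Finₚ.≟ y)
... | yes p = p
... | no ¬p = ⊥-elim (ℕₚ.1+n≰n (Finₚ.injective⇒≤ {suc n} {n}
  {λ x → punchOut {i = y} {f x} (λ eq → ¬p (x , sym eq))}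
  (λ eq → f-inj (Finₚ.punchOut-injective {i = y} _ _ eq))))

injective⇒↔ : ∀ {X Y : Set} {n} → HasSize (≡.setoid X) n → HasSize (≡.setoid Y) n →
  (f : X → Y) → (∀ {x y} → f x ≡ f y → x ≡ y) → X ↔ Y
injective⇒↔ {X} {Y} s t f f-inj = bijection⇒inverse (≡.setoid X) (≡.setoid Y) f (cong f) f-inj f-surj
  where
  module S = Size s
  module T = Size t

  f-surj : ∀ y → Σ[ x ∈ X ] f x ≡ y
  f-surj y with injective⇒surjective (T.to ∘ f ∘ S.from)
      (λ {i} {j} eq → trans (sym (S.to-from i))
        (trans (cong S.to (f-inj (T.to-injective eq))) (S.to-from j))) (T.to y)
  ... | i , eq = S.from i , T.to-injective eq

gcd-nonZero : ∀ a b .{{_ : NonZero a}} .{{_ : NonZero b}} → NonZero (gcd a b)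
gcd-nonZero a b = ℕₚ.m*n≢0⇒m≢0 (gcd a b) {{subst NonZero (sym (gcd*lcm a b)) (ℕₚ.m*n≢0 a b)}}

lcm-nonZero : ∀ a b .{{_ : NonZero a}} .{{_ : NonZero b}} → NonZero (lcm a b)
lcm-nonZero a b = ℕₚ.m*n≢0⇒n≢0 (gcd a b) {{subst NonZero (sym (gcd*lcm a b)) (ℕₚ.m*n≢0 a b)}}

-- The difference of the two coordinates modulo the gcd is constant along a cycle, so it serves as
-- the label `i` of the cycle, and `t` is the time elapsed from the point (0 , i). Injectivity is
-- enough, because gcd times lcm equals a times b: reducing modulo the gcd recovers `i`, and then
-- `t` is known modulo `a` and modulo `b`.
rotate-×-≃ : ∀ a b .{{_ : NonZero a}} .{{_ : NonZero b}} →
  _⊗_ {Fin (gcd a b)} id (rotate {lcm a b}) ≃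
  (rotate {a} ⊗ rotate {b})
rotate-×-≃ a b = conj (injective⇒↔
    (size-resp (Symmetry.inverse Finₚ.*↔×) size-Fin)
    (subst (HasSize (≡.setoid (Fin a × Fin b))) (sym (gcd*lcm a b))
      (size-resp (Symmetry.inverse Finₚ.*↔×) size-Fin))
    f f-inj)
  equi
  where
  g = gcd a b
  l = lcm a b

  instance
    g≢0 : NonZero g
    g≢0 = gcd-nonZero a b

    l≢0 : NonZero l
    l≢0 = lcm-nonZero a b

  f : Fin g × Fin l → Fin a × Fin b
  f (i , t) = toℕ t mod a , (toℕ t + toℕ i) mod b

  mod-injective : ∀ {m n} c .{{_ : NonZero c}} → m mod c ≡ n mod c → m % c ≡ n % c
  mod-injective {m} {n} c eq = trans (sym (toℕ-mod m c)) (trans (cong toℕ eq) (toℕ-mod n c))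

  reduce : ∀ {m n} c .{{_ : NonZero c}} → g ∣ c → m % c ≡ n % c → m % g ≡ n % g
  reduce {m} {n} c g∣c eq = trans (sym (m∣n⇒o%n%m≡o%m g c m g∣c))
    (trans (cong (_% g) eq) (m∣n⇒o%n%m≡o%m g c n g∣c))

  f-inj : ∀ {p q} → f p ≡ f q → p ≡ q
  f-inj {i , t} {j , u} eq with Finₚ.toℕ-injective {i = i} {j} (trans (sym (toℕ-% i))
      (trans (%-cancelˡ-+ g (toℕ t) (reduce a (gcd[m,n]∣m a b) t≡u) (reduce b (gcd[m,n]∣n a b) t+i≡u+j))
             (toℕ-% j)))
    where
    t≡u = mod-injective a (cong proj₁ eq)
    t+i≡u+j = mod-injective b (cong proj₂ eq)
  ... | refl = cong (i ,_) (Finₚ.toℕ-injective (%-lcm-injective a b (Finₚ.toℕ<n t) (Finₚ.toℕ<n u)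
    (mod-injective a (cong proj₁ eq))
    (%-cancelˡ-+ b (toℕ i) {toℕ i} refl
      (trans (cong (_% b) (ℕₚ.+-comm (toℕ i) (toℕ t)))
        (trans (mod-injective b (cong proj₂ eq)) (cong (_% b) (ℕₚ.+-comm (toℕ u) (toℕ i))))))))

  equi : ∀ p → f ((id ⊗ rotate) p) ≡ (rotate ⊗ rotate) (f p)
  equi (i , t) = cong₂ _,_
    (trans (mod-cong (trans (cong (_% a) (toℕ-rotate t)) (m∣n⇒o%n%m≡o%m a l (suc (toℕ t)) (m∣lcm[m,n] a b))))
      (sym (rotate-mod (toℕ t) a)))
    (trans (mod-cong (begin
        (toℕ (rotate t) + toℕ i) % b          ≡⟨ %-distribˡ-+ (toℕ (rotate t)) (toℕ i) b ⟩
        (toℕ (rotate t) % b + toℕ i % b) % b  ≡⟨ cong (λ k → (k + toℕ i % b) % b)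
          (trans (cong (_% b) (toℕ-rotate t)) (m∣n⇒o%n%m≡o%m b l (suc (toℕ t)) (n∣lcm[m,n] a b))) ⟩
        (suc (toℕ t) % b + toℕ i % b) % b     ≡⟨ %-distribˡ-+ (suc (toℕ t)) (toℕ i) b ⟨
        (suc (toℕ t) + toℕ i) % b             ∎))
      (sym (rotate-mod (toℕ t + toℕ i) b)))
    where open ≡-Reasoning

-- Products over pairs of cycles

-- The number of tables fixed by a relabelling with cycle type `K` on the generators and `J` on the
-- nonzero values. The `1` counts the value zero, which is always fixed. The product runs over
-- single parts, where `N` groups equal parts by multiplicity.
pairProduct : List ℕ → List ℕ → ℕ
pairProduct K J = product (map (λ a → product (map (λ b →
  (1 + sum (map (dividing (lcm a b)) J)) ^ gcd a b) K)) K)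

equivariants-pairs : ∀ K J → All NonZero K → All NonZero J →
  HasSize (Equivariants (rotates K ⊗ rotates K) (rotates (1 ∷ J))) (pairProduct K J)
equivariants-pairs K J nzK nzJ =
  -- The splitting lemma acts on the left factor, so the factors are swapped to split the right one
  -- and swapped back afterwards.
  equivariants-cycles-× τ (rotates K) K _ nzK λ a → equivariants-≃ˡ τ ×-swap-≃
  (equivariants-cycles-× τ (rotate {a}) K _ nzK λ b →
  equivariants-≃ˡ τ (≃-trans ×-swap-≃ (≃-sym (rotate-×-≃ a b)))
  (equivariants-copies τ (rotate {lcm a b}) (gcd a b)
    (equivariants-rotate τ (lcm a b) {{lcm-nonZero a b}}
    (subst (HasSize (Fixed (rotates (1 ∷ J)) (lcm a b)))
      (cong (_+ sum (map (dividing (lcm a b)) J)) (dividing-1 (lcm a b)))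
      (fixed-cycles (1 ∷ J) (lcm a b) (_ ∷ nzJ))))))
  where
  τ = rotates (1 ∷ J)

  dividing-1 : ∀ l → dividing l 1 ≡ 1
  dividing-1 l = cong (λ b → if b then 1 else 0)
    (dec-true (1 ∣? l) (divides l (sym (ℕₚ.*-identityʳ l))))

-- Finite sums and products

-- `big` unfolds to the same `foldr` over `map` as `sum`, `product` and `∑`, so the three instances
-- below apply to these directly.
module BigOp {A : Set} (_∙_ : A → A → A) (ε : A) (isCM : IsCommutativeMonoid _≡_ _∙_ ε) where
  open IsCommutativeMonoid isCM using (assoc; comm; identityˡ; identityʳ)

  big : ∀ {I : Set} → List I → (I → A) → A
  big xs f = foldr _∙_ ε (map f xs)

  x∙yz≡y∙xz : ∀ x y z → x ∙ (y ∙ z) ≡ y ∙ (x ∙ z)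
  x∙yz≡y∙xz x y z = trans (sym (assoc x y z)) (trans (cong (_∙ z) (comm x y)) (assoc y x z))

  big-cong : ∀ {I : Set} {xs : List I} {f g : I → A} → All (λ x → f x ≡ g x) xs → big xs f ≡ big xs g
  big-cong eq = cong (foldr _∙_ ε) (Listₚ.map-cong-local eq)

  big-cong-∈ : ∀ {I : Set} (xs : List I) {f g : I → A} → (∀ {x} → x ∈ xs → f x ≡ g x) → big xs f ≡ big xs g
  big-cong-∈ xs eq = big-cong (All.tabulate eq)

  big-↭ : ∀ {I : Set} {xs ys : List I} {f : I → A} → xs ↭ ys → big xs f ≡ big ys f
  big-↭ ↭.refl = refl
  big-↭ {f = f} (↭.prep x p) = cong (f x ∙_) (big-↭ p)
  big-↭ {xs = _ ∷ _ ∷ xs} {f = f} (↭.swap x y p) =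
    trans (x∙yz≡y∙xz (f x) (f y) _) (cong (λ z → f y ∙ (f x ∙ z)) (big-↭ p))
  big-↭ (↭.trans p q) = trans (big-↭ p) (big-↭ q)

  big-ε : ∀ {I : Set} (xs : List I) → big xs (λ _ → ε) ≡ ε
  big-ε []       = refl
  big-ε (x ∷ xs) = trans (identityˡ _) (big-ε xs)

  big-∙ : ∀ {I : Set} (xs : List I) {f g : I → A} → big xs (λ x → f x ∙ g x) ≡ big xs f ∙ big xs g
  big-∙ []       = sym (identityˡ ε)
  big-∙ (x ∷ xs) {f} {g} = begin
    (f x ∙ g x) ∙ big xs (λ x → f x ∙ g x)  ≡⟨ cong ((f x ∙ g x) ∙_) (big-∙ xs) ⟩
    (f x ∙ g x) ∙ (big xs f ∙ big xs g)     ≡⟨ assoc (f x) (g x) _ ⟩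
    f x ∙ (g x ∙ (big xs f ∙ big xs g))     ≡⟨ cong (f x ∙_) (x∙yz≡y∙xz (g x) (big xs f) (big xs g)) ⟩
    f x ∙ (big xs f ∙ (g x ∙ big xs g))     ≡⟨ assoc (f x) (big xs f) _ ⟨
    (f x ∙ big xs f) ∙ (g x ∙ big xs g)     ∎
    where open ≡-Reasoning

  big-comm : ∀ {I J : Set} (xs : List I) (ys : List J) {f : I → J → A} →
             big xs (λ x → big ys (f x)) ≡ big ys (λ y → big xs (λ x → f x y))
  big-comm []       ys     = sym (big-ε ys)
  big-comm (x ∷ xs) ys {f} = trans (cong (big ys (f x) ∙_) (big-comm xs ys)) (sym (big-∙ ys))

  big-hom : ∀ {I : Set} (xs : List I) {f : I → A} (h : A → A) → h ε ≡ ε →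
            (∀ x y → h (x ∙ y) ≡ h x ∙ h y) → big xs (h ∘ f) ≡ h (big xs f)
  big-hom []           h hε h∙ = sym hε
  big-hom (x ∷ xs) {f} h hε h∙ = trans (cong (h (f x) ∙_) (big-hom xs h hε h∙)) (sym (h∙ (f x) _))

  big-map : ∀ {I J : Set} (h : J → I) (xs : List J) {f : I → A} → big (map h xs) f ≡ big xs (f ∘ h)
  big-map h xs = cong (foldr _∙_ ε) (sym (Listₚ.map-∘ xs))

  big-filter : ∀ {I : Set} {P : I → Set} (P? : ∀ x → Dec (P x)) (xs : List I) {f : I → A} →
               (∀ {x} → ¬ P x → f x ≡ ε) → big (filter P? xs) f ≡ big xs f
  big-filter P? []           fε = refl
  big-filter P? (x ∷ xs) {f} fε with P? x
  ... | yes _ = cong (f x ∙_) (big-filter P? xs fε)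
  ... | no ¬p = trans (big-filter P? xs fε) (sym (trans (cong (_∙ big xs f) (fε ¬p)) (identityˡ _)))

  -- Made for multiplicities: putting one more part in front of a list alters exactly one entry of a
  -- sum or product over all possible part sizes.
  big-change : ∀ {I : Set} {xs : List I} {f g : I → A} {x c} → Unique xs → x ∈ xs →
    (∀ {y} → y ≢ x → f y ≡ g y) → f x ≡ c ∙ g x → big xs f ≡ c ∙ big xs g
  big-change {xs = x ∷ xs} {f} {g} {c = c} (x∉ ∷ _) (here refl) eq eqx = begin
    f x ∙ big xs f        ≡⟨ cong₂ _∙_ eqx (big-cong (All.map (λ x≢y → eq (x≢y ∘ sym)) x∉)) ⟩
    (c ∙ g x) ∙ big xs g  ≡⟨ assoc c (g x) _ ⟩
    c ∙ (g x ∙ big xs g)  ∎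
    where open ≡-Reasoning
  big-change {xs = y ∷ xs} {f} {g} {x} {c} (y∉ ∷ u) (there x∈) eq eqx = begin
    f y ∙ big xs f        ≡⟨ cong₂ _∙_ (eq (All.lookup y∉ x∈)) (big-change u x∈ eq eqx) ⟩
    g y ∙ (c ∙ big xs g)  ≡⟨ x∙yz≡y∙xz (g y) c _ ⟩
    c ∙ (g y ∙ big xs g)  ∎
    where open ≡-Reasoning

module Sumℕ = BigOp _+_ 0 ℕₚ.+-0-isCommutativeMonoid
module Prodℕ = BigOp _*_ 1 ℕₚ.*-1-isCommutativeMonoid
module Sumℚ = BigOp ℚ._+_ 0ℚ ℚₚ.+-0-isCommutativeMonoid

[1⋯]-unique : ∀ n → Unique [ 1 ⋯ n ]
[1⋯]-unique n = Uniqueₚ.applyUpTo⁺₁ (1 +_) n (λ i<j _ eq → ℕₚ.<⇒≢ i<j (ℕₚ.suc-injective eq))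

∈-[1⋯]⁺ : ∀ {i n} → .{{_ : NonZero i}} → i ≤ n → i ∈ [ 1 ⋯ n ]
∈-[1⋯]⁺ {suc i} i<n = ∈-applyUpTo⁺ (1 +_) i<n

∈-[1⋯]⁻ : ∀ {i n} → i ∈ [ 1 ⋯ n ] → NonZero i × i ≤ n
∈-[1⋯]⁻ i∈ with ∈-applyUpTo⁻ (1 +_) i∈
... | _ , i<n , refl = _ , i<n

-- Multiplicities

mult-here : ∀ x L → mult (x ∷ L) x ≡ suc (mult L x)
mult-here x L = cong length (Listₚ.filter-accept (x ℕₚ.≟_) refl)

mult-there : ∀ {x i} L → i ≢ x → mult (x ∷ L) i ≡ mult L i
mult-there L i≢x = cong length (Listₚ.filter-reject (_ ℕₚ.≟_) i≢x)

mult-∉ : ∀ {i} L → i ∉ L → mult L i ≡ 0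
mult-∉ []      _  = refl
mult-∉ (x ∷ L) i∉ = trans (mult-there L (i∉ ∘ here)) (mult-∉ L (i∉ ∘ there))

mult-↭ : ∀ {L L′} i → L ↭ L′ → mult L i ≡ mult L′ i
mult-↭ i p = ↭ₚ.↭-length (↭ₚ.filter-↭ (i ℕₚ.≟_) p)

∏-parts : ∀ n L (f : ℕ → ℕ) → All (_∈ [ 1 ⋯ n ]) L →
          product (map f L) ≡ ∏[1⋯ n ] (λ a → f a ^ mult L a)
∏-parts n []      f _         = sym (Prodℕ.big-ε [ 1 ⋯ n ])
∏-parts n (x ∷ L) f (x∈ ∷ L∈) = sym (trans
  (Prodℕ.big-change {c = f x} ([1⋯]-unique n) x∈
    (λ {y} y≢x → cong (f y ^_) (mult-there L y≢x))
    (cong (f x ^_) (mult-here x L)))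
  (cong (f x *_) (sym (∏-parts n L f L∈))))

∑-parts : ∀ n L (f : ℕ → ℕ) → All (_∈ [ 1 ⋯ n ]) L →
          sum (map f L) ≡ sum (map (λ a → mult L a * f a) [ 1 ⋯ n ])
∑-parts n []      f _         = sym (Sumℕ.big-ε [ 1 ⋯ n ])
∑-parts n (x ∷ L) f (x∈ ∷ L∈) = sym (trans
  (Sumℕ.big-change {c = f x} ([1⋯]-unique n) x∈
    (λ {y} y≢x → cong (_* f y) (mult-there L y≢x))
    (cong (_* f x) (mult-here x L)))
  (cong (f x +_) (sym (∑-parts n L f L∈))))

∑-divisors : ∀ l .{{_ : NonZero l}} J → All NonZero J →
  sum (map (dividing l) J) ≡ sum (map (λ d → d * mult J d) (divisors l))
∑-divisors l []      _          = sym (trans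
  (Sumℕ.big-cong-∈ (divisors l) (λ {d} _ → ℕₚ.*-zeroʳ d)) (Sumℕ.big-ε (divisors l)))
∑-divisors l (x ∷ J) (nz ∷ nzs) with x ∣? l
... | yes x∣l = sym (trans
  (Sumℕ.big-change {c = x} (Uniqueₚ.filter⁺ (_∣? l) ([1⋯]-unique l))
    (∈-filter⁺ (_∣? l) (∈-[1⋯]⁺ {{nz}} (∣⇒≤ x∣l)) x∣l)
    (λ {y} y≢x → cong (y *_) (mult-there J y≢x))
    (trans (cong (x *_) (mult-here x J)) (ℕₚ.*-suc x (mult J x))))
  (cong (x +_) (sym (∑-divisors l J nzs))))
... | no ¬x∣l = trans
  (∑-divisors l J nzs)
  (Sumℕ.big-cong-∈ (divisors l) (λ {d} d∈ → cong (d *_) (sym (mult-there J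
    (λ { refl → ¬x∣l (proj₂ (∈-filter⁻ (_∣? l) {xs = [ 1 ⋯ l ]} d∈)) })))))

-- Deleting and inserting a part

delete : ℕ → List ℕ → List ℕ
delete i []      = []
delete i (x ∷ L) with i ℕₚ.≟ x
... | yes _ = L
... | no _  = x ∷ delete i L

delete-here : ∀ x L → delete x (x ∷ L) ≡ L
delete-here x L with x ℕₚ.≟ x
... | yes _  = refl
... | no x≢x = ⊥-elim (x≢x refl)

delete-∈ : ∀ {i L} → i ∈ L → i ∷ delete i L ↭ L
delete-∈ {i} {x ∷ L} i∈ with i ℕₚ.≟ x
... | yes refl = ↭-refl
delete-∈ {i} {x ∷ L} (here i≡x) | no i≢x = ⊥-elim (i≢x i≡x)
delete-∈ {i} {x ∷ L} (there i∈) | no i≢x = ↭-trans (↭.swap i x ↭-refl) (prep x (delete-∈ i∈))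

delete-there : ∀ {i} x {L} → i ∈ L → delete i (x ∷ L) ↭ x ∷ delete i L
delete-there {i} x i∈ with i ℕₚ.≟ x
... | yes refl = ↭-sym (delete-∈ i∈)
... | no _     = ↭-refl

delete-↭ : ∀ {i L L′} → i ∈ L → L ↭ L′ → delete i L ↭ delete i L′
delete-↭ i∈ p = ↭ₚ.drop-∷ (↭-trans (delete-∈ i∈) (↭-trans p (↭-sym (delete-∈ (↭ₚ.∈-resp-↭ p i∈)))))

-- Insertion produces cycle types as unsorted lists, while partitions are sorted; the two can be
-- compared only through functions of the underlying multiset.
Invariant : ∀ {A : Set} → (List ℕ → A) → Set
Invariant F = ∀ {L L′} → L ↭ L′ → F L ≡ F L′

-- For invariant `F` the lengthened part may be moved to the front. This makes the summand depend on
-- the part alone and not on its position, which gives the invariance of `grow F` and later allows a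
-- sum over part sizes.
grow-delete : ∀ F → Invariant F → ∀ L → grow F L ≡ sum (map (λ p → p * F (suc p ∷ delete p L)) L)
grow-delete F inv []      = refl
grow-delete F inv (l ∷ L) = cong₂ _+_
  (cong (λ M → l * F (suc l ∷ M)) (sym (delete-here l L)))
  (trans (grow-delete (F ∘ (l ∷_)) (inv ∘ prep l) L)
    (Sumℕ.big-cong-∈ L (λ {p} p∈ → cong (p *_)
      (inv (↭-trans (↭.swap l (suc p) ↭-refl) (prep (suc p) (↭-sym (delete-there l p∈))))))))

grow-invariant : ∀ {F} → Invariant F → Invariant (grow F)
grow-invariant {F} inv {L} {L′} p = begin
  grow F L                                           ≡⟨ grow-delete F inv L ⟩
  sum (map (λ p → p * F (suc p ∷ delete p L)) L)     ≡⟨ Sumℕ.big-cong-∈ L (λ {i} i∈ →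
    cong (i *_) (inv (prep (suc i) (delete-↭ i∈ p)))) ⟩
  sum (map (λ p → p * F (suc p ∷ delete p L′)) L)    ≡⟨ Sumℕ.big-↭ p ⟩
  sum (map (λ p → p * F (suc p ∷ delete p L′)) L′)   ≡⟨ grow-delete F inv L′ ⟨
  grow F L′                                          ∎
  where open ≡-Reasoning

sumPermutations-cong : ∀ n {F G : List ℕ → ℕ} → F ≗ G → sumPermutations n F ≡ sumPermutations n G
sumPermutations-cong zero    eq = eq []
sumPermutations-cong (suc n) eq = sumPermutations-cong n (λ L → cong₂ _+_ (eq (1 ∷ L)) (grow-cong eq L))
  where
  grow-cong : ∀ {F G : List ℕ → ℕ} → F ≗ G → grow F ≗ grow G
  grow-cong eq []      = refl
  grow-cong eq (l ∷ L) = cong₂ _+_ (cong (l *_) (eq (suc l ∷ L))) (grow-cong (eq ∘ (l ∷_)) L)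

-- Rational arithmetic

toℚᵘ-fromℕ : ∀ n → ℚ.toℚᵘ (fromℕ n) ℚᵘ.≃ ℚᵘ.mkℚᵘ (ℤ.+ n) 0
toℚᵘ-fromℕ n = ℚₚ.toℚᵘ-fromℚᵘ (ℚᵘ.mkℚᵘ (ℤ.+ n) 0)

fromℕ-+ : ∀ m n → fromℕ (m + n) ≡ fromℕ m ℚ.+ fromℕ n
fromℕ-+ m n = ℚₚ.toℚᵘ-injective (begin
  ℚ.toℚᵘ (fromℕ (m + n))                        ≈⟨ toℚᵘ-fromℕ (m + n) ⟩
  ℚᵘ.mkℚᵘ (ℤ.+ (m + n)) 0                       ≈⟨ ℚᵘ.*≡* (cong (ℤ._* ℤ.+ 1) (cong₂ ℤ._+_
    (sym (ℤₚ.*-identityʳ (ℤ.+ m))) (sym (ℤₚ.*-identityʳ (ℤ.+ n))))) ⟩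
  ℚᵘ.mkℚᵘ (ℤ.+ m) 0 ℚᵘ.+ ℚᵘ.mkℚᵘ (ℤ.+ n) 0      ≈⟨ ℚᵘₚ.+-cong (toℚᵘ-fromℕ m) (toℚᵘ-fromℕ n) ⟨
  ℚ.toℚᵘ (fromℕ m) ℚᵘ.+ ℚ.toℚᵘ (fromℕ n)        ≈⟨ ℚₚ.toℚᵘ-homo-+ (fromℕ m) (fromℕ n) ⟨
  ℚ.toℚᵘ (fromℕ m ℚ.+ fromℕ n)                  ∎)
  where open ℚᵘₚ.≃-Reasoning

fromℕ-* : ∀ m n → fromℕ (m * n) ≡ fromℕ m ℚ.* fromℕ n
fromℕ-* m n = ℚₚ.toℚᵘ-injective (begin
  ℚ.toℚᵘ (fromℕ (m * n))                        ≈⟨ toℚᵘ-fromℕ (m * n) ⟩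
  ℚᵘ.mkℚᵘ (ℤ.+ (m * n)) 0                       ≈⟨ ℚᵘ.*≡* (cong (ℤ._* ℤ.+ 1) (ℤₚ.pos-* m n)) ⟩
  ℚᵘ.mkℚᵘ (ℤ.+ m) 0 ℚᵘ.* ℚᵘ.mkℚᵘ (ℤ.+ n) 0      ≈⟨ ℚᵘₚ.*-cong (toℚᵘ-fromℕ m) (toℚᵘ-fromℕ n) ⟨
  ℚ.toℚᵘ (fromℕ m) ℚᵘ.* ℚ.toℚᵘ (fromℕ n)        ≈⟨ ℚₚ.toℚᵘ-homo-* (fromℕ m) (fromℕ n) ⟨
  ℚ.toℚᵘ (fromℕ m ℚ.* fromℕ n)                  ∎)
  where open ℚᵘₚ.≃-Reasoning

reciprocal : (d : ℕ) → .{{NonZero d}} → ℚ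
reciprocal d = ℤ.+ 1 ℚ./ d

reciprocal-inverse : ∀ d .{{_ : NonZero d}} → reciprocal d ℚ.* fromℕ d ≡ 1ℚ
reciprocal-inverse (suc d) = ℚₚ.toℚᵘ-injective (begin
  ℚ.toℚᵘ (reciprocal (suc d) ℚ.* fromℕ (suc d))              ≈⟨ ℚₚ.toℚᵘ-homo-* (reciprocal (suc d)) (fromℕ (suc d)) ⟩
  ℚ.toℚᵘ (reciprocal (suc d)) ℚᵘ.* ℚ.toℚᵘ (fromℕ (suc d))    ≈⟨ ℚᵘₚ.*-cong
    (ℚₚ.toℚᵘ-fromℚᵘ (ℚᵘ.mkℚᵘ (ℤ.+ 1) d)) (toℚᵘ-fromℕ (suc d)) ⟩
  ℚᵘ.mkℚᵘ (ℤ.+ 1) d ℚᵘ.* ℚᵘ.mkℚᵘ (ℤ.+ suc d) 0              ≈⟨ ℚᵘ.*≡* (cong ℤ.+_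
    (trans (ℕₚ.*-identityʳ _) (trans (ℕₚ.*-identityˡ (suc d))
      (sym (trans (ℕₚ.*-identityˡ _) (ℕₚ.*-identityʳ (suc d))))))) ⟩
  ℚ.toℚᵘ 1ℚ                                                  ∎)
  where open ℚᵘₚ.≃-Reasoning

reciprocal-unique : ∀ d .{{_ : NonZero d}} {q} → q ℚ.* fromℕ d ≡ 1ℚ → q ≡ reciprocal d
reciprocal-unique d {q} eq = begin
  q                                     ≡⟨ ℚₚ.*-identityʳ q ⟨
  q ℚ.* 1ℚ                              ≡⟨ cong (q ℚ.*_) (trans (ℚₚ.*-comm (fromℕ d) _) (reciprocal-inverse d)) ⟨
  q ℚ.* (fromℕ d ℚ.* reciprocal d)      ≡⟨ ℚₚ.*-assoc q _ _ ⟨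
  q ℚ.* fromℕ d ℚ.* reciprocal d        ≡⟨ cong (ℚ._* reciprocal d) eq ⟩
  1ℚ ℚ.* reciprocal d                   ≡⟨ ℚₚ.*-identityˡ _ ⟩
  reciprocal d                          ∎
  where open ≡-Reasoning

reciprocal-* : ∀ c d .{{_ : NonZero c}} .{{_ : NonZero d}} .{{_ : NonZero (c * d)}} →
               reciprocal c ℚ.* reciprocal d ≡ reciprocal (c * d)
reciprocal-* c d = reciprocal-unique (c * d) (begin
  reciprocal c ℚ.* reciprocal d ℚ.* fromℕ (c * d)              ≡⟨ cong (reciprocal c ℚ.* reciprocal d ℚ.*_)
    (trans (cong fromℕ (ℕₚ.*-comm c d)) (fromℕ-* d c)) ⟩
  reciprocal c ℚ.* reciprocal d ℚ.* (fromℕ d ℚ.* fromℕ c)      ≡⟨ ℚₚ.*-assoc (reciprocal c) (reciprocal d) _ ⟩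
  reciprocal c ℚ.* (reciprocal d ℚ.* (fromℕ d ℚ.* fromℕ c))    ≡⟨ cong (reciprocal c ℚ.*_) (trans
    (sym (ℚₚ.*-assoc (reciprocal d) _ _)) (trans (cong (ℚ._* fromℕ c) (reciprocal-inverse d)) (ℚₚ.*-identityˡ _))) ⟩
  reciprocal c ℚ.* fromℕ c                                     ≡⟨ reciprocal-inverse c ⟩
  1ℚ                                                           ∎)
  where open ≡-Reasoning

reciprocal-cancel : ∀ c d .{{_ : NonZero (c * d)}} .{{_ : NonZero d}} →
                    reciprocal (c * d) ℚ.* fromℕ c ≡ reciprocal d
reciprocal-cancel c d = reciprocal-unique d (trans (ℚₚ.*-assoc (reciprocal (c * d)) (fromℕ c) (fromℕ d))
  (trans (cong (reciprocal (c * d) ℚ.*_) (sym (fromℕ-* c d))) (reciprocal-inverse (c * d))))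

reciprocal-cong : ∀ {c d} .{{_ : NonZero c}} .{{_ : NonZero d}} → c ≡ d → reciprocal c ≡ reciprocal d
reciprocal-cong refl = refl

∑-*ˡ : ∀ {I : Set} (xs : List I) {f : I → ℚ} q → ∑ xs (λ x → q ℚ.* f x) ≡ q ℚ.* ∑ xs f
∑-*ˡ xs q = Sumℚ.big-hom xs (q ℚ.*_) (ℚₚ.*-zeroʳ q) (ℚₚ.*-distribˡ-+ q)

fromℕ-sum : ∀ {I : Set} (xs : List I) (f : I → ℕ) → fromℕ (sum (map f xs)) ≡ ∑ xs (fromℕ ∘ f)
fromℕ-sum []       f = refl
fromℕ-sum (x ∷ xs) f = trans (fromℕ-+ (f x) _) (cong (fromℕ (f x) ℚ.+_) (fromℕ-sum xs f))

-- Partitions with a marked part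

open Sort (Flip.decTotalOrder ℕₚ.≤-decTotalOrder) using (sort; sort-↭; sort-↗)

sorted-unique : ∀ {L L′} → Linked _≥_ L → Linked _≥_ L′ → L ↭ L′ → L ≡ L′
sorted-unique s s′ p = Pointwise-≡⇒≡
  (Sortedₚ.↗↭↗⇒≋ (Flip.totalOrder ℕₚ.≤-totalOrder) s s′ (↭.↭⇒↭ₛ p))

sort-isPartition : ∀ {n} L → All NonZero L → sum L ≡ n → IsPartition n (sort L)
sort-isPartition L nz s = record
  { decreasing = sort-↗ L
  ; positive   = ↭ₚ.All-resp-↭ (↭-sym (sort-↭ L)) nz
  ; total      = trans (sum-↭ (sort-↭ L)) s
  }

partition-∈ : ∀ n {j} → j ∈ partitions n → IsPartition n j
partition-∈ n = Equivalence.to (∈-partitions⇔ {n})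

∈-partition : ∀ n {j} → IsPartition n j → j ∈ partitions n
∈-partition n = Equivalence.from (∈-partitions⇔ {n})

parts-∈ : ∀ L → All NonZero L → All (_∈ [ 1 ⋯ sum L ]) L
parts-∈ L nz = All.tabulate λ {x} x∈ → ∈-[1⋯]⁺ {{All.lookup nz x∈}} (part≤sum L x∈)
  where
  part≤sum : ∀ L {x} → x ∈ L → x ≤ sum L
  part≤sum (x ∷ L) (here refl) = ℕₚ.m≤m+n x (sum L)
  part≤sum (y ∷ L) (there x∈)  = ℕₚ.≤-trans (part≤sum L x∈) (ℕₚ.m≤n+m (sum L) y)

partition-parts : ∀ {n j} → IsPartition n j → All (_∈ [ 1 ⋯ n ]) j
partition-parts {j = j} p = subst (λ n → All (_∈ [ 1 ⋯ n ]) j) total (parts-∈ j positive)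
  where open IsPartition p

unique-map : ∀ {A B : Set} {xs : List A} (f : A → B) →
  (∀ {x y} → x ∈ xs → y ∈ xs → f x ≡ f y → x ≡ y) → Unique xs → Unique (map f xs)
unique-map {xs = []}     f inj []      = []
unique-map {xs = x ∷ xs} f inj (n ∷ u) =
  Allₚ.map⁺ (All.tabulate λ y∈ eq → All.lookup n y∈ (inj (here refl) (there y∈) eq))
  ∷ unique-map f (λ p q → inj (there p) (there q)) u

delete-sum : ∀ {i L} → i ∈ L → i + sum (delete i L) ≡ sum L
delete-sum i∈ = sum-↭ (delete-∈ i∈)

-- Deleting one part `i` is inverted by inserting it and sorting. Both lists are free of repetitions
-- and have the same elements, so they agree up to order.
partitions-marked : ∀ n i .{{_ : NonZero i}} → i ≤ n →
  filter (i ∈?_) (partitions n) ↭ map (λ j → sort (i ∷ j)) (partitions (n ∸ i))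
partitions-marked n i i≤n = ∼bag⇒↭ (unique∧set⇒bag
  (Uniqueₚ.filter⁺ (i ∈?_) (partitions-unique n))
  (unique-map (λ j → sort (i ∷ j)) insert-injective (partitions-unique (n ∸ i)))
  (mk⇔ to from))
  where
  sorted : ∀ {j} → j ∈ partitions (n ∸ i) → Linked _≥_ j
  sorted j∈ = IsPartition.decreasing (partition-∈ (n ∸ i) j∈)

  insert-injective : ∀ {x y} → x ∈ partitions (n ∸ i) → y ∈ partitions (n ∸ i) →
                     sort (i ∷ x) ≡ sort (i ∷ y) → x ≡ y
  insert-injective {x} {y} x∈ y∈ eq = sorted-unique (sorted x∈) (sorted y∈) (↭ₚ.drop-∷
    (↭-trans (↭-sym (sort-↭ (i ∷ x))) (subst (_↭ i ∷ y) (sym eq) (sort-↭ (i ∷ y)))))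

  to : ∀ {j} → j ∈ filter (i ∈?_) (partitions n) → j ∈ map (λ j → sort (i ∷ j)) (partitions (n ∸ i))
  to {j} j∈ with ∈-filter⁻ (i ∈?_) {xs = partitions n} j∈
  ... | j∈n , i∈j = subst (_∈ _) (sym j≡) (∈-map⁺ (λ j → sort (i ∷ j)) (∈-partition (n ∸ i)
      (sort-isPartition (delete i j) (All.tail (↭ₚ.All-resp-↭ (↭-sym (delete-∈ i∈j)) positive))
        (trans (sym (ℕₚ.m+n∸m≡n i _)) (cong (_∸ i) (trans (delete-sum i∈j) total))))))
    where
    open IsPartition (partition-∈ n j∈n)
    j≡ : j ≡ sort (i ∷ sort (delete i j))
    j≡ = sorted-unique decreasing (sort-↗ (i ∷ sort (delete i j)))
      (↭-sym (↭-trans (sort-↭ _) (↭-trans (prep i (sort-↭ _)) (delete-∈ i∈j))))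

  from : ∀ {j} → j ∈ map (λ j → sort (i ∷ j)) (partitions (n ∸ i)) → j ∈ filter (i ∈?_) (partitions n)
  from j∈ with ∈-map⁻ (λ j → sort (i ∷ j)) j∈
  ... | j′ , j′∈ , refl = ∈-filter⁺ (i ∈?_)
    (∈-partition n (sort-isPartition (i ∷ j′) (recompute-i ∷ positive)
      (trans (cong (i +_) total) (ℕₚ.m+[n∸m]≡n i≤n))))
    (↭ₚ.∈-resp-↭ (↭-sym (sort-↭ (i ∷ j′))) (here refl))
    where
    open IsPartition (partition-∈ (n ∸ i) j′∈)
    -- The instance argument is irrelevant; the passage through `i ≢ 0` turns it into a proof that
    -- can be stored in the list.
    recompute-i : NonZero i
    recompute-i = ≢-nonZero (≢-nonZero⁻¹ i)

-- Orders of centralisers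

centraliserOrder-↭ : ∀ n {L L′} → L ↭ L′ → centraliserOrder n L ≡ centraliserOrder n L′
centraliserOrder-↭ n p = Prodℕ.big-cong-∈ [ 1 ⋯ n ]
  (λ {i} _ → cong (λ m → m ! * i ^ m) (mult-↭ i p))

product-applyUpTo-tail : ∀ (h : ℕ → ℕ) {m n} → m ≤ n → (∀ k → m ≤ k → h k ≡ 1) →
                         product (applyUpTo h n) ≡ product (applyUpTo h m)
product-applyUpTo-tail h {n = zero}  z≤n h≡1 = refl
product-applyUpTo-tail h {n = suc n} z≤n h≡1 =
  cong₂ _*_ (h≡1 0 z≤n) (product-applyUpTo-tail (h ∘ suc) {0} {n} z≤n (λ k _ → h≡1 (suc k) z≤n))
product-applyUpTo-tail h (s≤s m≤n) h≡1 =
  cong (h 0 *_) (product-applyUpTo-tail (h ∘ suc) m≤n (λ k m≤k → h≡1 (suc k) (s≤s m≤k)))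

-- A size that does not occur as a part contributes the factor `0 ! * i ^ 0`, which is 1.
centraliserOrder-bound : ∀ {m n} L → m ≤ n → All (_≤ m) L → centraliserOrder n L ≡ centraliserOrder m L
centraliserOrder-bound {m} {n} L m≤n L≤m = begin
  ∏[1⋯ n ] f                           ≡⟨ cong product (Listₚ.map-applyUpTo (1 +_) f n) ⟩
  product (applyUpTo (f ∘ (1 +_)) n)   ≡⟨ product-applyUpTo-tail _ m≤n (λ k m≤k → cong (λ e → e ! * suc k ^ e)
    (mult-∉ L (λ k∈ → ℕₚ.<⇒≱ (s≤s m≤k) (All.lookup L≤m k∈)))) ⟩
  product (applyUpTo (f ∘ (1 +_)) m)   ≡⟨ cong product (Listₚ.map-applyUpTo (1 +_) f m) ⟨
  ∏[1⋯ m ] f                           ∎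
  where
  open ≡-Reasoning
  f = λ i → mult L i ! * i ^ mult L i

centraliserOrder-∷ : ∀ n i L → i ∈ [ 1 ⋯ n ] →
  centraliserOrder n (i ∷ L) ≡ (i * mult (i ∷ L) i) * centraliserOrder n L
centraliserOrder-∷ n i L i∈ = Prodℕ.big-change {c = i * mult (i ∷ L) i} ([1⋯]-unique n) i∈
  (λ {y} y≢i → cong (λ e → e ! * y ^ e) (mult-there L y≢i))
  (trans (cong (λ e → e ! * i ^ e) (mult-here i L))
    (trans (rearrange i (mult L i) (mult L i !) (i ^ mult L i))
      (cong (λ e → i * e * (mult L i ! * i ^ mult L i)) (sym (mult-here i L)))))
  where
  open ℕ-Solver
  rearrange : ∀ i m f p → suc m * f * (i * p) ≡ i * suc m * (f * p)
  rearrange = solve 4 (λ i m f p → (con 1 :+ m) :* f :* (i :* p) := i :* (con 1 :+ m) :* (f :* p)) refl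

-- For a partition `j` of `n` this is the share of the permutations of cycle type `j` among all
-- permutations of `n` points, so the sums weighted by it below are means over the symmetric group.
weight : ℕ → List ℕ → ℚ
weight n j = reciprocal (centraliserOrder n j) {{centraliserOrder≢0 {n} {j}}}

-- Deleting a part `i` divides the centraliser order by `i * mult j i`, which cancels the factor in
-- the summand; partitions without the part `i` contribute zero. Invariance of `G` is asked for on
-- lists containing `i`, which is what summands built with `delete i` provide.
marked-sum : ∀ n i .{{_ : NonZero i}} → i ≤ n → (G : List ℕ → ℚ) →
  (∀ {L L′} → i ∈ L → L ↭ L′ → G L ≡ G L′) →
  ∑ (partitions n) (λ j → weight n j ℚ.* (fromℕ (i * mult j i) ℚ.* G j)) ≡
  ∑ (partitions (n ∸ i)) (λ j → weight (n ∸ i) j ℚ.* G (i ∷ j))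
marked-sum n i i≤n G G-inv = begin
  ∑ (partitions n) t                                            ≡⟨ Sumℚ.big-filter (i ∈?_) (partitions n) (λ {j} → t≡0 {j}) ⟨
  ∑ (filter (i ∈?_) (partitions n)) t                           ≡⟨ Sumℚ.big-↭ (partitions-marked n i i≤n) ⟩
  ∑ (map (λ j → sort (i ∷ j)) (partitions (n ∸ i))) t           ≡⟨ Sumℚ.big-map (λ j → sort (i ∷ j)) (partitions (n ∸ i)) ⟩
  ∑ (partitions (n ∸ i)) (λ j → t (sort (i ∷ j)))               ≡⟨ Sumℚ.big-cong-∈ (partitions (n ∸ i)) term ⟩
  ∑ (partitions (n ∸ i)) (λ j → weight (n ∸ i) j ℚ.* G (i ∷ j)) ∎
  where
  open ≡-Reasoning
  t : List ℕ → ℚ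
  t j = weight n j ℚ.* (fromℕ (i * mult j i) ℚ.* G j)

  t≡0 : ∀ {j} → i ∉ j → t j ≡ 0ℚ
  t≡0 {j} i∉ = begin
    weight n j ℚ.* (fromℕ (i * mult j i) ℚ.* G j)  ≡⟨ cong (λ m → weight n j ℚ.* (fromℕ m ℚ.* G j))
      (trans (cong (i *_) (mult-∉ j i∉)) (ℕₚ.*-zeroʳ i)) ⟩
    weight n j ℚ.* (0ℚ ℚ.* G j)                    ≡⟨ cong (weight n j ℚ.*_) (ℚₚ.*-zeroˡ (G j)) ⟩
    weight n j ℚ.* 0ℚ                              ≡⟨ ℚₚ.*-zeroʳ (weight n j) ⟩
    0ℚ                                             ∎

  term : ∀ {j} → j ∈ partitions (n ∸ i) → t (sort (i ∷ j)) ≡ weight (n ∸ i) j ℚ.* G (i ∷ j)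
  term {j} j∈ = begin
    weight n s ℚ.* (fromℕ c ℚ.* G s)  ≡⟨ ℚₚ.*-assoc (weight n s) (fromℕ c) (G s) ⟨
    weight n s ℚ.* fromℕ c ℚ.* G s    ≡⟨ cong₂ ℚ._*_ cancel (G-inv (↭ₚ.∈-resp-↭ (↭-sym s↭) (here refl)) s↭) ⟩
    weight (n ∸ i) j ℚ.* G (i ∷ j)    ∎
    where
    s = sort (i ∷ j)
    s↭ = sort-↭ (i ∷ j)
    c = i * mult s i
    z = centraliserOrder (n ∸ i) j

    z-s : centraliserOrder n s ≡ c * z
    z-s = begin
      centraliserOrder n s                              ≡⟨ centraliserOrder-↭ n s↭ ⟩
      centraliserOrder n (i ∷ j)                        ≡⟨ centraliserOrder-∷ n i j (∈-[1⋯]⁺ i≤n) ⟩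
      (i * mult (i ∷ j) i) * centraliserOrder n j       ≡⟨ cong₂ _*_ (cong (i *_) (sym (mult-↭ i s↭)))
        (centraliserOrder-bound j (ℕₚ.m∸n≤m n i)
          (All.map (λ x∈ → proj₂ (∈-[1⋯]⁻ x∈)) (partition-parts (partition-∈ (n ∸ i) j∈)))) ⟩
      c * z                                             ∎

    instance
      z≢0 : NonZero z
      z≢0 = centraliserOrder≢0 {n ∸ i} {j}

      cz≢0 : NonZero (c * z)
      cz≢0 = subst NonZero z-s (centraliserOrder≢0 {n} {s})

    cancel : weight n s ℚ.* fromℕ c ≡ weight (n ∸ i) j
    cancel = trans (cong (ℚ._* fromℕ c) (reciprocal-cong {{centraliserOrder≢0 {n} {s}}} z-s))
                   (reciprocal-cancel c z)

-- Averages over partitions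

partitionAverage : ℕ → (List ℕ → ℚ) → ℚ
partitionAverage n f = ∑ (partitions n) λ j → weight n j ℚ.* f j

partitionAverage-cong : ∀ n {f g : List ℕ → ℚ} → (∀ {j} → j ∈ partitions n → f j ≡ g j) →
                        partitionAverage n f ≡ partitionAverage n g
partitionAverage-cong n eq = Sumℚ.big-cong-∈ (partitions n) (λ {j} j∈ → cong (weight n j ℚ.*_) (eq j∈))

partitionAverage-*ˡ : ∀ n {f : List ℕ → ℚ} q →
  partitionAverage n (λ j → q ℚ.* f j) ≡ q ℚ.* partitionAverage n f
partitionAverage-*ˡ n {f} q = trans
  (Sumℚ.big-cong-∈ (partitions n) (λ {j} _ → swap (weight n j) (f j))) (∑-*ˡ (partitions n) q)
  where
  open ≡-Reasoning
  swap : ∀ w x → w ℚ.* (q ℚ.* x) ≡ q ℚ.* (w ℚ.* x)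
  swap w x = trans (sym (ℚₚ.*-assoc w q x)) (trans (cong (ℚ._* x) (ℚₚ.*-comm w q)) (ℚₚ.*-assoc q w x))

∑-marked : ∀ n (H : ℕ → List ℕ → ℚ) → (∀ i {L L′} → i ∈ L → L ↭ L′ → H i L ≡ H i L′) →
  partitionAverage n (λ j → ∑ [ 1 ⋯ n ] (λ i → fromℕ (i * mult j i) ℚ.* H i j)) ≡
  ∑ [ 1 ⋯ n ] (λ i → partitionAverage (n ∸ i) (λ j → H i (i ∷ j)))
∑-marked n H H-inv = begin
  ∑ (partitions n) (λ j → weight n j ℚ.* ∑ [ 1 ⋯ n ] (λ i → fromℕ (i * mult j i) ℚ.* H i j))
    ≡⟨ Sumℚ.big-cong-∈ (partitions n) (λ {j} _ → sym (∑-*ˡ [ 1 ⋯ n ] (weight n j))) ⟩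
  ∑ (partitions n) (λ j → ∑ [ 1 ⋯ n ] (λ i → weight n j ℚ.* (fromℕ (i * mult j i) ℚ.* H i j)))
    ≡⟨ Sumℚ.big-comm (partitions n) [ 1 ⋯ n ] ⟩
  ∑ [ 1 ⋯ n ] (λ i → ∑ (partitions n) (λ j → weight n j ℚ.* (fromℕ (i * mult j i) ℚ.* H i j)))
    ≡⟨ Sumℚ.big-cong-∈ [ 1 ⋯ n ] (λ {i} i∈ →
         marked-sum n i {{proj₁ (∈-[1⋯]⁻ i∈)}} (proj₂ (∈-[1⋯]⁻ i∈)) (H i) (H-inv i)) ⟩
  ∑ [ 1 ⋯ n ] (λ i → partitionAverage (n ∸ i) (λ j → H i (i ∷ j))) ∎
  where open ≡-Reasoning

fromℕ-sum-parts : ∀ {n j} → IsPartition n j → (f : ℕ → ℕ) →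
  fromℕ (sum (map (λ p → p * f p) j)) ≡ ∑ [ 1 ⋯ n ] (λ i → fromℕ (i * mult j i) ℚ.* fromℕ (f i))
fromℕ-sum-parts {n} {j} p f = begin
  fromℕ (sum (map (λ p → p * f p) j))                           ≡⟨ cong fromℕ (∑-parts n j _ (partition-parts p)) ⟩
  fromℕ (sum (map (λ i → mult j i * (i * f i)) [ 1 ⋯ n ]))      ≡⟨ fromℕ-sum [ 1 ⋯ n ] _ ⟩
  ∑ [ 1 ⋯ n ] (λ i → fromℕ (mult j i * (i * f i)))              ≡⟨ Sumℚ.big-cong-∈ [ 1 ⋯ n ] (λ {i} _ →
    trans (cong fromℕ (trans (sym (ℕₚ.*-assoc (mult j i) i (f i))) (cong (_* f i) (ℕₚ.*-comm (mult j i) i))))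
          (fromℕ-* (i * mult j i) (f i))) ⟩
  ∑ [ 1 ⋯ n ] (λ i → fromℕ (i * mult j i) ℚ.* fromℕ (f i))      ∎
  where open ≡-Reasoning

-- Both sides are the sum over i of the averages of F (1 + i ∷ _) on the partitions of n ∸ i.

partitionAverage-suc : ∀ n (F : List ℕ → ℕ) → Invariant F →
  partitionAverage n (λ j → fromℕ (F (1 ∷ j) + grow F j)) ≡
  fromℕ (suc n) ℚ.* partitionAverage (suc n) (fromℕ ∘ F)
partitionAverage-suc n F inv = begin
  partitionAverage n (λ j → fromℕ (F (1 ∷ j) + grow F j))
    ≡⟨ Sumℚ.big-cong-∈ (partitions n) (λ {j} _ → trans (cong (weight n j ℚ.*_) (fromℕ-+ (F (1 ∷ j)) (grow F j)))
         (ℚₚ.*-distribˡ-+ (weight n j) _ _)) ⟩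
  ∑ (partitions n) (λ j → weight n j ℚ.* fromℕ (F (1 ∷ j)) ℚ.+ weight n j ℚ.* fromℕ (grow F j))
    ≡⟨ Sumℚ.big-∙ (partitions n) ⟩
  A 0 ℚ.+ partitionAverage n (λ j → fromℕ (grow F j))
    ≡⟨ cong (A 0 ℚ.+_) (partitionAverage-cong n (λ {j} j∈ →
         trans (cong fromℕ (grow-delete F inv j)) (fromℕ-sum-parts (partition-∈ n j∈) (λ p → F (suc p ∷ delete p j))))) ⟩
  A 0 ℚ.+ partitionAverage n (λ j → ∑ [ 1 ⋯ n ] (λ i → fromℕ (i * mult j i) ℚ.* fromℕ (F (suc i ∷ delete i j))))
    ≡⟨ cong (A 0 ℚ.+_) (∑-marked n (λ i j → fromℕ (F (suc i ∷ delete i j)))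
         (λ i i∈ p → cong fromℕ (inv (prep (suc i) (delete-↭ i∈ p))))) ⟩
  A 0 ℚ.+ ∑ [ 1 ⋯ n ] (λ i → partitionAverage (n ∸ i) (λ j → fromℕ (F (suc i ∷ delete i (i ∷ j)))))
    ≡⟨ cong (A 0 ℚ.+_) (Sumℚ.big-cong-∈ [ 1 ⋯ n ] (λ {i} _ → partitionAverage-cong (n ∸ i)
         (λ {j} _ → cong (λ L → fromℕ (F (suc i ∷ L))) (delete-here i j)))) ⟩
  A 0 ℚ.+ ∑ [ 1 ⋯ n ] A
    ≡⟨ cong (λ xs → A 0 ℚ.+ foldr ℚ._+_ 0ℚ xs) (Listₚ.map-applyUpTo (1 +_) A n) ⟩
  A 0 ℚ.+ foldr ℚ._+_ 0ℚ (applyUpTo (A ∘ (1 +_)) n)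
    -- `A i` computes to `B (suc i)`, so the new fixed point, counted by `A 0`, supplies the term
    -- with index 1.
    ≡⟨ cong (λ xs → A 0 ℚ.+ foldr ℚ._+_ 0ℚ xs) (Listₚ.map-applyUpTo (2 +_) B n) ⟨
  ∑ [ 1 ⋯ suc n ] B
    ≡⟨ ∑-marked (suc n) (λ _ j → fromℕ (F j)) (λ _ _ p → cong fromℕ (inv p)) ⟨
  partitionAverage (suc n) (λ j → ∑ [ 1 ⋯ suc n ] (λ i → fromℕ (i * mult j i) ℚ.* fromℕ (F j)))
    -- The numbers `i * mult j i` add up to the sum of the parts of `j`, which is the factor
    -- `suc n`.
    ≡⟨ partitionAverage-cong (suc n) (λ {j} j∈ → trans (sym (fromℕ-sum-parts (partition-∈ (suc n) j∈) (λ _ → F j)))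
         (trans (cong fromℕ (trans (Sumℕ.big-hom j (_* F j) refl (ℕₚ.*-distribʳ-+ (F j)))
                                   (cong (_* F j) (trans (cong sum (Listₚ.map-id j)) (IsPartition.total (partition-∈ (suc n) j∈))))))
                (fromℕ-* (suc n) (F j)))) ⟩
  partitionAverage (suc n) (λ j → fromℕ (suc n) ℚ.* fromℕ (F j))
    ≡⟨ partitionAverage-*ˡ (suc n) (fromℕ (suc n)) ⟩
  fromℕ (suc n) ℚ.* partitionAverage (suc n) (fromℕ ∘ F) ∎
  where
  open ≡-Reasoning
  A B : ℕ → ℚ
  A i = partitionAverage (n ∸ i) (λ j → fromℕ (F (suc i ∷ j)))
  B i = partitionAverage (suc n ∸ i) (λ j → fromℕ (F (i ∷ j)))

-- In substance this is the formula for the sizes of conjugacy classes, proved for all invariant `F`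
-- at once: `partitionAverage-suc` supplies the factor `suc n` at each insertion, and
-- `grow-invariant` keeps the modified summand within reach of the induction.
sumPermutations-average : ∀ n (F : List ℕ → ℕ) → Invariant F →
  fromℕ (sumPermutations n F) ≡ fromℕ (n !) ℚ.* partitionAverage n (fromℕ ∘ F)
sumPermutations-average zero    F inv = sym (trans (ℚₚ.*-identityˡ _)
  (trans (ℚₚ.+-identityʳ _) (ℚₚ.*-identityˡ _)))
sumPermutations-average (suc n) F inv = begin
  fromℕ (sumPermutations n (λ L → F (1 ∷ L) + grow F L))
    ≡⟨ sumPermutations-average n _ (λ p → cong₂ _+_ (inv (prep 1 p)) (grow-invariant inv p)) ⟩
  fromℕ (n !) ℚ.* partitionAverage n (λ L → fromℕ (F (1 ∷ L) + grow F L))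
    ≡⟨ cong (fromℕ (n !) ℚ.*_) (partitionAverage-suc n F inv) ⟩
  fromℕ (n !) ℚ.* (fromℕ (suc n) ℚ.* partitionAverage (suc n) (fromℕ ∘ F))
    ≡⟨ ℚₚ.*-assoc (fromℕ (n !)) _ _ ⟨
  fromℕ (n !) ℚ.* fromℕ (suc n) ℚ.* partitionAverage (suc n) (fromℕ ∘ F)
    ≡⟨ cong (ℚ._* partitionAverage (suc n) (fromℕ ∘ F)) (trans (sym (fromℕ-* (n !) (suc n))) (cong fromℕ (ℕₚ.*-comm (n !) (suc n)))) ⟩
  fromℕ (suc n !) ℚ.* partitionAverage (suc n) (fromℕ ∘ F) ∎
  where open ≡-Reasoning

-- Multiplication tables up to relabelling

relabellings : ℕ → ℕ → Group 0ℓ 0ℓ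
relabellings k b = DirectProduct.group (permutationGroup k) (permutationGroup b)

-- The arguments are the `k` generators and the values are the elements of the square: `zero` stands
-- for the zero of the semigroup, the other `b` values for its nonzero products.
Table : ℕ → ℕ → Set
Table k b = Fin k × Fin k → Fin (suc b)

Tables : ℕ → ℕ → Setoid 0ℓ 0ℓ
Tables k b = Functions (Fin k × Fin k) (suc b)

-- Arguments are pulled back along the inverse of `σ` to obtain a left action, and `lift₀ τ` keeps
-- the zero in place.
relabelling : ∀ k b → Action (relabellings k b) (Tables k b)
relabelling k b = record
  { act      = λ { (σ , τ) f (x , y) → lift₀ τ ⟨$⟩ʳ f (σ ⟨$⟩ˡ x , σ ⟨$⟩ˡ y) }
  ; act-cong = λ { {σ , τ} {σ′ , τ′} {f} {g} (σ≈ , τ≈) f≈g (x , y) → trans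
      (Perm.lift₀-cong τ τ′ τ≈ (f (σ ⟨$⟩ˡ x , σ ⟨$⟩ˡ y)))
      (cong (lift₀ τ′ ⟨$⟩ʳ_) (trans (f≈g (σ ⟨$⟩ˡ x , σ ⟨$⟩ˡ y))
        (cong₂ (λ u v → g (u , v)) (⁻¹-cong {σ} {σ′} σ≈ x) (⁻¹-cong {σ} {σ′} σ≈ y)))) }
  ; act-ε    = λ f p → Perm.lift₀-id (f p)
  ; act-∙    = λ { (_ , τ) (_ , τ′) f p → sym (Perm.lift₀-comp τ′ τ (f _)) }
  }
  where open Group (permutationGroup k) using (⁻¹-cong)

size-relabellings : ∀ k b → HasSize (Group.setoid (relabellings k b)) (k ! * b !)
size-relabellings k b = size-× (size-permutations k) (size-permutations b)

size-Tables : ∀ k b → HasSize (Tables k b) (suc b ^ (k * k))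
size-Tables k b = size-functions (suc b) (Symmetry.inverse Finₚ.*↔×)

TableClasses : ℕ → ℕ → Setoid 0ℓ 0ℓ
TableClasses k b = Action.orbits (relabelling k b)

module _ {k b : ℕ} where
  open Action (relabelling k b)

  classes-≟ : ∀ f g → Dec (Setoid._≈_ (TableClasses k b) f g)
  classes-≟ f g = map′
    (λ { (i , eq) → G.from i , eq })
    (λ { (π , eq) → G.to π , λ p →
      trans (act-cong {G.from (G.to π)} {π} {f} {f} (G.from-to π) (λ _ → refl) p) (eq p) })
    (Finₚ.any? (λ i → Size.≈-dec (size-Tables k b) (act (G.from i) f) g))
    where module G = Size (size-relabellings k b)

countClasses : ∀ k b → ∃[ c ] HasSize (TableClasses k b) c
countClasses k b = finite-quotient (TableClasses k b) classes-≟ (just ∘ T.from)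
  (λ f → T.to f , T.from (T.to f) , refl ,
    (Perm.id , Perm.id) , λ p → trans (act-ε (T.from (T.to f)) p) (T.from-to f p))
  where
  open Action (relabelling k b)
  module T = Size (size-Tables k b)

pairProduct-invariantˡ : ∀ J → Invariant (λ K → pairProduct K J)
pairProduct-invariantˡ J {K} {K′} p = trans
  (Prodℕ.big-cong-∈ K (λ _ → Prodℕ.big-↭ p)) (Prodℕ.big-↭ p)

pairProduct-invariantʳ : ∀ K → Invariant (pairProduct K)
pairProduct-invariantʳ K p = Prodℕ.big-cong-∈ K λ {a} _ → Prodℕ.big-cong-∈ K λ {b} _ →
  cong (λ s → (1 + s) ^ gcd a b) (Sumℕ.big-↭ p)

lift₀-≃ : ∀ {n} (π : Permutation′ n) L → (π ⟨$⟩ʳ_) ≃ rotates L → (lift₀ π ⟨$⟩ʳ_) ≃ rotates (1 ∷ L)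
lift₀-≃ π L e = ≃-trans (conj (mk↔ₛ′ id id (λ _ → refl) (λ _ → refl))
  (λ { zero → refl ; (suc _) → refl })) (extend-zero π L e)

-- Moving the inverse of `σ` to the other side turns "fixed by (σ , τ)" into equivariance, which
-- survives replacing `σ` and `τ` by conjugates, hence by standard unions of cycles. The permutation
-- `τ` comes outermost to match the order of the double sum in `N`.
size-fixedPairs : ∀ k b → HasSize (Action.FixedPairs (relabelling k b))
  (sumPermutations b λ J → sumPermutations k λ K → pairProduct K J)
size-fixedPairs k b = size-resp
  (bijection⇒inverse FixedPairs (Sub (Permutations b ×ₛ (Permutations k ×ₛ Tables k b)) (uncurry R))
    (λ { (((σ , τ) , f) , eq) → (τ , σ , f) , fixed⇒equivariant σ τ f eq })
    (λ { ((p , q) , e) → q , p , e })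
    (λ { (q , p , e) → (p , q) , e })
    (λ { ((τ , σ , f) , eq) → (((σ , τ) , f) , λ { (x , y) →
           trans (sym (eq (σ ⟨$⟩ˡ x , σ ⟨$⟩ˡ y)))
                 (cong₂ (λ u v → f (u , v)) (Perm.inverseʳ σ) (Perm.inverseʳ σ)) })
       , (λ _ → refl) , (λ _ → refl) , λ _ → refl }))
  (size-over-permutations b (Permutations k ×ₛ Tables k b) R _
    (λ { {τ} {τ′} {σ , f} τ≈ eq p → trans (eq p) (Perm.lift₀-cong τ τ′ τ≈ (f p)) })
    λ τ J nzJ eJ → size-over-permutations k (Tables k b) (λ σ f → R τ (σ , f)) _
      (λ { {σ} {σ′} {f} σ≈ eq p → trans
        (cong₂ (λ u v → f (u , v)) (sym (σ≈ (proj₁ p))) (sym (σ≈ (proj₂ p)))) (eq p) })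
      λ σ K nzK eK → equivariants-≃ (×-≃ eK eK) (lift₀-≃ τ J eJ) (equivariants-pairs K J nzK nzJ))
  where
  open Action (relabelling k b)

  R : Permutation′ b → Permutation′ k × Table k b → Set
  R τ (σ , f) = Equivariant ((σ ⟨$⟩ʳ_) ⊗ (σ ⟨$⟩ʳ_)) (lift₀ τ ⟨$⟩ʳ_) f

  fixed⇒equivariant : ∀ σ τ f → (∀ p → act (σ , τ) f p ≡ f p) → R τ (σ , f)
  fixed⇒equivariant σ τ f eq (x , y) = trans (sym (eq (σ ⟨$⟩ʳ x , σ ⟨$⟩ʳ y)))
    (cong₂ (λ u v → lift₀ τ ⟨$⟩ʳ f (u , v)) (Perm.inverseˡ σ) (Perm.inverseˡ σ))

doubleAverage : ℕ → ℕ → ℚ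
doubleAverage k b = partitionAverage b λ J → partitionAverage k λ K → fromℕ (pairProduct K J)

classes-average : ∀ k b {c} → HasSize (TableClasses k b) c → fromℕ c ≡ doubleAverage k b
classes-average k b {c} s = cancel (begin
  fromℕ c ℚ.* fromℕ (k ! * b !)     ≡⟨ fromℕ-* c (k ! * b !) ⟨
  fromℕ (c * (k ! * b !))           ≡⟨ cong fromℕ (size-unique
    (burnside (relabelling k b) (size-relabellings k b) (size-Tables k b) s) (size-fixedPairs k b)) ⟩
  fromℕ (sumPermutations b λ J → sumPermutations k λ K → pairProduct K J)
    ≡⟨ sumPermutations-average b _ (λ p → sumPermutations-cong k (λ K → pairProduct-invariantʳ K p)) ⟩
  fromℕ (b !) ℚ.* partitionAverage b (λ J → fromℕ (sumPermutations k λ K → pairProduct K J))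
    ≡⟨ cong (fromℕ (b !) ℚ.*_) (trans
         (partitionAverage-cong b (λ {J} _ → sumPermutations-average k _ (pairProduct-invariantˡ J)))
         (partitionAverage-*ˡ b (fromℕ (k !)))) ⟩
  fromℕ (b !) ℚ.* (fromℕ (k !) ℚ.* doubleAverage k b)
    ≡⟨ ℚₚ.*-assoc (fromℕ (b !)) (fromℕ (k !)) (doubleAverage k b) ⟨
  fromℕ (b !) ℚ.* fromℕ (k !) ℚ.* doubleAverage k b
    ≡⟨ cong (ℚ._* doubleAverage k b) (trans (sym (fromℕ-* (b !) (k !))) (cong fromℕ (ℕₚ.*-comm (b !) (k !)))) ⟩
  fromℕ (k ! * b !) ℚ.* doubleAverage k b
    ≡⟨ ℚₚ.*-comm (fromℕ (k ! * b !)) (doubleAverage k b) ⟩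
  doubleAverage k b ℚ.* fromℕ (k ! * b !) ∎)
  where
  open ≡-Reasoning
  instance
    kb≢0 : NonZero (k ! * b !)
    kb≢0 = ℕₚ.m*n≢0 (k !) (b !) {{ℕₚ._!≢0 k}} {{ℕₚ._!≢0 b}}

  cancel : ∀ {p q} → p ℚ.* fromℕ (k ! * b !) ≡ q ℚ.* fromℕ (k ! * b !) → p ≡ q
  cancel {p} {q} eq = trans (sym (undo p)) (trans (cong (ℚ._* r) eq) (undo q))
    where
    r = reciprocal (k ! * b !)
    undo : ∀ p → p ℚ.* fromℕ (k ! * b !) ℚ.* r ≡ p
    undo p = trans (ℚₚ.*-assoc p _ r) (trans (cong (p ℚ.*_)
      (trans (ℚₚ.*-comm (fromℕ (k ! * b !)) r) (reciprocal-inverse (k ! * b !)))) (ℚₚ.*-identityʳ p))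

-- The numbers `N` as counts of table classes

^-distribʳ-* : ∀ n x y → (x * y) ^ n ≡ x ^ n * y ^ n
^-distribʳ-* zero    x y = refl
^-distribʳ-* (suc n) x y = trans (cong (x * y *_) (^-distribʳ-* n x y))
  (ℕₚ.[m*n]*[o*p]≡[m*o]*[n*p] x y (x ^ n) (y ^ n))

-- Grouping equal parts: the pair of lengths (a , b) occurs `mult K a * mult K b` times, and equal
-- factors become powers.
pairProduct-partitions : ∀ {k b K J} → IsPartition k K → IsPartition b J →
  pairProduct K J ≡ (∏[1⋯ k ] λ a → ∏[1⋯ k ] λ b →
    (1 + sum (map (λ d → d * mult J d) (divisors (lcm a b)))) ^ (mult K a * mult K b * gcd a b))
pairProduct-partitions {k} {b} {K} {J} pK pJ = trans
  (∏-parts k K _ parts)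
  (Prodℕ.big-cong-∈ [ 1 ⋯ k ] λ {a} a∈ → trans
    (cong (_^ mult K a) (∏-parts k K _ parts))
    (trans (sym (Prodℕ.big-hom [ 1 ⋯ k ] (_^ mult K a) (ℕₚ.^-zeroˡ (mult K a))
                  (^-distribʳ-* (mult K a))))
      (Prodℕ.big-cong-∈ [ 1 ⋯ k ] λ {b} b∈ → trans
        (powers (gcd a b) (mult K b) (mult K a))
        (cong (λ s → (1 + s) ^ (mult K a * mult K b * gcd a b))
          (∑-divisors (lcm a b) {{lcm-nonZero a b {{proj₁ (∈-[1⋯]⁻ a∈)}} {{proj₁ (∈-[1⋯]⁻ b∈)}}}} J
            (IsPartition.positive pJ))))))
  where
  parts = partition-parts pK

  powers : ∀ g m n {x} → ((x ^ g) ^ m) ^ n ≡ x ^ (n * m * g)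
  powers g m n {x} = trans (cong (_^ n) (ℕₚ.^-*-assoc x g m)) (trans (ℕₚ.^-*-assoc x (g * m) n)
    (cong (x ^_) (trans (ℕₚ.*-comm (g * m) n) (trans (cong (n *_) (ℕₚ.*-comm g m)) (sym (ℕₚ.*-assoc n m g))))))

N-average : ∀ p q → N p q ≡ doubleAverage (p ∸ q) (q ∸ 1)
N-average p q = Sumℚ.big-cong-∈ (partitions (q ∸ 1)) λ {J} J∈ → trans
  (Sumℚ.big-cong-∈ (partitions (p ∸ q)) λ {K} K∈ → trans
    (cong₂ ℚ._*_
      (sym (reciprocal-* (centraliserOrder (q ∸ 1) J) (centraliserOrder (p ∸ q) K)
        {{centraliserOrder≢0 {q ∸ 1} {J}}} {{centraliserOrder≢0 {p ∸ q} {K}}}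
        {{ℕₚ.m*n≢0 _ _ {{centraliserOrder≢0 {q ∸ 1} {J}}} {{centraliserOrder≢0 {p ∸ q} {K}}}}}))
      (cong fromℕ (sym (pairProduct-partitions (partition-∈ (p ∸ q) K∈) (partition-∈ (q ∸ 1) J∈)))))
    (ℚₚ.*-assoc (weight (q ∸ 1) J) (weight (p ∸ q) K) _))
  (∑-*ˡ (partitions (p ∸ q)) (weight (q ∸ 1) J))

classes-N : ∀ p q {c} → HasSize (TableClasses (p ∸ q) (q ∸ 1)) c → fromℕ c ≡ N p q
classes-N p q s = trans (classes-average (p ∸ q) (q ∸ 1) s) (sym (N-average p q))

-- Tables attaining every nonzero value

-- The value `zero` is exempt, since the zero of the semigroup is its own square.
Full : ∀ {k b} → Table k b → Set
Full {k} {b} f = ∀ (y : Fin b) → Σ[ p ∈ Fin k × Fin k ] f p ≡ suc y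

any-pair? : ∀ {k} {P : Fin k × Fin k → Set} → (∀ p → Dec (P p)) → Dec (Σ _ P)
any-pair? P? = map′ (λ { (x , y , p) → (x , y) , p }) (λ { ((x , y) , p) → x , y , p })
  (Finₚ.any? λ x → Finₚ.any? λ y → P? (x , y))

full⊎missed : ∀ {k b} (f : Table k b) → Full f ⊎ Σ[ y ∈ Fin b ] (∀ p → f p ≢ suc y)
full⊎missed f with Finₚ.any? (λ y → ¬? (any-pair? (λ p → f p Finₚ.≟ suc y)))
... | yes (y , ¬p) = inj₂ (y , λ p eq → ¬p (p , eq))
... | no ¬∃ = inj₁ λ y → attained y (any-pair? (λ p → f p Finₚ.≟ suc y))
  where
  attained : ∀ y → Dec (Σ _ (λ p → f p ≡ suc y)) → Σ _ (λ p → f p ≡ suc y)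
  attained y (yes p) = p
  attained y (no ¬p) = ⊥-elim (¬∃ (y , ¬p))

FullClasses : ℕ → ℕ → Setoid 0ℓ 0ℓ
FullClasses k b = Sub (TableClasses k b) Full

countFull : ∀ k b → ∃[ c ] HasSize (FullClasses k b) c
countFull k b = finite-quotient (FullClasses k b) (λ (f , _) (g , _) → classes-≟ f g)
  (λ i → select (T.from i) (full⊎missed (T.from i)))
  (λ (f , full) → T.to f , selected f full (full⊎missed (T.from (T.to f))))
  where
  open Action (relabelling k b)
  module T = Size (size-Tables k b)

  select : ∀ f → Full f ⊎ Σ[ y ∈ Fin b ] (∀ p → f p ≢ suc y) → Maybe (Σ (Table k b) Full)
  select f (inj₁ full) = just (f , full)
  select f (inj₂ _)    = nothing

  selected : ∀ f → Full f → (d : Full (T.from (T.to f)) ⊎ _) →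
    Σ[ g ∈ Σ (Table k b) Full ] select (T.from (T.to f)) d ≡ just g ×
                                Setoid._≈_ (TableClasses k b) (proj₁ g) f
  selected f full (inj₁ full′) = (_ , full′) , refl ,
    (Perm.id , Perm.id) , λ p → trans (act-ε (T.from (T.to f)) p) (T.from-to f p)
  selected f full (inj₂ (y , missed)) =
    ⊥-elim (missed (proj₁ (full y)) (trans (T.from-to f _) (proj₂ (full y))))

-- The value left out is `suc zero`, the first nonzero one, so that the zero stays where it is.
widen : ∀ {k b} → Table k b → Table k (suc b)
widen f p = punchIn (suc zero) (f p)

lift₀-widen : ∀ {b} (τ : Permutation′ b) y →
  lift₀ (lift₀ τ) ⟨$⟩ʳ punchIn (suc zero) y ≡ punchIn (suc zero) (lift₀ τ ⟨$⟩ʳ y)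
lift₀-widen τ zero    = refl
lift₀-widen τ (suc y) = refl

-- A class either attains every nonzero value or comes, by relabelling, from a
-- unique class with one value fewer.

size-split : ∀ k b {c d} → HasSize (FullClasses k (suc b)) c → HasSize (TableClasses k b) d →
             HasSize (TableClasses k (suc b)) (c + d)
size-split k b s t = size-resp
  (Symmetry.inverse (bijection⇒inverse (FullClasses k (suc b) ⊎ₛ TableClasses k b) (TableClasses k (suc b))
    h (λ {u} {v} → h-cong {u} {v}) (λ {u} {v} → h-inj {u} {v}) h-surj))
  (size-⊎ s t)
  where
  open Setoid (FullClasses k (suc b) ⊎ₛ TableClasses k b) using (_≈_) renaming (Carrier to Source)
  open Setoid (TableClasses k (suc b)) using () renaming (_≈_ to _≈⁺_)

  h : Source → Table k (suc b)
  h (inj₁ (f , _)) = f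
  h (inj₂ f)       = widen f

  h-cong : ∀ {u v} → u ≈ v → h u ≈⁺ h v
  h-cong (inj₁ p) = p
  h-cong {inj₂ f} (inj₂ ((σ , τ) , eq)) = (σ , lift₀ τ) , λ p →
    trans (lift₀-widen τ _) (cong (punchIn (suc zero)) (eq p))

  full-missed : ∀ {f g} → Full f → ¬ (f ≈⁺ widen g)
  -- A full table attains the value that `τ` relabels as `suc zero`, which `widen g` avoids.
  full-missed {f} {g} full ((σ , τ) , eq) with full (τ ⟨$⟩ˡ zero)
  ... | (x , y) , fp = Finₚ.punchInᵢ≢i (suc zero) (g (σ ⟨$⟩ʳ x , σ ⟨$⟩ʳ y)) (trans
    (sym (eq (σ ⟨$⟩ʳ x , σ ⟨$⟩ʳ y)))
    (trans (cong₂ (λ u v → lift₀ τ ⟨$⟩ʳ f (u , v)) (Perm.inverseˡ σ) (Perm.inverseˡ σ))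
      (trans (cong (lift₀ τ ⟨$⟩ʳ_) fp) (cong suc (Perm.inverseʳ τ)))))

  widen-inj : ∀ {f g} → widen f ≈⁺ widen g → Setoid._≈_ (TableClasses k b) f g
  widen-inj {f} {g} ((σ , τ) , eq) = (σ , Perm.remove zero ρ) , λ p → step (f _) (g p) (eq p)
    where
    -- `τ` may move the omitted value. A transposition brings its image back and disturbs no
    -- attained value, since these are different from both transposed points; the result fixes
    -- `zero` and restricts to the smaller set of values.
    ρ = τ Perm.∘ₚ Perm.transpose (τ ⟨$⟩ʳ zero) zero

    step : ∀ y z → lift₀ τ ⟨$⟩ʳ punchIn (suc zero) y ≡ punchIn (suc zero) z →
           lift₀ (Perm.remove zero ρ) ⟨$⟩ʳ y ≡ z
    step zero    zero    _  = refl
    step (suc y) (suc z) eq = trans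
      (Perm.lift₀-remove ρ (transpose-left (τ ⟨$⟩ʳ zero) zero) (suc y))
      (trans (transpose-other (τ ⟨$⟩ʳ zero) zero
          (λ e → 0≢suc (permutation-injective τ {suc y} {zero} e))
          (λ e → 0≢suc (trans (sym τy≡) e)))
        τy≡)
      where
      0≢suc : ∀ {n} {i : Fin n} → suc i ≢ zero
      0≢suc ()

      τy≡ : τ ⟨$⟩ʳ suc y ≡ suc z
      τy≡ = Finₚ.suc-injective eq

  h-inj : ∀ {u v} → h u ≈⁺ h v → u ≈ v
  h-inj {inj₁ _} {inj₁ _} p = inj₁ p
  h-inj {inj₁ (f , full)} {inj₂ g} p = ⊥-elim (full-missed {f} {g} full p)
  h-inj {inj₂ g} {inj₁ (f , full)} p =
    ⊥-elim (full-missed {f} {g} full (Setoid.sym (TableClasses k (suc b)) {widen g} {f} p))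
  h-inj {inj₂ f} {inj₂ g} p = inj₂ (widen-inj {f} {g} p)

  h-surj : ∀ f → Σ[ u ∈ Source ] h u ≈⁺ f
  h-surj f with full⊎missed f
  ... | inj₁ full = inj₁ (f , full) , Setoid.refl (TableClasses k (suc b)) {f}
  ... | inj₂ (y , missed) = inj₂ g ,
    Setoid.sym (TableClasses k (suc b)) {f} {widen g}
      ((Perm.id , τ) , λ p → sym (Finₚ.punchIn-punchOut (avoid p)))
    where
    -- This relabelling moves the missed value to the place that `widen` leaves out.
    τ = Perm.transpose y zero

    avoid : ∀ p → suc zero ≢ lift₀ τ ⟨$⟩ʳ f p
    avoid p eq = missed p (permutation-injective (lift₀ τ)
      (trans (sym eq) (cong suc (sym (transpose-left y zero)))))

    g : Table k b
    g p = punchOut (avoid p)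

difference : ∀ {p q r s : ℚ} → p ℚ.+ q ≡ r → q ≡ s → p ≡ r ℚ.- s
difference {p} {q} refl refl = sym (trans (ℚₚ.+-assoc p q (ℚ.- q))
  (trans (cong (p ℚ.+_) (ℚₚ.+-inverseʳ q)) (ℚₚ.+-identityʳ p)))

-- The bound a

largest-≤ : ∀ {P : ℕ → Set} (P? : ∀ m → Dec (P m)) u → largest P? u ≤ u
largest-≤ P? zero    = z≤n
largest-≤ P? (suc u) with P? (suc u)
... | yes _ = ℕₚ.≤-refl
... | no _  = ℕₚ.m≤n⇒m≤1+n (largest-≤ P? u)

≤-largest : ∀ {P : ℕ → Set} (P? : ∀ m → Dec (P m)) u {m} → m ≤ u → P m → m ≤ largest P? u
≤-largest P? zero    z≤n p = z≤n
≤-largest P? (suc u) {m} m≤ p with P? (suc u)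
... | yes _ = m≤
... | no ¬p with ℕₚ.m≤n⇒m<n∨m≡n m≤
...   | inj₁ (s≤s m≤u) = ≤-largest P? u m≤u p
...   | inj₂ refl      = ⊥-elim (¬p p)

-- Choosing for every nonzero value a cell that holds it is injective into the k² cells.
full⇒≤ : ∀ {k b} (f : Table k b) → Full f → b ≤ k * k
full⇒≤ {k} {b} f full = Finₚ.injective⇒≤ {b} {k * k} {λ y → uncurry Fin.combine (proj₁ (full y))}
  (λ {y} {z} eq → Finₚ.suc-injective (trans (sym (proj₂ (full y))) (trans
    (cong f (uncurry (cong₂ _,_) (Finₚ.combine-injective _ _ _ _ eq))) (proj₂ (full z)))))

0≤fromℕ : ∀ n → 0ℚ ℚ.≤ fromℕ n
0≤fromℕ n = ℚₚ.nonNegative⁻¹ (fromℕ n) {{ℚₚ.normalize-nonNeg n 1}}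

-- Here lies the origin of ½ and ¾. With n = k + b + 1 and candidate b + 1, the difference `x ℚ.- r`
-- is k + ½, whose square is k² + k + ¼, while n - ¾ is k + b + ¼. Comparing the two leaves b ≤ k²,
-- and `d` is the slack.
≤a : ∀ k b → b ≤ k * k → suc b ≤ a (k + suc b)
≤a k b b≤k² = ≤-largest (λ m → fromℕ m ≤? fromℕ n ℚ.+ ½ -√ (fromℕ n ℚ.- ℤ.+ 3 ℚ./ 4)) n
  (ℕₚ.m≤n+m (suc b) k)
  ( subst (0ℚ ℚ.≤_) (sym x-r) (ℚₚ.+-mono-≤ (0≤fromℕ k) (ℚₚ.nonNegative⁻¹ ½))
  , subst₂ ℚ._≤_ (ℚₚ.+-identityʳ y) square (ℚₚ.+-monoʳ-≤ y (0≤fromℕ d)))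
  where
  open ≡-Reasoning
  n = k + suc b
  K = fromℕ k
  B = fromℕ b
  d = k * k ∸ b
  D = fromℕ d
  x = fromℕ n ℚ.+ ½
  y = fromℕ n ℚ.- ℤ.+ 3 ℚ./ 4
  r = fromℕ (suc b)

  n≡ : fromℕ n ≡ K ℚ.+ (1ℚ ℚ.+ B)
  n≡ = trans (fromℕ-+ k (suc b)) (cong (K ℚ.+_) (fromℕ-+ 1 b))

  K² : K ℚ.* K ≡ B ℚ.+ D
  K² = trans (sym (fromℕ-* k k)) (trans (cong fromℕ (sym (ℕₚ.m+[n∸m]≡n b≤k²))) (fromℕ-+ b d))

  open ℚ-Solver

  x-r-identity : ∀ K B → K ℚ.+ (1ℚ ℚ.+ B) ℚ.+ ½ ℚ.- (1ℚ ℚ.+ B) ≡ K ℚ.+ ½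
  x-r-identity = solve 2 (λ K B → (K :+ (con 1ℚ :+ B)) :+ con ½ :- (con 1ℚ :+ B) := K :+ con ½) refl

  y-identity : ∀ K B D → K ℚ.+ (1ℚ ℚ.+ B) ℚ.- ℤ.+ 3 ℚ./ 4 ℚ.+ D ≡ B ℚ.+ D ℚ.+ K ℚ.+ ½ ℚ.* ½
  y-identity = solve 3 (λ K B D → (K :+ (con 1ℚ :+ B)) :+ con (ℚ.- (ℤ.+ 3 ℚ./ 4)) :+ D :=
    (B :+ D) :+ K :+ con ½ :* con ½) refl

  square-identity : ∀ K → K ℚ.* K ℚ.+ K ℚ.+ ½ ℚ.* ½ ≡ (K ℚ.+ ½) ℚ.* (K ℚ.+ ½)
  square-identity = solve 1 (λ K → K :* K :+ K :+ con ½ :* con ½ := (K :+ con ½) :* (K :+ con ½)) refl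

  x-r : x ℚ.- r ≡ K ℚ.+ ½
  x-r = trans (cong₂ (λ u v → u ℚ.+ ½ ℚ.- v) n≡ (fromℕ-+ 1 b)) (x-r-identity K B)

  square : y ℚ.+ D ≡ (x ℚ.- r) ℚ.* (x ℚ.- r)
  square = begin
    y ℚ.+ D                                      ≡⟨ cong (λ u → u ℚ.- ℤ.+ 3 ℚ./ 4 ℚ.+ D) n≡ ⟩
    K ℚ.+ (1ℚ ℚ.+ B) ℚ.- ℤ.+ 3 ℚ./ 4 ℚ.+ D       ≡⟨ y-identity K B D ⟩
    B ℚ.+ D ℚ.+ K ℚ.+ ½ ℚ.* ½                    ≡⟨ cong (λ u → u ℚ.+ K ℚ.+ ½ ℚ.* ½) (sym K²) ⟩
    K ℚ.* K ℚ.+ K ℚ.+ ½ ℚ.* ½                    ≡⟨ square-identity K ⟩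
    (K ℚ.+ ½) ℚ.* (K ℚ.+ ½)                      ≡⟨ cong₂ ℚ._*_ (sym x-r) (sym x-r) ⟩
    (x ℚ.- r) ℚ.* (x ℚ.- r)                      ∎

-- The semigroup of a table

module _ {k b : ℕ} (f : Table k b) where

  -- `inj₁` holds the generators and `inj₂` the square. A product with a factor from the square is
  -- zero, so both bracketings of a triple product are zero and associativity holds for any table.
  tableProduct : Fin k ⊎ Fin (suc b) → Fin k ⊎ Fin (suc b) → Fin k ⊎ Fin (suc b)
  tableProduct (inj₁ x) (inj₁ y) = inj₂ (f (x , y))
  tableProduct (inj₁ _) (inj₂ _) = inj₂ zero
  tableProduct (inj₂ _) _        = inj₂ zero

  tableProduct-assoc : ∀ u v w →
    tableProduct (tableProduct u v) w ≡ tableProduct u (tableProduct v w)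
  tableProduct-assoc (inj₁ _) (inj₁ _) (inj₁ _) = refl
  tableProduct-assoc (inj₁ _) (inj₁ _) (inj₂ _) = refl
  tableProduct-assoc (inj₁ _) (inj₂ _) _        = refl
  tableProduct-assoc (inj₂ _) _        _        = refl

  tableProduct-inj₂ : ∀ u v → Σ[ z ∈ Fin (suc b) ] inj₂ z ≡ tableProduct u v
  tableProduct-inj₂ (inj₁ x) (inj₁ y) = f (x , y) , refl
  tableProduct-inj₂ (inj₁ _) (inj₂ _) = zero , refl
  tableProduct-inj₂ (inj₂ _) _        = zero , refl

  tableProduct-triple : ∀ u v w → inj₂ zero ≡ tableProduct u (tableProduct v w)
  tableProduct-triple u        v w with tableProduct v w | tableProduct-inj₂ v w
  tableProduct-triple (inj₁ _) v w | _ | z , refl = refl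
  tableProduct-triple (inj₂ _) v w | _ | z , refl = refl

  tableProduct-factor : Full f → ∀ z → Σ[ u ∈ _ ] Σ[ v ∈ _ ] inj₂ z ≡ tableProduct u v
  tableProduct-factor full zero    = inj₂ zero , inj₂ zero , refl
  tableProduct-factor full (suc y) =
    inj₁ (proj₁ (proj₁ (full y))) , inj₁ (proj₂ (proj₁ (full y))) , cong inj₂ (sym (proj₂ (full y)))

  tableSemigroup : Semigroup 0ℓ 0ℓ
  tableSemigroup = record
    { Carrier     = Fin k ⊎ Fin (suc b)
    ; _≈_         = _≡_
    ; _∙_         = tableProduct
    ; isSemigroup = record
      { isMagma = record { isEquivalence = ≡.isEquivalence ; ∙-cong = cong₂ tableProduct }
      ; assoc   = tableProduct-assoc
      }
    }

  size-cube : HasSize (Power tableSemigroup 3) 1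
  size-cube = representatives⇒size (Power tableSemigroup 3) {1}
    (λ _ → inj₂ zero , inj₂ zero ∷ inj₂ zero ∷ inj₂ zero ∷ [] , refl)
    (λ { {zero} {zero} _ → refl })
    (λ { (s , u ∷ v ∷ w ∷ [] , eq) → zero , trans (tableProduct-triple u v w) (sym eq) })

  size-square : Full f → HasSize (Power tableSemigroup 2) (suc b)
  size-square full = representatives⇒size (Power tableSemigroup 2)
    (λ z → let u , v , eq = tableProduct-factor full z in inj₂ z , u ∷ v ∷ [] , eq)
    Sumₚ.inj₂-injective
    (λ { (s , u ∷ v ∷ [] , eq) →
      proj₁ (tableProduct-inj₂ u v) , trans (proj₂ (tableProduct-inj₂ u v)) (sym eq) })

-- The table has at least one nonzero value, `suc b` of them, so the square is larger than the cube
-- and the degree is exactly 3.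
nilpotentTable : ∀ {n k b} → k + suc (suc b) ≡ n → (f : Table k (suc b)) → Full f → NilpotentSemigroup3 n
nilpotentTable {n} {k} {b} eq f full = record
  { semigroup = tableSemigroup f
  ; order     = subst (HasSize (≡.setoid (Fin k ⊎ Fin (suc (suc b))))) eq (Symmetry.inverse Finₚ.+↔⊎)
  ; nilpotent = size-cube f , suc (suc b) , size-square f full , s≤s (s≤s z≤n)
  }

-- Isomorphisms

module _ (S T : Semigroup 0ℓ 0ℓ) where
  private
    module S = Semigroup S
    module T = Semigroup T
  open MagmaMorphisms S.rawMagma T.rawMagma

  mkMagmaIsomorphism : (φ : S.Carrier → T.Carrier) →
    (∀ {x y} → x S.≈ y → φ x T.≈ φ y) →
    (∀ x y → φ (x S.∙ y) T.≈ φ x T.∙ φ y) →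
    (∀ {x y} → φ x T.≈ φ y → x S.≈ y) →
    (∀ y → Σ[ x ∈ S.Carrier ] φ x T.≈ y) →
    IsMagmaIsomorphism φ
  mkMagmaIsomorphism φ φ-cong φ-homo φ-inj φ-surj = record
    { isMagmaMonomorphism = record
      { isMagmaHomomorphism = record
        { isRelHomomorphism = record { cong = φ-cong }
        ; homo              = φ-homo
        }
      ; injective = φ-inj
      }
    ; surjective = λ y → proj₁ (φ-surj y) , λ z≈x → T.trans (φ-cong z≈x) (proj₂ (φ-surj y))
    }

  isomorphism⇒squares : ∀ {φ} → IsMagmaIsomorphism φ → Inverse (Power S 2) (Power T 2)
  isomorphism⇒squares {φ} iso = bijection⇒inverse (Power S 2) (Power T 2)
    (λ { (s , u ∷ v ∷ [] , eq) → φ s , φ u ∷ φ v ∷ [] , T.trans (⟦⟧-cong eq) (homo u v) })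
    (λ { {_ , _ ∷ _ ∷ [] , _} {_ , _ ∷ _ ∷ [] , _} → ⟦⟧-cong })
    (λ { {_ , _ ∷ _ ∷ [] , _} {_ , _ ∷ _ ∷ [] , _} → injective })
    (λ { (t , u ∷ v ∷ [] , eq) →
      let x , φx = surjective u ; y , φy = surjective v in
      (x S.∙ y , x ∷ y ∷ [] , S.refl) ,
      T.trans (homo x y) (T.trans (T.∙-cong (φx S.refl) (φy S.refl)) (T.sym eq)) })
    where open IsMagmaIsomorphism iso

module _ {k b : ℕ} {f g : Table k b} where

  class⇒isomorphism : Setoid._≈_ (TableClasses k b) f g →
    ∃[ φ ] MagmaMorphisms.IsMagmaIsomorphism
      (Semigroup.rawMagma (tableSemigroup f)) (Semigroup.rawMagma (tableSemigroup g)) φ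
  class⇒isomorphism ((σ , τ) , eq) = φ , mkMagmaIsomorphism (tableSemigroup f) (tableSemigroup g)
    φ (cong φ) φ-homo (λ {x} {y} e → trans (sym (ψφ x)) (trans (cong ψ e) (ψφ y))) (λ y → ψ y , φψ y)
    where
    φ = Sum.map (σ ⟨$⟩ʳ_) (lift₀ τ ⟨$⟩ʳ_)
    ψ = Sum.map (σ ⟨$⟩ˡ_) (lift₀ τ ⟨$⟩ˡ_)

    φψ : ∀ y → φ (ψ y) ≡ y
    φψ (inj₁ y) = cong inj₁ (Perm.inverseʳ σ)
    φψ (inj₂ y) = cong inj₂ (Perm.inverseʳ (lift₀ τ))

    ψφ : ∀ x → ψ (φ x) ≡ x
    ψφ (inj₁ x) = cong inj₁ (Perm.inverseˡ σ)
    ψφ (inj₂ x) = cong inj₂ (Perm.inverseˡ (lift₀ τ))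

    φ-homo : ∀ x y → φ (tableProduct f x y) ≡ tableProduct g (φ x) (φ y)
    φ-homo (inj₁ x) (inj₁ y) = cong inj₂ (trans
      (cong₂ (λ u v → lift₀ τ ⟨$⟩ʳ f (u , v)) (sym (Perm.inverseˡ σ)) (sym (Perm.inverseˡ σ)))
      (eq (σ ⟨$⟩ʳ x , σ ⟨$⟩ʳ y)))
    φ-homo (inj₁ _) (inj₂ _) = refl
    φ-homo (inj₂ _) (inj₁ _) = refl
    φ-homo (inj₂ _) (inj₂ _) = refl

  -- Fullness makes the `inj₂` summand exactly the set of products, so `φ` preserves it together
  -- with its complement. The relabelling consists of the two restrictions, which are bijective
  -- because they are injective on finite sets.
  isomorphism⇒class : Full f → Full g → ∀ {φ} → MagmaMorphisms.IsMagmaIsomorphism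
      (Semigroup.rawMagma (tableSemigroup f)) (Semigroup.rawMagma (tableSemigroup g)) φ →
    Setoid._≈_ (TableClasses k b) f g
  isomorphism⇒class full-f full-g {φ} iso = (σ , Perm.remove zero τ) , λ { (x , y) →
    Sumₚ.inj₂-injective (act-table x y) }
    where
    open MagmaMorphisms.IsMagmaIsomorphism iso

    ψ : Fin k ⊎ Fin (suc b) → Fin k ⊎ Fin (suc b)
    ψ y = proj₁ (surjective y)

    φψ : ∀ y → φ (ψ y) ≡ y
    φψ y = proj₂ (surjective y) refl

    φ-inj₂ : ∀ z → Σ[ w ∈ Fin (suc b) ] inj₂ w ≡ φ (inj₂ z)
    φ-inj₂ z with tableProduct-factor f full-f z
    ... | u , v , eq = proj₁ p , trans (proj₂ p) (trans (sym (homo u v)) (cong φ (sym eq)))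
      where p = tableProduct-inj₂ g (φ u) (φ v)

    inj₂-φ : ∀ x w → φ x ≡ inj₂ w → Σ[ z ∈ Fin (suc b) ] inj₂ z ≡ x
    inj₂-φ x w eq with tableProduct-factor g full-g w
    ... | u , v , eq′ = proj₁ p , trans (proj₂ p) (injective (trans (homo (ψ u) (ψ v))
        (trans (cong₂ (tableProduct g) (φψ u) (φψ v)) (sym (trans eq eq′)))))
      where p = tableProduct-inj₂ f (ψ u) (ψ v)

    φ-inj₁ : ∀ x → Σ[ w ∈ Fin k ] inj₁ w ≡ φ (inj₁ x)
    φ-inj₁ x with φ (inj₁ x) in eq
    ... | inj₁ w = w , refl
    ... | inj₂ w with inj₂-φ (inj₁ x) w eq
    ...   | _ , ()

    σ : Permutation′ k
    σ = injective⇒↔ size-Fin size-Fin (λ x → proj₁ (φ-inj₁ x)) λ {x} {y} eq →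
      Sumₚ.inj₁-injective (injective
        (trans (sym (proj₂ (φ-inj₁ x))) (trans (cong inj₁ eq) (proj₂ (φ-inj₁ y)))))

    τ : Permutation′ (suc b)
    τ = injective⇒↔ size-Fin size-Fin (λ x → proj₁ (φ-inj₂ x)) λ {x} {y} eq →
      Sumₚ.inj₂-injective (injective
        (trans (sym (proj₂ (φ-inj₂ x))) (trans (cong inj₂ eq) (proj₂ (φ-inj₂ y)))))

    -- The zero is its own square, and the square of its image, an `inj₂` element, is again zero.
    τ-zero : τ ⟨$⟩ʳ zero ≡ zero
    τ-zero = Sumₚ.inj₂-injective (trans (proj₂ (φ-inj₂ zero)) (trans (homo (inj₂ zero) (inj₂ zero))
      (cong (λ u → tableProduct g u u) (sym (proj₂ (φ-inj₂ zero))))))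

    act-table : ∀ x y → inj₂ (lift₀ (Perm.remove zero τ) ⟨$⟩ʳ f (σ ⟨$⟩ˡ x , σ ⟨$⟩ˡ y)) ≡
                        tableProduct g (inj₁ x) (inj₁ y)
    act-table x y = begin
      inj₂ (lift₀ (Perm.remove zero τ) ⟨$⟩ʳ f (x′ , y′)) ≡⟨ cong inj₂ (Perm.lift₀-remove τ τ-zero (f (x′ , y′))) ⟩
      inj₂ (τ ⟨$⟩ʳ f (x′ , y′))                          ≡⟨ proj₂ (φ-inj₂ (f (x′ , y′))) ⟩
      φ (tableProduct f (inj₁ x′) (inj₁ y′))             ≡⟨ homo (inj₁ x′) (inj₁ y′) ⟩
      tableProduct g (φ (inj₁ x′)) (φ (inj₁ y′))         ≡⟨ cong₂ (tableProduct g)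
        (sym (proj₂ (φ-inj₁ x′))) (sym (proj₂ (φ-inj₁ y′))) ⟩
      tableProduct g (inj₁ (σ ⟨$⟩ʳ x′)) (inj₁ (σ ⟨$⟩ʳ y′)) ≡⟨ cong₂ (λ u v → tableProduct g (inj₁ u) (inj₁ v))
        (Perm.inverseʳ σ) (Perm.inverseʳ σ) ⟩
      tableProduct g (inj₁ x) (inj₁ y)                   ∎
      where
      open ≡-Reasoning
      x′ = σ ⟨$⟩ˡ x
      y′ = σ ⟨$⟩ˡ y

-- The table of a semigroup: its rows and columns are the elements outside the
-- square, its values the elements of the square, with the zero first.

module TableOf (S : Semigroup 0ℓ 0ℓ) {n b : ℕ} (order : HasSize (Semigroup.setoid S) n)
  (cube : HasSize (Power S 3) 1) (square : HasSize (Power S 2) (suc b)) where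

  open Semigroup S
    using (Carrier; _≈_; _∙_; ∙-cong; assoc; setoid)
    renaming (refl to ≈-refl; sym to ≈-sym; trans to ≈-trans)
  module E = Size order

  cube-element : Setoid.Carrier (Power S 3)
  cube-element = Size.from cube zero

  o : Carrier
  o = proj₁ cube-element

  triple≈o : ∀ x y z → x ∙ (y ∙ z) ≈ o
  triple≈o x y z = Size.to-injective cube {x ∙ (y ∙ z) , x ∷ y ∷ z ∷ [] , ≈-refl} {cube-element}
    (fin1-unique _ _)
    where
    fin1-unique : ∀ (i j : Fin 1) → i ≡ j
    fin1-unique zero zero = refl

  cube⊆square : Setoid.Carrier (Power S 3) → Setoid.Carrier (Power S 2)
  cube⊆square (s , x ∷ y ∷ z ∷ [] , eq) = s , x ∷ y ∙ z ∷ [] , eq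

  cube⊆square-≈ : ∀ e → proj₁ (cube⊆square e) ≈ proj₁ e
  cube⊆square-≈ (s , x ∷ y ∷ z ∷ [] , eq) = ≈-refl

  -- The given enumeration of the square may list the zero anywhere; `i₀` is its index there, to be
  -- exchanged with the first.
  i₀ : Fin (suc b)
  i₀ = Size.to square (cube⊆square cube-element)

  square₀ : HasSize (Power S 2) (suc b)
  square₀ = Compose.inverse square (Perm.transpose i₀ zero)

  module Sq = Size square₀

  o≡zero : ∀ e → proj₁ e ≈ o → Sq.to e ≡ zero
  o≡zero e e≈o = trans
    (cong (Perm.transpose i₀ zero ⟨$⟩ʳ_)
      (Size.to-cong square {e} {cube⊆square cube-element} (≈-trans e≈o (≈-sym (cube⊆square-≈ cube-element)))))
    (transpose-left i₀ zero)

  from-zero : proj₁ (Sq.from zero) ≈ o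
  from-zero = ≈-trans
    (Sq.to-injective {Sq.from zero} {e} (trans (Sq.to-from zero) (sym (o≡zero e (cube⊆square-≈ cube-element)))))
    (cube⊆square-≈ cube-element)
    where e = cube⊆square cube-element

  Decomposable : Carrier → Set
  Decomposable x = Σ[ u ∈ Carrier ] Σ[ v ∈ Carrier ] x ≈ u ∙ v

  decomposable? : ∀ x → Dec (Decomposable x)
  decomposable? x = map′
    (λ { (i , j , eq) → E.from i , E.from j , eq })
    (λ { (u , v , eq) → E.to u , E.to v ,
      ≈-trans eq (∙-cong (≈-sym (E.from-to u)) (≈-sym (E.from-to v))) })
    (Finₚ.any? λ i → Finₚ.any? λ j → E.≈-dec x (E.from i ∙ E.from j))

  square-decomposable : ∀ (e : Setoid.Carrier (Power S 2)) → Decomposable (proj₁ e)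
  square-decomposable (s , u ∷ v ∷ [] , eq) = u , v , eq

  decomposable-square : ∀ {x} → Decomposable x → Setoid.Carrier (Power S 2)
  decomposable-square {x} (u , v , eq) = x , u ∷ v ∷ [] , eq

  annihilatesʳ : ∀ x {y} → Decomposable y → x ∙ y ≈ o
  annihilatesʳ x (u , v , eq) = ≈-trans (∙-cong ≈-refl eq) (triple≈o x u v)

  annihilatesˡ : ∀ {x} y → Decomposable x → x ∙ y ≈ o
  annihilatesˡ y (u , v , eq) = ≈-trans (∙-cong eq ≈-refl) (≈-trans (assoc u v y) (triple≈o u v y))

  Generators : Setoid 0ℓ 0ℓ
  Generators = Sub setoid (λ x → ¬ Decomposable x)

  generators-finite : ∃[ k ] HasSize Generators k
  generators-finite = finite-quotient Generators (λ (x , _) (y , _) → E.≈-dec x y)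
    (λ i → select (E.from i) (decomposable? (E.from i)))
    (λ (x , ¬d) → E.to x , selected x ¬d (decomposable? (E.from (E.to x))))
    where
    select : ∀ x → Dec (Decomposable x) → Maybe (Setoid.Carrier Generators)
    select x (yes _) = nothing
    select x (no ¬d) = just (x , ¬d)

    selected : ∀ x → ¬ Decomposable x → (d : Dec (Decomposable (E.from (E.to x)))) →
      Σ[ y ∈ Setoid.Carrier Generators ] select (E.from (E.to x)) d ≡ just y × proj₁ y ≈ x
    selected x ¬d (no ¬d′)          = (_ , ¬d′) , refl , E.from-to x
    selected x ¬d (yes (u , v , eq)) = ⊥-elim (¬d (u , v , ≈-trans (≈-sym (E.from-to x)) eq))

  k : ℕ
  k = proj₁ generators-finite

  module Gen = Size (proj₂ generators-finite)

  -- The carrier is the disjoint union of the indecomposable elements and the square, because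
  -- decomposability is decidable.
  k+b≡n : k + suc b ≡ n
  k+b≡n = size-unique (size-resp (Symmetry.inverse (bijection⇒inverse (Generators ⊎ₛ Power S 2) setoid
      h (λ { (inj₁ p) → p ; (inj₂ p) → p }) (λ {u} {v} → h-inj u v) h-surj))
    (size-⊎ (proj₂ generators-finite) square)) order
    where
    h : Setoid.Carrier (Generators ⊎ₛ Power S 2) → Carrier
    h (inj₁ (x , _)) = x
    h (inj₂ (s , _)) = s

    h-inj : ∀ u v → h u ≈ h v → Setoid._≈_ (Generators ⊎ₛ Power S 2) u v
    h-inj (inj₁ _) (inj₁ _) p = inj₁ p
    h-inj (inj₂ _) (inj₂ _) p = inj₂ p
    h-inj (inj₁ (_ , ¬d)) (inj₂ e) p with square-decomposable e
    ... | u , v , eq = ⊥-elim (¬d (u , v , ≈-trans p eq))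
    h-inj (inj₂ e) (inj₁ (_ , ¬d)) p with square-decomposable e
    ... | u , v , eq = ⊥-elim (¬d (u , v , ≈-trans (≈-sym p) eq))

    h-surj : ∀ x → Σ[ u ∈ Setoid.Carrier (Generators ⊎ₛ Power S 2) ] h u ≈ x
    h-surj x with decomposable? x
    ... | yes d = inj₂ (decomposable-square d) , ≈-refl
    ... | no ¬d = inj₁ (x , ¬d) , ≈-refl

  generator : Fin k → Carrier
  generator x = proj₁ (Gen.from x)

  multiply : Carrier → Carrier → Setoid.Carrier (Power S 2)
  multiply x y = x ∙ y , x ∷ y ∷ [] , ≈-refl

  table : Table k b
  table (x , y) = Sq.to (multiply (generator x) (generator y))

  -- A product with a decomposable factor is zero, so every factorisation of a nonzero element of
  -- the square uses two generators.
  table-full : Full table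
  table-full y = attain (Sq.from (suc y)) (Sq.to-from (suc y))
    where
    attain : ∀ e → Sq.to e ≡ suc y → Σ[ p ∈ Fin k × Fin k ] table p ≡ suc y
    attain e@(s , u ∷ v ∷ [] , eq) to≡ with decomposable? u | decomposable? v
    ... | yes d | _     = ⊥-elim (Finₚ.0≢1+n (trans (sym (o≡zero e (≈-trans eq (annihilatesˡ v d)))) to≡))
    ... | no _  | yes d = ⊥-elim (Finₚ.0≢1+n (trans (sym (o≡zero e (≈-trans eq (annihilatesʳ u d)))) to≡))
    ... | no ¬u | no ¬v = (Gen.to (u , ¬u) , Gen.to (v , ¬v)) ,
      trans (Sq.to-cong {multiply _ _} {e}
        (≈-trans (∙-cong (Gen.from-to (u , ¬u)) (Gen.from-to (v , ¬v))) (≈-sym eq))) to≡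

  element : Fin k ⊎ Fin (suc b) → Carrier
  element (inj₁ x) = generator x
  element (inj₂ z) = proj₁ (Sq.from z)

  element-homo : ∀ u v → element (tableProduct table u v) ≈ element u ∙ element v
  element-homo (inj₁ x) (inj₁ y) = Sq.from-to (multiply (generator x) (generator y))
  element-homo (inj₁ x) (inj₂ z) = ≈-trans from-zero
    (≈-sym (annihilatesʳ (generator x) (square-decomposable (Sq.from z))))
  element-homo (inj₂ z) v        = ≈-trans from-zero
    (≈-sym (annihilatesˡ (element v) (square-decomposable (Sq.from z))))

  element-injective : ∀ u v → element u ≈ element v → u ≡ v
  element-injective (inj₁ x) (inj₁ y) eq =
    cong inj₁ (trans (sym (Gen.to-from x)) (trans (Gen.to-cong {Gen.from x} {Gen.from y} eq) (Gen.to-from y)))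
  element-injective (inj₂ x) (inj₂ y) eq =
    cong inj₂ (trans (sym (Sq.to-from x)) (trans (Sq.to-cong {Sq.from x} {Sq.from y} eq) (Sq.to-from y)))
  element-injective (inj₁ x) (inj₂ y) eq with square-decomposable (Sq.from y)
  ... | u , v , eq′ = ⊥-elim (proj₂ (Gen.from x) (u , v , ≈-trans eq eq′))
  element-injective (inj₂ x) (inj₁ y) eq with square-decomposable (Sq.from x)
  ... | u , v , eq′ = ⊥-elim (proj₂ (Gen.from y) (u , v , ≈-trans (≈-sym eq) eq′))

  element-surjective : ∀ x → Σ[ u ∈ Fin k ⊎ Fin (suc b) ] element u ≈ x
  element-surjective x with decomposable? x
  ... | yes d = inj₂ (Sq.to (decomposable-square d)) , Sq.from-to (decomposable-square d)
  ... | no ¬d = inj₁ (Gen.to (x , ¬d)) , Gen.from-to (x , ¬d)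

  table-isomorphic : ∃[ φ ] MagmaMorphisms.IsMagmaIsomorphism
    (Semigroup.rawMagma (tableSemigroup table)) (Semigroup.rawMagma S) φ
  table-isomorphic = element , mkMagmaIsomorphism (tableSemigroup table) S
    element (λ { refl → ≈-refl }) element-homo (λ {u} {v} → element-injective u v) element-surjective

-- Counting semigroups by the size of their square

squareSize : ∀ {n} → NilpotentSemigroup3 n → ℕ
squareSize S = proj₁ (proj₂ (NilpotentSemigroup3.nilpotent S))

squareSize-cong : ∀ {n} {S T : NilpotentSemigroup3 n} → S ≅ T → squareSize S ≡ squareSize T
squareSize-cong {S = S} {T} (_ , iso) = size-unique
  (proj₁ (proj₂ (proj₂ (NilpotentSemigroup3.nilpotent S))))
  (size-resp (isomorphism⇒squares (NilpotentSemigroup3.semigroup S) (NilpotentSemigroup3.semigroup T) iso) (proj₁ (proj₂ (proj₂ (NilpotentSemigroup3.nilpotent T)))))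

-- The number of generators found in `S` equals the prescribed `k` only up to a proof, so the table
-- is transported along it. Stating the isomorphism for every `eq` lets it survive that transport.
tableOf : ∀ {n k b} → k + suc (suc b) ≡ n → (S : NilpotentSemigroup3 n) → squareSize S ≡ suc (suc b) →
  Σ[ f ∈ Table k (suc b) ] Σ[ full ∈ Full f ] (∀ eq → nilpotentTable {n} eq f full ≅ S)
tableOf {n} {k} {b} eq S size≡ = move
  (ℕₚ.+-cancelʳ-≡ (suc (suc b)) T.k k (trans T.k+b≡n (sym eq)))
  (T.table , T.table-full , λ _ → T.table-isomorphic)
  where
  module S = NilpotentSemigroup3 S
  module T = TableOf S.semigroup S.order (proj₁ S.nilpotent)
    (subst (HasSize (Power S.semigroup 2)) size≡ (proj₁ (proj₂ (proj₂ S.nilpotent))))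

  Tabled : ℕ → Set
  Tabled k = Σ[ f ∈ Table k (suc b) ] Σ[ full ∈ Full f ] (∀ eq → nilpotentTable {n} eq f full ≅ S)

  move : ∀ {k′ k} → k′ ≡ k → Tabled k′ → Tabled k
  move refl t = t

squareSize-∈ : ∀ {n} (S : NilpotentSemigroup3 n) → squareSize S ∈ [ 2 ⋯ a n ]
squareSize-∈ {n} S = member (proj₁ (proj₂ (proj₂ S.nilpotent))) (proj₂ (proj₂ (proj₂ S.nilpotent)))
  where
  module S = NilpotentSemigroup3 S

  member : ∀ {m} → HasSize (Power S.semigroup 2) m → 1 < m → m ∈ [ 2 ⋯ a n ]
  member {suc (suc b)} sq _ = ∈-applyUpTo⁺ (2 +_) (ℕₚ.∸-monoˡ-≤ {suc (suc (suc b))} 2 (s≤s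
      (subst (λ n → suc (suc b) ≤ a n) T.k+b≡n (≤a T.k (suc b) (full⇒≤ T.table T.table-full)))))
    where module T = TableOf S.semigroup S.order (proj₁ S.nilpotent) sq
  member {suc zero} _ (s≤s ())

size-squareSize : ∀ {n k b c} → k + suc (suc b) ≡ n → HasSize (FullClasses k (suc b)) c →
  HasSize (Sub (NilpotentSemigroups3UpToIso n) (λ S → squareSize S ≡ suc (suc b))) c
size-squareSize {n} {k} {b} eq s = size-resp
  (Symmetry.inverse (bijection⇒inverse (FullClasses k (suc b)) _
    (λ (f , full) → nilpotentTable eq f full , refl)
    class⇒isomorphism
    (λ { {f , full-f} {g , full-g} (_ , iso) → isomorphism⇒class full-f full-g iso })
    (λ (S , size≡) → let f , full , iso = tableOf eq S size≡ in (f , full) , iso eq)))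
  s

-- Summation over the size of the square

size-by-index : ∀ {a ℓ} (X : Setoid a ℓ) (index : Setoid.Carrier X → ℕ) →
  (∀ {x y} → Setoid._≈_ X x y → index x ≡ index y) →
  ∀ {D} (F : ℕ → ℕ) → Unique D → (∀ x → index x ∈ D) →
  (∀ {d} → d ∈ D → HasSize (Sub X (λ x → index x ≡ d)) (F d)) →
  HasSize X (sum (map F D))
size-by-index X index index-cong {[]} F _ ∈D s = size-empty (λ x → absurd (∈D x))
  where
  absurd : ∀ {i : ℕ} → i ∈ [] → ⊥
  absurd ()
size-by-index X index index-cong {d ∷ D} F (d∉ ∷ u) ∈D s = size-resp
  (Symmetry.inverse (bijection⇒inverse (Xd ⊎ₛ XD) X
    h (λ { (inj₁ p) → p ; (inj₂ p) → p }) (λ {u} {v} → h-inj u v) (λ x → h-surj x (∈D x))))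
  (size-⊎ (s (here refl)) (size-by-index XD (index ∘ proj₁) index-cong F u proj₂ λ {e} e∈ →
    size-resp (bijection⇒inverse (Sub XD (λ x → index (proj₁ x) ≡ e)) (Sub X (λ x → index x ≡ e))
        (λ ((x , _) , eq) → x , eq) id id
        (λ (x , eq) → ((x , subst (_∈ D) (sym eq) e∈) , eq) , X.refl))
      (s (there e∈))))
  where
  module X = Setoid X
  Xd = Sub X (λ x → index x ≡ d)
  XD = Sub X (λ x → index x ∈ D)

  h : Setoid.Carrier (Xd ⊎ₛ XD) → X.Carrier
  h (inj₁ (x , _)) = x
  h (inj₂ (x , _)) = x

  h-inj : ∀ u v → h u X.≈ h v → Setoid._≈_ (Xd ⊎ₛ XD) u v
  h-inj (inj₁ _) (inj₁ _) p = inj₁ p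
  h-inj (inj₂ _) (inj₂ _) p = inj₂ p
  h-inj (inj₁ (_ , eq)) (inj₂ (_ , e∈)) p =
    ⊥-elim (All.lookup d∉ (subst (_∈ D) (trans (sym (index-cong p)) eq) e∈) refl)
  h-inj (inj₂ (_ , e∈)) (inj₁ (_ , eq)) p =
    ⊥-elim (All.lookup d∉ (subst (_∈ D) (trans (index-cong p) eq) e∈) refl)

  h-surj : ∀ x → index x ∈ d ∷ D → Σ[ u ∈ Setoid.Carrier (Xd ⊎ₛ XD) ] h u X.≈ x
  h-surj x (here eq)  = inj₁ (x , eq) , X.refl
  h-surj x (there e∈) = inj₂ (x , e∈) , X.refl

-- Both counts are outcomes of an exhaustive search through tables and relabellings. Only their
-- characterisation as sizes matters, so the values are sealed.
abstract

  fullCount : ℕ → ℕ → ℕ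
  fullCount n m = proj₁ (countFull (n ∸ m) (m ∸ 1))

  size-fullCount : ∀ n m → HasSize (FullClasses (n ∸ m) (m ∸ 1)) (fullCount n m)
  size-fullCount n m = proj₂ (countFull (n ∸ m) (m ∸ 1))

  restCount : ℕ → ℕ → ℕ
  restCount n m = proj₁ (countClasses (n ∸ m) (m ∸ 2))

  size-restCount : ∀ n m → HasSize (TableClasses (n ∸ m) (m ∸ 2)) (restCount n m)
  size-restCount n m = proj₂ (countClasses (n ∸ m) (m ∸ 2))

∈-[2⋯]⁻ : ∀ {m u} → m ∈ [ 2 ⋯ u ] → Σ[ b ∈ ℕ ] m ≡ suc (suc b) × m ≤ u
∈-[2⋯]⁻ {u = u} m∈ with ∈-applyUpTo⁻ (2 +_) m∈
... | b , b< , refl = b , refl , bound u b<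
  where
  bound : ∀ u → b < suc u ∸ 2 → suc (suc b) ≤ u
  bound (suc u) b<u = s≤s b<u

a≤ : ∀ n → a n ≤ n
a≤ n = largest-≤ (λ m → fromℕ m ≤? fromℕ n ℚ.+ ½ -√ (fromℕ n ℚ.- ℤ.+ 3 ℚ./ 4)) n

size-squareSize-a : ∀ n {m} → m ∈ [ 2 ⋯ a n ] →
  HasSize (Sub (NilpotentSemigroups3UpToIso n) (λ S → squareSize S ≡ m)) (fullCount n m)
size-squareSize-a n m∈ = sized (∈-[2⋯]⁻ m∈)
  where
  sized : ∀ {m} → Σ[ b ∈ ℕ ] m ≡ suc (suc b) × m ≤ a n →
    HasSize (Sub (NilpotentSemigroups3UpToIso n) (λ S → squareSize S ≡ m)) (fullCount n m)
  sized (b , refl , m≤a) = size-squareSize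
    (ℕₚ.m∸n+n≡m (ℕₚ.≤-trans m≤a (a≤ n))) (size-fullCount n (suc (suc b)))

-- Passing from (n , m) to (n - 1 , m - 1) keeps the number n - m of generators and lowers the
-- number of nonzero values by one. The subtracted term thus counts exactly the classes of tables
-- that miss a nonzero value.
fullCount-N : ∀ n {m} → m ∈ [ 2 ⋯ a n ] → fromℕ (fullCount n m) ≡ N n m ℚ.- N (n ∸ 1) (m ∸ 1)
fullCount-N n {m} m∈ = difference
  (trans (sym (fromℕ-+ (fullCount n m) (restCount n m))) (classes-N n m (all (∈-[2⋯]⁻ {u = a n} m∈))))
  (classes-N (n ∸ 1) (m ∸ 1) (missing (∈-[2⋯]⁻ {u = a n} m∈)))
  where
  all : ∀ {m u} → Σ[ b ∈ ℕ ] m ≡ suc (suc b) × m ≤ u →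
        HasSize (TableClasses (n ∸ m) (m ∸ 1)) (fullCount n m + restCount n m)
  all (b , refl , _) = size-split (n ∸ suc (suc b)) b
    (size-fullCount n (suc (suc b))) (size-restCount n (suc (suc b)))

  missing : ∀ {m u} → Σ[ b ∈ ℕ ] m ≡ suc (suc b) × m ≤ u →
            HasSize (TableClasses (n ∸ 1 ∸ (m ∸ 1)) (m ∸ 1 ∸ 1)) (restCount n m)
  missing (b , refl , _) =
    subst (λ k → HasSize (TableClasses k b) (restCount n (suc (suc b)))) (sym (ℕₚ.∸-+-assoc n 1 (suc b)))
      (size-restCount n (suc (suc b)))

[2⋯]-unique : ∀ u → Unique [ 2 ⋯ u ]
[2⋯]-unique u = Uniqueₚ.applyUpTo⁺₁ (2 +_) (suc u ∸ 2)
  (λ i<j _ eq → ℕₚ.<⇒≢ i<j (ℕₚ.+-cancelˡ-≡ 2 _ _ eq))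

theorem2p2 : (n : ℕ) → .{{_ : NonZero n}} →
    ∃[ c ] HasSize (NilpotentSemigroups3UpToIso n) c ×
    fromℕ c ≡ ∑ [ 2 ⋯ a n ] (λ m → N n m - N (n ∸ 1) (m ∸ 1))
theorem2p2 n = sum (map (fullCount n) [ 2 ⋯ a n ])
  , size-by-index (NilpotentSemigroups3UpToIso n) squareSize (λ {S} {T} → squareSize-cong {S = S} {T})
      (fullCount n) ([2⋯]-unique (a n)) squareSize-∈ (size-squareSize-a n)
  , trans (fromℕ-sum [ 2 ⋯ a n ] (fullCount n)) (Sumℚ.big-cong-∈ [ 2 ⋯ a n ] {λ m → fromℕ (fullCount n m)} {λ m → N n m - N (n ∸ 1) (m ∸ 1)} (fullCount-N n))
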